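{- Let $n,s\in\mathbb{N}$ with $s=O(\sqrt{n})$. Then $h(n,s)=\Omega((n/\log s)^{1/3})$. On the other hand, \[ h(n,s)=\begin{cases} O(\sqrt{n}) & \text{for } 2\le s\le n^{3/8},\\ O((n/s)^{4/5}) & \text{for } n^{3/8}\le s=O(\sqrt{n}).\end{cases} \]
   Context: For $n\ge s\ge 2$, $h(n,s)$ is the largest integer such that every set $P\subseteq\mathbb{R}^2$ of $n$ points with at most $s$ points on any line contains a subset of $h(n,s)$ points such that all lines through two points of the subset have pairwise distinct slopes (the subset determines pairwise distinct slopes). Here $s=s(n)$ may depend on $n$, and asymptotic notation refers to $n\to\infty$. -}

module Defs where

open import Level using (0ℓ)
open import Algebra.Bundles using (CommutativeRing)
open import Data.Nat as ℕ using (ℕ; zero; suc)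
open import Data.Fin using (Fin)
open import Data.List using (List; []; _∷_; length)
open import Data.Product using (Σ; ∃; _×_; _,_; proj₁)
open import Data.Sum using (_⊎_)
open import Relation.Nullary using (¬_)
open import Relation.Binary.PropositionalEquality using (_≡_; _≢_)
open import Function.Definitions using (Injective)

-- Real closed fields (the stand-in for ℝ).
-- The standard library has no real numbers.  The statement is about
-- finite point configurations and is (for fixed n, s, k) a first-order
-- sentence in the language of ordered fields, so by Tarski's transfer
-- principle it holds over ℝ iff it holds over every real closed field.

module Poly (R : CommutativeRing 0ℓ 0ℓ) where
  open CommutativeRing R
  monicEval : List Carrier → Carrier → Carrier
  monicEval []       x = 1#
  monicEval (a ∷ as) x = a + x * monicEval as x

record IsRealClosedField (R : CommutativeRing 0ℓ 0ℓ) : Set₁ where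
  open CommutativeRing R
  open Poly R
  infix 4 _<_
  field
    _<_          : Carrier → Carrier → Set
    <-resp-≈     : ∀ {a a′ b b′} → a ≈ a′ → b ≈ b′ → a < b → a′ < b′
    <-irrefl     : ∀ {a} → ¬ (a < a)
    <-trans      : ∀ {a b c} → a < b → b < c → a < c
    <-trichotomy : ∀ a b → a < b ⊎ a ≈ b ⊎ b < a
    +-mono-<     : ∀ {a b} c → a < b → a + c < b + c
    *-pos        : ∀ {a b} → 0# < a → 0# < b → 0# < a * b
    0<1          : 0# < 1#
    inverse      : ∀ a → ¬ (a ≈ 0#) → ∃ λ b → a * b ≈ 1#
    sqrt         : ∀ a → 0# < a → ∃ λ b → b * b ≈ a
    odd-root     : ∀ (m : ℕ) (as : List Carrier) → length as ≡ suc (2 ℕ.* m) →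
                   ∃ λ x → monicEval as x ≈ 0#

record RealClosedField : Set₂ where
  field
    commRing       : CommutativeRing 0ℓ 0ℓ
    isRealClosed   : IsRealClosedField commRing
  open CommutativeRing commRing public
  open IsRealClosedField isRealClosed public

module Plane (𝔽 : RealClosedField) where
  open RealClosedField 𝔽

  Point : Set
  Point = Carrier × Carrier

  x : Point → Carrier
  x (a , _) = a
  y : Point → Carrier
  y (_ , b) = b

  _≉ₚ_ : Point → Point → Set
  p ≉ₚ q = ¬ ((x p ≈ x q) × (y p ≈ y q))

  OnLine : Carrier → Carrier → Carrier → Point → Set
  OnLine a b c p = a * x p + b * y p ≈ c

  -- the line through p,q is parallel to the line through p′,q′
  -- (i.e. the two lines have the same slope; vertical lines have slope ∞)
  SameSlope : Point → Point → Point → Point → Set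
  SameSlope p q p′ q′ =
    (x q - x p) * (y q′ - y p′) ≈ (y q - y p) * (x q′ - x p′)

  PointSet : ℕ → Set
  PointSet n = Σ (Fin n → Point) λ P → ∀ i j → i ≢ j → P i ≉ₚ P j

  AtMostOnLine : ∀ {n} → ℕ → (Fin n → Point) → Set
  AtMostOnLine {n} s P =
    ∀ (a b c : Carrier) → ¬ ((a ≈ 0#) × (b ≈ 0#)) →
    ∀ (g : Fin (suc s) → Fin n) → Injective _≡_ _≡_ g →
    ¬ (∀ i → OnLine a b c (P (g i)))

  DistinctSlopes : ∀ {k} → (Fin k → Point) → Set
  DistinctSlopes {k} Q =
    ∀ (i j i′ j′ : Fin k) → i ≢ j → i′ ≢ j′ →
    ¬ ((i ≡ i′ × j ≡ j′) ⊎ (i ≡ j′ × j ≡ i′)) →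
    ¬ SameSlope (Q i) (Q j) (Q i′) (Q j′)

  HasDistinctSlopeSubset : ∀ {n} → ℕ → (Fin n → Point) → Set
  HasDistinctSlopeSubset {n} k P =
    ∃ λ (g : Fin k → Fin n) → Injective _≡_ _≡_ g × DistinctSlopes (λ i → P (g i))

  -- "k ≤ h(n,s)": every n-point set with at most s points on a line
  -- contains k points determining distinct slopes
  h≥ : ℕ → ℕ → ℕ → Set
  h≥ n s k = ∀ (P : PointSet n) → AtMostOnLine s (proj₁ P) →
             HasDistinctSlopeSubset k (proj₁ P)

  -- "h(n,s) ≤ k": some n-point set with at most s points on a line
  -- contains no k+1 points determining distinct slopes
  h≤ : ℕ → ℕ → ℕ → Set
  h≤ n s k = ∃ λ (P : PointSet n) → AtMostOnLine s (proj₁ P) ×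
             ¬ HasDistinctSlopeSubset (suc k) (proj₁ P)

{-# OPTIONS --safe #-}
module Submission where

-- Lower bound.  After a shear all abscissae are distinct.  A crossing-free straight-line graph has at
-- most three edges per vertex, by charging each edge to a vertex; sampling vertices at random turns this
-- into a crossing inequality, which, applied to the segments between consecutive points of the lines
-- with between t and 2t points, is the Szemerédi–Trotter bound.  Summing over dyadic t ≤ s = O(√n)
-- gives O(n² log s) collinear triples, hence O(n³ log s) quadruples spanning two parallel lines.
-- Deleting a point from every bad tuple inside a random subset leaves (n / log s)^(1/3) points.
--
-- Upper bounds.  On the parabola the slope of a chord is the sum of its parameters, so a subset with
-- distinct slopes is essentially a Sidon set.  For larger s take n / s² copies of the s × s grid in
-- general position: for each scale d the points of a large subset fall into few classes modulo d and
-- position, two points of a class differ by d times a short vector w, and the slope of w determines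
-- the two points and d; counting the pairs (d , w) bounds the subset.

open import Defs
open import Data.Bool using (Bool; true; false; T)
open import Data.Bool.Properties using (T?)
open import Data.Empty using (⊥; ⊥-elim)
open import Data.Fin using (Fin; zero; suc; _≟_; toℕ; fromℕ<; combine; inject≤; _↑ˡ_; _↑ʳ_; splitAt)
import Data.Fin.Properties as Fin
import Data.Integer.Properties as ℤ
import Data.Integer.Tactic.RingSolver as ℤ-Solver
open import Data.List using (List; []; _∷_; length; filter; cartesianProduct; map; _++_; lookup; allFin; upTo)
open import Data.List.Properties using (length-tabulate; length-upTo; length-map; length-++)
open import Data.List.Membership.Propositional using (_∈_; _∉_; find; lose)
open import Data.List.Membership.Propositional.Properties
open import Data.List.Relation.Unary.All as All using (All; []; _∷_)
open import Data.List.Relation.Unary.AllPairs using ([]; _∷_)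
open import Data.List.Relation.Unary.Any as Any using (here; there; index)
open import Data.List.Relation.Unary.Any.Properties using (lookup-index)
open import Data.List.Relation.Unary.Unique.DecPropositional using (unique?)
open import Data.List.Relation.Unary.Unique.Propositional using (Unique)
import Data.List.Relation.Unary.Unique.Propositional.Properties as Unique
open import Data.Maybe using (just; nothing)
open import Data.Nat as ℕ using (ℕ; zero; suc; ∣_-_∣)
open import Data.Nat.DivMod using (_/_; _%_; m%n<n; m≡m%n+[m/n]*n; m<n*o⇒m/o<n; m/n/o≡m/[n*o]; m/n*n≤m; /-congʳ; /-monoˡ-≤)
open import Data.Nat.Logarithm using (⌈log₂_⌉; ⌈log₂⌉-mono-≤; ⌈log₂2^n⌉≡n)
import Data.Nat.Properties as ℕ
open import Data.Nat.Tactic.RingSolver using (solve-∀)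
open import Data.Product using (∃; _×_; _,_; proj₁; proj₂)
open import Data.Product.Properties using (≡-dec; ,-injectiveˡ; ,-injectiveʳ)
open import Data.Sign as Sign using (Sign)
open import Data.Sum using (_⊎_; inj₁; inj₂)
open import Data.Vec as Vec using (Vec; []; _∷_; replicate; _[_]≔_)
import Data.Vec.Properties as Vec
open import Function using (_∘_; case_of_)
open import Function.Definitions using (Injective)
open import Relation.Binary.Definitions using (WeaklyDecidable; tri<; tri≈; tri>)
open import Relation.Binary.PropositionalEquality as ≡ using (_≡_; _≢_)
import Relation.Binary.Reasoning.Setoid
open import Relation.Nullary using (¬_; Dec; yes; no; contradiction; ¬?)
open import Relation.Nullary.Decidable using (_×-dec_; _→-dec_)
open import Relation.Unary using (Decidable)
import Algebra.Properties.Monoid.Mult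
import Algebra.Properties.Ring
import Algebra.Properties.Semiring.Mult
import Algebra.Solver.Ring
open import Algebra.Solver.Ring.AlmostCommutativeRing using (fromCommutativeRing; _-Raw-AlmostCommutative⟶_; Induced-equivalence)

-- Distinct abscissae make every edge the graph of an affine function over an interval with vertices
-- at both ends, so crossing is a sign change visible at vertices and planarity needs no topology.
-- Lines are not enumerated: a line with m points is weighed by its consecutive edges, at least m /
-- 2 of them. The hypothesis s = O(√n) keeps the term n t² of the incidence bound below O(n²), so
-- each dyadic class costs the same and their number gives the logarithm. A sample of density 1 / r
-- expects O(n² log s / r³) collinear triples and O(n³ log s / r⁴) parallel quadruples; both drop to
-- the order of its size n / r at r ≈ (n² log s)^(1/3), and n / r is the bound. In the grids,
-- n^(3/8) ≤ s serves to make n ≤ s³: at most s copies, so a line meeting each copy once is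
-- harmless. Many scales are used because they share the small vectors: with z copies, v scales and
-- vectors of size u ≈ s / v, a subset of K points has v K = O(z v³ + u²).

module Combinatorics where
  open import Data.Nat using (_+_; _*_; _^_; _≤_; z≤n; s≤s; _≤?_)
  open import Data.Nat.Properties hiding (_≟_)
  open import Relation.Binary.PropositionalEquality

  private variable
    A B : Set
    P Q : Set

  -- Finite sums, charging and extremal elements.

  χ : Dec P → ℕ
  χ (yes _) = 1
  χ (no _)  = 0

  χ-mono : (p : Dec P) (q : Dec Q) → (P → Q) → χ p ≤ χ q
  χ-mono (no _)  _       _ = z≤n
  χ-mono (yes _) (yes _) _ = ≤-refl
  χ-mono (yes p) (no ¬q) f = contradiction (f p) ¬q

  χ-yes : (p : Dec P) → P → χ p ≡ 1
  χ-yes (yes _) _ = refl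
  χ-yes (no ¬p) p = contradiction p ¬p

  χ*≤ : ∀ {m k} (p : Dec P) → (P → m ≤ k) → χ p * m ≤ k
  χ*≤ {m = m} (yes p) h = ≤-trans (≤-reflexive (*-identityˡ m)) (h p)
  χ*≤ (no _) _ = z≤n

  ∑ : List A → (A → ℕ) → ℕ
  ∑ []       f = 0
  ∑ (x ∷ xs) f = f x + ∑ xs f

  ∑-mono : ∀ (xs : List A) {f g : A → ℕ} → (∀ {x} → x ∈ xs → f x ≤ g x) → ∑ xs f ≤ ∑ xs g
  ∑-mono []       h = z≤n
  ∑-mono (x ∷ xs) h = +-mono-≤ (h (here refl)) (∑-mono xs (h ∘ there))

  ∑-cong : ∀ (xs : List A) {f g : A → ℕ} → (∀ x → f x ≡ g x) → ∑ xs f ≡ ∑ xs g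
  ∑-cong []       h = refl
  ∑-cong (x ∷ xs) h = cong₂ _+_ (h x) (∑-cong xs h)

  ∑-cong-∈ : ∀ (xs : List A) {f g : A → ℕ} → (∀ {x} → x ∈ xs → f x ≡ g x) → ∑ xs f ≡ ∑ xs g
  ∑-cong-∈ []       h = refl
  ∑-cong-∈ (x ∷ xs) h = cong₂ _+_ (h (here refl)) (∑-cong-∈ xs (h ∘ there))

  ∑-+ : ∀ (xs : List A) (f g : A → ℕ) → ∑ xs (λ x → f x + g x) ≡ ∑ xs f + ∑ xs g
  ∑-+ []       f g = refl
  ∑-+ (x ∷ xs) f g rewrite ∑-+ xs f g = lemma (f x) (g x) (∑ xs f) (∑ xs g)
    where
    lemma : ∀ a b c d → (a + b) + (c + d) ≡ (a + c) + (b + d)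
    lemma = solve-∀

  ∑-*ˡ : ∀ c (xs : List A) (f : A → ℕ) → ∑ xs (λ x → c * f x) ≡ c * ∑ xs f
  ∑-*ˡ c []       f = sym (*-zeroʳ c)
  ∑-*ˡ c (x ∷ xs) f = trans (cong (c * f x +_) (∑-*ˡ c xs f)) (sym (*-distribˡ-+ c (f x) (∑ xs f)))

  ∑-*ʳ : ∀ c (xs : List A) (f : A → ℕ) → ∑ xs (λ x → f x * c) ≡ ∑ xs f * c
  ∑-*ʳ c xs f = trans (∑-cong xs (λ x → *-comm (f x) c)) (trans (∑-*ˡ c xs f) (*-comm c (∑ xs f)))

  ∑-const : ∀ (xs : List A) c → ∑ xs (λ _ → c) ≡ length xs * c
  ∑-const []       c = refl
  ∑-const (x ∷ xs) c = cong (c +_) (∑-const xs c)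

  ∑-bound : ∀ (xs : List A) {f : A → ℕ} {c} → (∀ {x} → x ∈ xs → f x ≤ c) → ∑ xs f ≤ length xs * c
  ∑-bound xs {c = c} h = ≤-trans (∑-mono xs h) (≤-reflexive (∑-const xs c))

  ∑-swap : ∀ (xs : List A) (ys : List B) (f : A → B → ℕ) →
           ∑ xs (λ x → ∑ ys (f x)) ≡ ∑ ys (λ y → ∑ xs (λ x → f x y))
  ∑-swap []       ys f = sym (trans (∑-const ys 0) (*-zeroʳ (length ys)))
  ∑-swap (x ∷ xs) ys f = trans (cong (∑ ys (f x) +_) (∑-swap xs ys f))
                               (sym (∑-+ ys (f x) (λ y → ∑ xs (λ x → f x y))))

  ∑-∈ : ∀ {xs : List A} {x} (f : A → ℕ) → x ∈ xs → f x ≤ ∑ xs f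
  ∑-∈ f (here refl)        = m≤m+n _ _
  ∑-∈ f (there {y} x∈xs) = ≤-trans (∑-∈ f x∈xs) (m≤n+m _ (f y))

  ∑-++ : ∀ (xs ys : List A) (f : A → ℕ) → ∑ (xs ++ ys) f ≡ ∑ xs f + ∑ ys f
  ∑-++ []       ys f = refl
  ∑-++ (x ∷ xs) ys f = trans (cong (f x +_) (∑-++ xs ys f)) (sym (+-assoc (f x) (∑ xs f) (∑ ys f)))

  ∑-map : ∀ (g : A → B) xs (f : B → ℕ) → ∑ (map g xs) f ≡ ∑ xs (f ∘ g)
  ∑-map g []       f = refl
  ∑-map g (x ∷ xs) f = cong (f (g x) +_) (∑-map g xs f)

  ∑-× : ∀ (xs : List A) (ys : List B) (f : A × B → ℕ) →
        ∑ (cartesianProduct xs ys) f ≡ ∑ xs (λ x → ∑ ys (λ y → f (x , y)))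
  ∑-× []       ys f = refl
  ∑-× (x ∷ xs) ys f = trans (∑-++ (map (x ,_) ys) (cartesianProduct xs ys) f)
                            (cong₂ _+_ (∑-map (x ,_) ys f) (∑-× xs ys f))

  ∑-*-∑ : ∀ (xs : List A) (ys : List B) (f : A → ℕ) (g : B → ℕ) →
          ∑ xs (λ x → ∑ ys (λ y → f x * g y)) ≡ ∑ xs f * ∑ ys g
  ∑-*-∑ xs ys f g = trans (∑-cong xs (λ x → ∑-*ˡ (f x) ys g)) (∑-*ʳ (∑ ys g) xs f)

  ∑-filter : ∀ {R : A → Set} (R? : Decidable R) xs (f : A → ℕ) →
             ∑ (filter R? xs) f ≡ ∑ xs (λ x → χ (R? x) * f x)
  ∑-filter R? []       f = refl
  ∑-filter R? (x ∷ xs) f with R? x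
  ... | yes _ = cong₂ _+_ (sym (+-identityʳ (f x))) (∑-filter R? xs f)
  ... | no  _ = ∑-filter R? xs f

  length≡∑ : ∀ (xs : List A) → length xs ≡ ∑ xs (λ _ → 1)
  length≡∑ xs = sym (trans (∑-const xs 1) (*-identityʳ _))

  length-× : ∀ (xs : List A) (ys : List B) → length (cartesianProduct xs ys) ≡ length xs * length ys
  length-× xs ys = trans (length≡∑ (cartesianProduct xs ys)) (trans (∑-× xs ys (λ _ → 1))
    (trans (∑-cong xs (λ _ → sym (length≡∑ ys))) (∑-const xs (length ys))))

  length-filter≡∑ : ∀ {R : A → Set} (R? : Decidable R) xs → length (filter R? xs) ≡ ∑ xs (χ ∘ R?)
  length-filter≡∑ R? []       = refl
  length-filter≡∑ R? (x ∷ xs) with R? x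
  ... | yes _ = cong suc (length-filter≡∑ R? xs)
  ... | no  _ = length-filter≡∑ R? xs

  ∑χ≤1 : ∀ {R : A → Set} (R? : Decidable R) {xs} → Unique xs →
         (∀ {x y} → x ∈ xs → y ∈ xs → R x → R y → x ≡ y) → ∑ xs (χ ∘ R?) ≤ 1
  ∑χ≤1 R? {[]}     _          _ = z≤n
  ∑χ≤1 {R = R} R? {x ∷ xs} (x∉ ∷ u) h with R? x
  ... | no _  = ∑χ≤1 R? u (λ a b → h (there a) (there b))
  ... | yes r = s≤s (≤-trans (∑-mono xs bound) (≤-reflexive (trans (∑-const xs 0) (*-zeroʳ (length xs)))))
    where
    bound : ∀ {y} → y ∈ xs → χ (R? y) ≤ 0
    bound {y} y∈ with R? y
    ... | no _   = z≤n
    ... | yes r′ = contradiction (h (here refl) (there y∈) r r′) (All.lookup x∉ y∈)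

  lookup-injective : ∀ {xs : List A} → Unique xs → ∀ {i j} → lookup xs i ≡ lookup xs j → i ≡ j
  lookup-injective {xs = x ∷ xs} (x∉ ∷ u) {zero}  {zero}  eq = refl
  lookup-injective {xs = x ∷ xs} (x∉ ∷ u) {zero}  {suc j} eq = contradiction eq (All.lookup x∉ (∈-lookup j))
  lookup-injective {xs = x ∷ xs} (x∉ ∷ u) {suc i} {zero}  eq = contradiction (sym eq) (All.lookup x∉ (∈-lookup i))
  lookup-injective {xs = x ∷ xs} (x∉ ∷ u) {suc i} {suc j} eq = cong suc (lookup-injective u eq)

  -- Counting by charging. `R` may relate an element to several targets; only a target has to
  -- determine its source. Charges can thus be described by cases instead of being computed by a
  -- function.
  length-≤-via : ∀ {xs : List A} {ys : List B} (R : A → B → Set) → Unique xs →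
                 (∀ {x} → x ∈ xs → ∃ λ y → y ∈ ys × R x y) →
                 (∀ {x x′ y} → x ∈ xs → x′ ∈ xs → R x y → R x′ y → x ≡ x′) →
                 length xs ≤ length ys
  length-≤-via {xs = xs} {ys} R u total inj = Fin.injective⇒≤ {f = λ i → index (y∈ i)} λ {i} {j} eq →
      lookup-injective u (inj (∈-lookup i) (∈-lookup j) (r i)
        (subst (R _) (trans (lookup-index (y∈ j)) (trans (cong (lookup ys) (sym eq)) (sym (lookup-index (y∈ i))))) (r j)))
    where
    y∈ : ∀ i → proj₁ (total (∈-lookup {xs = xs} i)) ∈ ys
    y∈ i = proj₁ (proj₂ (total (∈-lookup {xs = xs} i)))
    r : ∀ i → R (lookup xs i) (proj₁ (total (∈-lookup {xs = xs} i)))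
    r i = proj₂ (proj₂ (total (∈-lookup {xs = xs} i)))

  χ-× : ∀ {P Q : Set} (p : Dec P) (q : Dec Q) → χ (p ×-dec q) ≡ χ p * χ q
  χ-× (yes _) (yes _) = refl
  χ-× (yes _) (no _)  = refl
  χ-× (no _)  _       = refl

  -- An element with nonzero `f` contributes at least 1 to the sum. This one inequality removes both
  -- the crossed edges of a sample and the vertices that spoil independence.
  length-zeros : ∀ {A : Set} (f : A → ℕ) xs → length xs ≤ length (filter (λ x → f x ℕ.≟ 0) xs) + ∑ xs f
  length-zeros f xs = ≤-trans
    (≤-trans (≤-reflexive (length≡∑ xs)) (∑-mono xs (λ {x} _ → pointwise (f x))))
    (≤-reflexive (trans (∑-+ xs (λ x → χ (f x ℕ.≟ 0)) f) (cong (_+ ∑ xs f) (sym (length-filter≡∑ (λ x → f x ℕ.≟ 0) xs)))))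
    where
    pointwise : ∀ m → 1 ≤ χ (m ℕ.≟ 0) + m
    pointwise zero    = ≤-refl
    pointwise (suc m) = m≤n⇒m≤o+n (χ (suc m ℕ.≟ 0)) (s≤s z≤n)

  ∑≡0 : ∀ {A : Set} {f : A → ℕ} {xs x} → ∑ xs f ≡ 0 → x ∈ xs → f x ≡ 0
  ∑≡0 {f = f} e x∈ = n≤0⇒n≡0 (≤-trans (∑-∈ f x∈) (≤-reflexive e))

  χ≡0 : ∀ {P : Set} (p : Dec P) → χ p ≡ 0 → ¬ P
  χ≡0 (no ¬p) _ = ¬p

  length-allFin : ∀ n → length (allFin n) ≡ n
  length-allFin n = length-tabulate {n = n} (λ i → i)

  ∑-filter-≤ : ∀ {A : Set} {R : A → Set} (R? : Decidable R) xs (f : A → ℕ) → ∑ (filter R? xs) f ≤ ∑ xs f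
  ∑-filter-≤ R? xs f = ≤-trans (≤-reflexive (∑-filter R? xs f)) (∑-mono xs (λ {x} _ → χ*≤ (R? x) (λ _ → ≤-refl)))

  -- An empty count is 0, so a count may be bounded with one of its members at hand; the argument
  -- can then refer to an object, such as a line, defined from that member.
  ∑χ-witness : ∀ {A : Set} {R : A → Set} (R? : Decidable R) xs {B} → (∀ x → R x → ∑ xs (χ ∘ R?) ≤ B) → ∑ xs (χ ∘ R?) ≤ B
  ∑χ-witness R? xs {B} h with Any.any? R? xs
  ... | yes p = let x , _ , r = find p in h x r
  ... | no ¬p = ≤-trans (∑-bound xs none) (≤-trans (≤-reflexive (*-zeroʳ (length xs))) z≤n)
    where
    none : ∀ {x} → x ∈ xs → χ (R? x) ≤ 0
    none {x} x∈ with R? x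
    ... | yes r = contradiction (lose x∈ r) ¬p
    ... | no _  = z≤n

  least : ∀ {P : ℕ → Set} → Decidable P → ∀ m → P m → ∃ λ k → P k × (∀ {j} → P j → k ≤ j)
  least P? zero    p = 0 , p , λ _ → z≤n
  least {P} P? (suc m) p with P? 0
  ... | yes p₀ = 0 , p₀ , λ _ → z≤n
  ... | no ¬p₀ with least (P? ∘ suc) m p
  ... | k , pk , min = suc k , pk , minimal
    where
    minimal : ∀ {j} → P j → suc k ≤ j
    minimal {zero}  q = contradiction q ¬p₀
    minimal {suc j} q = s≤s (min q)

  choose : ∀ {A : Set} {xs : List A} {m} → Unique xs → m ≤ length xs →
           ∃ λ (g : Fin m → A) → Injective _≡_ _≡_ g × (∀ i → g i ∈ xs)
  choose {xs = xs} u m≤ = (λ i → lookup xs (inject≤ i m≤))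
    , (λ eq → Fin.inject≤-injective m≤ m≤ _ _ (lookup-injective u eq))
    , (λ i → ∈-lookup (inject≤ i m≤))

  extremum : ∀ {A : Set} (_≼_ : A → A → Set) → (∀ {x y z} → x ≼ y → y ≼ z → x ≼ z) → (∀ x y → x ≼ y ⊎ y ≼ x) →
             ∀ {x} {xs : List A} → x ∈ xs → ∃ λ y → y ∈ xs × (∀ {z} → z ∈ xs → y ≼ z)
  extremum _≼_ tr total {xs = x ∷ []} _ = x , here refl , λ where (here refl) → reflex x
    where
    reflex : ∀ x → x ≼ x
    reflex x with total x x
    ... | inj₁ p = p
    ... | inj₂ p = p
  extremum _≼_ tr total {xs = x ∷ x′ ∷ xs} _ with extremum _≼_ tr total {xs = x′ ∷ xs} (here refl)
  ... | y , y∈ , least with total x y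
  ... | inj₁ x≼y = x , here refl , λ where
          (here refl) → case total x x of λ where (inj₁ p) → p ; (inj₂ p) → p
          (there z∈)    → tr x≼y (least z∈)
  ... | inj₂ y≼x = y , there y∈ , λ where
          (here refl) → y≼x
          (there z∈)    → least z∈

  -- Weighted sum over the subsets V of Fin n: an index outside V contributes the factor ρ,
  -- so that dividing by (1 + ρ)^n gives the expectation over a random V
  -- containing each index with probability 1 / (1 + ρ).

  module Expectation (ρ : ℕ) where

    𝔼 : ∀ {n} → (Vec Bool n → ℕ) → ℕ
    𝔼 {zero}  φ = φ []
    𝔼 {suc n} φ = 𝔼 (λ V → φ (true ∷ V)) + ρ * 𝔼 (λ V → φ (false ∷ V))

    𝔼-mono : ∀ {n} {φ ψ : Vec Bool n → ℕ} → (∀ V → φ V ≤ ψ V) → 𝔼 φ ≤ 𝔼 ψ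
    𝔼-mono {zero}  h = h []
    𝔼-mono {suc n} h = +-mono-≤ (𝔼-mono (λ V → h (true ∷ V))) (*-monoʳ-≤ ρ (𝔼-mono (λ V → h (false ∷ V))))

    𝔼-cong : ∀ {n} {φ ψ : Vec Bool n → ℕ} → (∀ V → φ V ≡ ψ V) → 𝔼 φ ≡ 𝔼 ψ
    𝔼-cong h = ≤-antisym (𝔼-mono (λ V → ≤-reflexive (h V))) (𝔼-mono (λ V → ≤-reflexive (sym (h V))))

    𝔼-+ : ∀ {n} (φ ψ : Vec Bool n → ℕ) → 𝔼 (λ V → φ V + ψ V) ≡ 𝔼 φ + 𝔼 ψ
    𝔼-+ {zero}  φ ψ = refl
    𝔼-+ {suc n} φ ψ
      rewrite 𝔼-+ (λ V → φ (true ∷ V)) (λ V → ψ (true ∷ V))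
            | 𝔼-+ (λ V → φ (false ∷ V)) (λ V → ψ (false ∷ V)) =
        lemma (𝔼 (λ V → φ (true ∷ V))) (𝔼 (λ V → ψ (true ∷ V))) (𝔼 (λ V → φ (false ∷ V))) (𝔼 (λ V → ψ (false ∷ V))) ρ
      where
      lemma : ∀ a b c d r → (a + b) + r * (c + d) ≡ (a + r * c) + (b + r * d)
      lemma = solve-∀

    𝔼-*ˡ : ∀ {n} c (φ : Vec Bool n → ℕ) → 𝔼 (λ V → c * φ V) ≡ c * 𝔼 φ
    𝔼-*ˡ {zero}  c φ = refl
    𝔼-*ˡ {suc n} c φ
      rewrite 𝔼-*ˡ c (λ V → φ (true ∷ V)) | 𝔼-*ˡ c (λ V → φ (false ∷ V)) =
        lemma c (𝔼 (λ V → φ (true ∷ V))) (𝔼 (λ V → φ (false ∷ V))) ρ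
      where
      lemma : ∀ c a b r → c * a + r * (c * b) ≡ c * (a + r * b)
      lemma = solve-∀

    𝔼-const : ∀ n c → 𝔼 {n} (λ _ → c) ≡ c * suc ρ ^ n
    𝔼-const zero    c = sym (*-identityʳ c)
    𝔼-const (suc n) c rewrite 𝔼-const n c = lemma c (suc ρ ^ n) ρ
      where
      lemma : ∀ c a r → c * a + r * (c * a) ≡ c * (a + r * a)
      lemma = solve-∀

    𝔼-∑ : ∀ {n} (xs : List A) (f : A → Vec Bool n → ℕ) → 𝔼 (λ V → ∑ xs (λ x → f x V)) ≡ ∑ xs (λ x → 𝔼 (f x))
    𝔼-∑ {n = n} []       f = 𝔼-const n 0
    𝔼-∑ (x ∷ xs) f = trans (𝔼-+ (f x) (λ V → ∑ xs (λ x → f x V))) (cong (𝔼 (f x) +_) (𝔼-∑ xs f))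

    𝔼-≤⇒∃ : ∀ {n} (φ ψ : Vec Bool n → ℕ) → 𝔼 φ ≤ 𝔼 ψ → ∃ λ V → φ V ≤ ψ V
    𝔼-≤⇒∃ {zero}  φ ψ h = [] , h
    𝔼-≤⇒∃ {suc n} φ ψ h
      with 𝔼 (λ V → φ (true ∷ V)) ≤? 𝔼 (λ V → ψ (true ∷ V))
         | 𝔼 (λ V → φ (false ∷ V)) ≤? 𝔼 (λ V → ψ (false ∷ V))
    ... | yes p | _     = let V , q = 𝔼-≤⇒∃ _ _ p in true ∷ V , q
    ... | no _  | yes p = let V , q = 𝔼-≤⇒∃ _ _ p in false ∷ V , q
    -- `ρ` may be 0, so strictness can only come from the `true` branch, whose weight is 1.
    ... | no p  | no q  = contradiction h (<⇒≱ (+-mono-<-≤ (≰⇒> p) (*-monoʳ-≤ ρ (<⇒≤ (≰⇒> q)))))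

    private
      sub : ∀ {n} → Vec Bool n → Vec Bool n → ℕ
      sub []          []      = 1
      sub (true ∷ S)  (b ∷ V) = χ (T? b) * sub S V
      sub (false ∷ S) (_ ∷ V) = sub S V

      card : ∀ {n} → Vec Bool n → ℕ
      card []          = 0
      card (true ∷ S)  = suc (card S)
      card (false ∷ S) = card S

      𝔼-sub : ∀ {n} (S : Vec Bool n) → 𝔼 (sub S) * suc ρ ^ card S ≡ suc ρ ^ n
      𝔼-sub [] = refl
      𝔼-sub {suc n} (true ∷ S) rewrite 𝔼-*ˡ 1 (sub S) | 𝔼-const n 0 =
        trans (lemma (𝔼 (sub S)) (suc ρ ^ card S) ρ) (cong (suc ρ *_) (𝔼-sub S))
        where
        lemma : ∀ a b r → (1 * a + r * 0) * (b + r * b) ≡ (1 + r) * (a * b)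
        lemma = solve-∀
      𝔼-sub (false ∷ S) =
        trans (*-assoc (suc ρ) (𝔼 (sub S)) _) (cong (suc ρ *_) (𝔼-sub S))

      card-insert : ∀ {n} (S : Vec Bool n) i → Vec.lookup S i ≡ false → card (S [ i ]≔ true) ≡ suc (card S)
      card-insert (false ∷ S) zero    _  = refl
      card-insert (true ∷ S)  (suc i) eq = cong suc (card-insert S i eq)
      card-insert (false ∷ S) (suc i) eq = card-insert S i eq

      sub-insert : ∀ {n} (S V : Vec Bool n) i → Vec.lookup S i ≡ false →
                   sub (S [ i ]≔ true) V ≡ χ (T? (Vec.lookup V i)) * sub S V
      sub-insert (false ∷ S) (b ∷ V) zero    _  = refl
      sub-insert (false ∷ S) (b ∷ V) (suc i) eq = sub-insert S V i eq
      sub-insert (true ∷ S)  (b ∷ V) (suc i) eq rewrite sub-insert S V i eq =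
        lemma (χ (T? b)) (χ (T? (Vec.lookup V i))) (sub S V)
        where
        lemma : ∀ a b c → a * (b * c) ≡ b * (a * c)
        lemma = solve-∀

      sub-replicate : ∀ {n} (V : Vec Bool n) → sub (replicate n false) V ≡ 1
      sub-replicate []      = refl
      sub-replicate (b ∷ V) = sub-replicate V

      card-replicate : ∀ n → card (replicate n false) ≡ 0
      card-replicate zero    = refl
      card-replicate (suc n) = card-replicate n

    contains : ∀ {n} → List (Fin n) → Vec Bool n → ℕ
    contains []      V = 1
    contains (i ∷ l) V = χ (T? (Vec.lookup V i)) * contains l V

    private
      -- Probabilities are computed by recursion on `n`, for which a bit vector is the right form of
      -- a set. Distinct entries make each insertion raise `card` by exactly one.
      asVec : ∀ {n} (l : List (Fin n)) → Unique l →
              ∃ λ S → (∀ i → i ∉ l → Vec.lookup S i ≡ false) × card S ≡ length l × (∀ V → sub S V ≡ contains l V)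
      asVec {n} [] _ = replicate n false , (λ i _ → Vec.lookup-replicate i false) , card-replicate n , sub-replicate
      asVec (i ∷ l) (i∉ ∷ u) =
        let S , out , c , s = asVec l u
            i∉S = out i (λ i∈ → All.lookup i∉ i∈ refl)
        in S [ i ]≔ true
         , (λ j j∉ → trans (Vec.lookup∘updateAt′ j i (j∉ ∘ here) S) (out j (j∉ ∘ there)))
         , trans (card-insert S i i∉S) (cong suc c)
         , λ V → trans (sub-insert S V i i∉S) (cong (χ (T? (Vec.lookup V i)) *_) (s V))

    -- Independence: distinct indices lie in V simultaneously with probability 1 / (1 + ρ) to the
    -- power of their number.
    𝔼-contains : ∀ {n} {l : List (Fin n)} → Unique l → 𝔼 (contains l) * suc ρ ^ length l ≡ suc ρ ^ n
    𝔼-contains {l = l} u with asVec l u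
    ... | S , _ , c , s = trans (cong₂ (λ a b → a * suc ρ ^ b) (sym (𝔼-cong s)) (sym c)) (𝔼-sub S)

    𝔼-length : ∀ {n} → 𝔼 {n} (λ V → length (filter (λ i → T? (Vec.lookup V i)) (allFin n))) * suc ρ ≡ n * suc ρ ^ n
    𝔼-length {n} = begin
        𝔼 (λ V → length (filter (λ i → T? (Vec.lookup V i)) (allFin n))) * suc ρ
          ≡⟨ cong (_* suc ρ) (trans (𝔼-cong size) (𝔼-∑ (allFin n) (λ i → contains (i ∷ [])))) ⟩
        ∑ (allFin n) (λ i → 𝔼 (contains (i ∷ []))) * suc ρ
          ≡⟨ ∑-*ʳ (suc ρ) (allFin n) _ ⟨
        ∑ (allFin n) (λ i → 𝔼 (contains (i ∷ [])) * suc ρ)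
          ≡⟨ ∑-cong (allFin n) (λ i → trans (cong (𝔼 (contains (i ∷ [])) *_) (sym (*-identityʳ (suc ρ)))) (𝔼-contains {l = i ∷ []} ([] ∷ []))) ⟩
        ∑ (allFin n) (λ _ → suc ρ ^ n)
          ≡⟨ ∑-const (allFin n) (suc ρ ^ n) ⟩
        length (allFin n) * suc ρ ^ n
          ≡⟨ cong (_* suc ρ ^ n) (length-allFin n) ⟩
        n * suc ρ ^ n ∎
      where
      open ≡-Reasoning
      size : ∀ V → length (filter (λ i → T? (Vec.lookup V i)) (allFin n)) ≡ ∑ (allFin n) (λ i → contains (i ∷ []) V)
      size V = trans (length-filter≡∑ (λ i → T? (Vec.lookup V i)) (allFin n)) (∑-cong (allFin n) (λ i → sym (*-identityʳ _)))

  -- Independent sets in sparse hypergraphs, by random sampling and deletion.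

  module Deletion {n : ℕ} (ρ : ℕ) where
    open Expectation ρ

    -- a hyperedge is stored as a vertex together with the remaining vertices
    Hyperedge : Set
    Hyperedge = Fin n × List (Fin n)

    vertices : Hyperedge → List (Fin n)
    vertices (i , l) = i ∷ l

    private
      r : ℕ
      r = suc ρ

      In? : ∀ (V : Vec Bool n) → Decidable (λ i → T (Vec.lookup V i))
      In? V i = T? (Vec.lookup V i)

      points : Vec Bool n → List (Fin n)
      points V = filter (In? V) (allFin n)

      -- The distinguished vertex of a hyperedge is the one to be deleted when the others are
      -- sampled; this counts the hyperedges that ask for the deletion of `i`.
      defect : List Hyperedge → Vec Bool n → Fin n → ℕ
      defect H V i = ∑ H (λ h → χ (proj₁ h Fin.≟ i) * contains (proj₂ h) V)

      ∑-defect : ∀ H V → ∑ (points V) (defect H V) ≤ ∑ H (λ h → contains (vertices h) V)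
      ∑-defect H V = begin
          ∑ (points V) (defect H V)
            ≡⟨ ∑-swap (points V) H _ ⟩
          ∑ H (λ h → ∑ (points V) (λ i → χ (proj₁ h Fin.≟ i) * contains (proj₂ h) V))
            ≡⟨ ∑-cong H (λ h → ∑-*ʳ (contains (proj₂ h) V) (points V) _) ⟩
          ∑ H (λ h → ∑ (points V) (λ i → χ (proj₁ h Fin.≟ i)) * contains (proj₂ h) V)
            ≤⟨ ∑-mono H (λ {h} _ → *-monoˡ-≤ (contains (proj₂ h) V) (single (proj₁ h))) ⟩
          ∑ H (λ h → contains (vertices h) V) ∎
        where
        open ≤-Reasoning
        outside : ∀ {i j} → ¬ T (Vec.lookup V j) → i ∈ points V → χ (j Fin.≟ i) ≤ 0
        outside {i} {j} j∉ i∈ with j Fin.≟ i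
        ... | no _     = z≤n
        ... | yes refl = contradiction (proj₂ (∈-filter⁻ (In? V) {xs = allFin n} i∈)) j∉
        single′ : ∀ j (d : Dec (T (Vec.lookup V j))) → ∑ (points V) (λ i → χ (j Fin.≟ i)) ≤ χ d
        single′ j (yes _) = ∑χ≤1 (j Fin.≟_) (Unique.filter⁺ (In? V) (Unique.allFin⁺ n)) (λ _ _ p q → trans (sym p) q)
        single′ j (no j∉) = ≤-trans (∑-bound (points V) (outside j∉)) (≤-reflexive (*-zeroʳ (length (points V))))
        single : ∀ j → ∑ (points V) (λ i → χ (j Fin.≟ i)) ≤ χ (In? V j)
        single j = single′ j (In? V j)

      contains-all : ∀ {V} l → All (_∈ points V) l → contains l V ≡ 1
      contains-all     []      []       = refl
      contains-all {V} (i ∷ l) (i∈ ∷ p) =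
        cong₂ _*_ (χ-yes (In? V i) (proj₂ (∈-filter⁻ (In? V) {xs = allFin n} i∈))) (contains-all l p)

      𝔼-uniform : ∀ {m} {H : List Hyperedge} → (∀ {h} → h ∈ H → Unique (vertices h) × length (vertices h) ≡ m) →
                  𝔼 (λ V → ∑ H (λ h → contains (vertices h) V)) * r ^ m ≡ length H * r ^ n
      𝔼-uniform {m} {H} u = trans (cong (_* r ^ m) (𝔼-∑ H (λ h → contains (vertices h))))
        (trans (sym (∑-*ʳ (r ^ m) H _)) (trans (∑-cong-∈ H each) (∑-const H (r ^ n))))
        where
        each : ∀ {h} → h ∈ H → 𝔼 (contains (vertices h)) * r ^ m ≡ r ^ n
        each {h} h∈ = trans (cong (λ m → 𝔼 (contains (vertices h)) * r ^ m) (sym (proj₂ (u h∈)))) (𝔼-contains (proj₁ (u h∈)))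

    -- With r = 1 + ρ, the numerical hypothesis says that a sample of density 1 / r contains on
    -- average |H₃| / r³ + |H₄| / r⁴ ≤ n / (2 r) hyperedges, half its expected size. Some sample
    -- does at least as well as the average, and one deletion per hyperedge leaves n / (2 r) points.
    independent-set : ∀ (H₃ H₄ : List Hyperedge) →
      (∀ {h} → h ∈ H₃ → Unique (vertices h) × length (vertices h) ≡ 3) →
      (∀ {h} → h ∈ H₄ → Unique (vertices h) × length (vertices h) ≡ 4) →
      2 * (suc ρ * length H₃ + length H₄) ≤ n * suc ρ ^ 3 →
      ∃ λ K → Unique K × n ≤ 2 * suc ρ * length K × (∀ {h} → h ∈ H₃ ++ H₄ → ¬ All (_∈ K) (vertices h))
    independent-set H₃ H₄ u₃ u₄ few =
      delete (𝔼-≤⇒∃ (λ V → n + 2 * r * count H V) (λ V → 2 * r * length (points V)) average)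
      where
      H : List Hyperedge
      H = H₃ ++ H₄
      count : List Hyperedge → Vec Bool n → ℕ
      count H V = ∑ H (λ h → contains (vertices h) V)
      open ≤-Reasoning
      p₄ : ∀ a r → 2 * r * a * (r * (r * (r * 1))) ≡ 2 * (a * (r * (r * (r * (r * 1)))))
      p₄ = solve-∀
      p₃ : ∀ a b r → 2 * ((a + b) * (r * (r * (r * (r * 1))))) ≡ 2 * (r * (a * (r * (r * (r * 1)))) + b * (r * (r * (r * (r * 1)))))
      p₃ = solve-∀
      p₂ : ∀ r a b c → 2 * (r * (a * c) + b * c) ≡ 2 * (r * a + b) * c
      p₂ = solve-∀
      p₁ : ∀ a b c → a * b * c ≡ a * c * b
      p₁ = solve-∀
      p₀ : ∀ a b → a * b + a * b ≡ 2 * (a * b)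
      p₀ = solve-∀
      p₋ : ∀ r a → 2 * (a * r) ≡ 2 * r * a
      p₋ = solve-∀
      cost : 2 * r * 𝔼 (count H) ≤ n * r ^ n
      cost = *-cancelʳ-≤ _ _ (r ^ 3) {{m^n≢0 r 3}} (begin
        2 * r * 𝔼 (count H) * r ^ 3                              ≡⟨ p₄ (𝔼 (count H)) r ⟩
        2 * (𝔼 (count H) * r ^ 4)                                ≡⟨ cong (λ a → 2 * (a * r ^ 4)) (trans (𝔼-cong {n} (λ V → ∑-++ H₃ H₄ (λ h → contains (vertices h) V))) (𝔼-+ (count H₃) (count H₄))) ⟩
        2 * ((𝔼 (count H₃) + 𝔼 (count H₄)) * r ^ 4)              ≡⟨ p₃ (𝔼 (count H₃)) (𝔼 (count H₄)) r ⟩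
        2 * (r * (𝔼 (count H₃) * r ^ 3) + 𝔼 (count H₄) * r ^ 4)  ≡⟨ cong₂ (λ a b → 2 * (r * a + b)) (𝔼-uniform u₃) (𝔼-uniform u₄) ⟩
        2 * (r * (length H₃ * r ^ n) + length H₄ * r ^ n)        ≡⟨ p₂ r (length H₃) (length H₄) (r ^ n) ⟩
        2 * (r * length H₃ + length H₄) * r ^ n                  ≤⟨ *-monoˡ-≤ (r ^ n) few ⟩
        n * r ^ 3 * r ^ n                                        ≡⟨ p₁ n (r ^ 3) (r ^ n) ⟩
        n * r ^ n * r ^ 3                                        ∎)
      average : 𝔼 (λ V → n + 2 * r * count H V) ≤ 𝔼 (λ V → 2 * r * length (points V))
      average = begin
        𝔼 (λ V → n + 2 * r * count H V)          ≡⟨ 𝔼-+ (λ _ → n) (λ V → 2 * r * count H V) ⟩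
        𝔼 {n} (λ _ → n) + 𝔼 (λ V → 2 * r * count H V) ≡⟨ cong₂ _+_ (𝔼-const n n) (𝔼-*ˡ (2 * r) (count H)) ⟩
        n * r ^ n + 2 * r * 𝔼 (count H)          ≤⟨ +-monoʳ-≤ (n * r ^ n) cost ⟩
        n * r ^ n + n * r ^ n                    ≡⟨ p₀ n (r ^ n) ⟩
        2 * (n * r ^ n)                          ≡⟨ cong (2 *_) (𝔼-length {n}) ⟨
        2 * (𝔼 (λ V → length (points V)) * r)    ≡⟨ p₋ r (𝔼 (λ V → length (points V))) ⟩
        2 * r * 𝔼 (λ V → length (points V))      ≡⟨ 𝔼-*ˡ (2 * r) (λ V → length (points V)) ⟨
        𝔼 (λ V → 2 * r * length (points V))      ∎
      delete : (∃ λ V → n + 2 * r * count H V ≤ 2 * r * length (points V)) →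
        ∃ λ K → Unique K × n ≤ 2 * r * length K × (∀ {h} → h ∈ H → ¬ All (_∈ K) (vertices h))
      delete (V , h) = filter kept? (points V) , Unique.filter⁺ kept? (Unique.filter⁺ (In? V) (Unique.allFin⁺ n)) , size , independent
        where
        kept? : ∀ i → Dec (defect H V i ≡ 0)
        kept? i = defect H V i ℕ.≟ 0
        size : n ≤ 2 * r * length (filter kept? (points V))
        size = +-cancelʳ-≤ (2 * r * ∑ H (λ h → contains (vertices h) V)) _ _ (begin
          n + 2 * r * ∑ H (λ h → contains (vertices h) V)   ≤⟨ h ⟩
          2 * r * length (points V)                         ≤⟨ *-monoʳ-≤ (2 * r) (≤-trans (length-zeros (defect H V) (points V)) (+-monoʳ-≤ _ (∑-defect H V))) ⟩
          2 * r * (length (filter kept? (points V)) + ∑ H (λ h → contains (vertices h) V)) ≡⟨ *-distribˡ-+ (2 * r) (length (filter kept? (points V))) _ ⟩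
          2 * r * length (filter kept? (points V)) + 2 * r * ∑ H (λ h → contains (vertices h) V) ∎)
        independent : ∀ {h} → h ∈ H → ¬ All (_∈ filter kept? (points V)) (vertices h)
        -- A hyperedge that survived would itself contribute 1 to the defect of its distinguished
        -- vertex, which is 0 for a kept vertex.
        independent {i , l} h∈ (i∈ ∷ l∈) = 1+n≢0 (trans (sym one)
            (∑≡0 {f = λ h → χ (proj₁ h Fin.≟ i) * contains (proj₂ h) V} (proj₂ (∈-filter⁻ kept? {xs = points V} i∈)) h∈))
          where
          one : χ (i Fin.≟ i) * contains l V ≡ 1
          one = cong₂ _*_ (χ-yes (i Fin.≟ i) refl) (contains-all l (All.map (λ k∈ → proj₁ (∈-filter⁻ kept? {xs = points V} k∈)) l∈))

open Combinatorics
open import Data.Integer as ℤ using (ℤ; +_; -[1+_]; _⊖_; _◃_)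

-- Ordered field arithmetic and affine functions.

module OrderedField (𝔽 : RealClosedField) where
  open RealClosedField 𝔽
  open Algebra.Properties.Ring ring
    using (-‿distribˡ-*; -‿distribʳ-*; -‿involutive; -0#≈0#; -‿+-comm)
  open Algebra.Properties.Semiring.Mult semiring using (×1-homo-*) renaming (_×_ to _·_)
  open Algebra.Properties.Monoid.Mult +-monoid using (×-homo-+)
  open Relation.Binary.Reasoning.Setoid setoid

  ιℕ : ℕ → Carrier
  ιℕ n = n · 1#

  ι : ℤ → Carrier
  ι (+ n)    = ιℕ n
  ι -[1+ n ] = - ιℕ (suc n)

  private
    cancel-1 : ∀ a b → (1# + a) - (1# + b) ≈ a - b
    cancel-1 a b = begin
      (1# + a) - (1# + b)     ≈⟨ +-congˡ (-‿+-comm 1# b) ⟨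
      (1# + a) + (- 1# - b)   ≈⟨ +-congʳ (+-comm 1# a) ⟩
      (a + 1#) + (- 1# - b)   ≈⟨ +-assoc a 1# _ ⟩
      a + (1# + (- 1# - b))   ≈⟨ +-congˡ (+-assoc 1# (- 1#) (- b)) ⟨
      a + ((1# - 1#) - b)     ≈⟨ +-congˡ (+-congʳ (-‿inverseʳ 1#)) ⟩
      a + (0# - b)            ≈⟨ +-congˡ (+-identityˡ _) ⟩
      a - b                   ∎

    ι-⊖ : ∀ m n → ι (m ⊖ n) ≈ ιℕ m - ιℕ n
    ι-⊖ zero    zero    = sym (-‿inverseʳ 0#)
    ι-⊖ zero    (suc n) = sym (+-identityˡ _)
    ι-⊖ (suc m) zero    = sym (trans (+-congˡ -0#≈0#) (+-identityʳ _))
    ι-⊖ (suc m) (suc n) rewrite ℤ.[1+m]⊖[1+n]≡m⊖n m n =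
      trans (ι-⊖ m n) (sym (cancel-1 (ιℕ m) (ιℕ n)))

  ι-+ : ∀ i j → ι (i ℤ.+ j) ≈ ι i + ι j
  ι-+ (+ m)    (+ n)    = ×-homo-+ 1# m n
  ι-+ (+ m)    -[1+ n ] = ι-⊖ m (suc n)
  ι-+ -[1+ m ] (+ n)    = trans (ι-⊖ n (suc m)) (+-comm _ _)
  ι-+ -[1+ m ] -[1+ n ] = begin
    - ιℕ (suc (suc (m ℕ.+ n)))        ≈⟨ -‿cong (reflexive (≡.cong (λ k → ιℕ (suc k)) (≡.sym (ℕ.+-suc m n)))) ⟩
    - ιℕ (suc m ℕ.+ suc n)            ≈⟨ -‿cong (×-homo-+ 1# (suc m) (suc n)) ⟩
    - (ιℕ (suc m) + ιℕ (suc n))       ≈⟨ -‿+-comm _ _ ⟨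
    - ιℕ (suc m) - ιℕ (suc n)         ∎

  ι-neg : ∀ i → ι (ℤ.- i) ≈ - ι i
  ι-neg (+ zero)  = sym -0#≈0#
  ι-neg (+ suc n) = refl
  ι-neg -[1+ n ]  = sym (-‿involutive _)

  private
    ι-◃- : ∀ n → ι (Sign.- ◃ n) ≈ - ιℕ n
    ι-◃- zero    = sym -0#≈0#
    ι-◃- (suc n) = refl

    ι-◃+ : ∀ n → ι (Sign.+ ◃ n) ≈ ιℕ n
    ι-◃+ zero    = refl
    ι-◃+ (suc n) = refl

  ι-* : ∀ i j → ι (i ℤ.* j) ≈ ι i * ι j
  ι-* (+ m)    (+ n)    = trans (ι-◃+ (m ℕ.* n)) (×1-homo-* m n)
  ι-* (+ m)    -[1+ n ] = trans (ι-◃- (m ℕ.* suc n)) (trans (-‿cong (×1-homo-* m (suc n))) (-‿distribʳ-* _ _))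
  ι-* -[1+ m ] (+ n)    = trans (ι-◃- (suc m ℕ.* n)) (trans (-‿cong (×1-homo-* (suc m) n)) (-‿distribˡ-* _ _))
  ι-* -[1+ m ] -[1+ n ] = begin
    ι (Sign.+ ◃ (suc m ℕ.* suc n))    ≈⟨ ι-◃+ (suc m ℕ.* suc n) ⟩
    ιℕ (suc m ℕ.* suc n)              ≈⟨ ×1-homo-* (suc m) (suc n) ⟩
    ιℕ (suc m) * ιℕ (suc n)           ≈⟨ -‿involutive _ ⟨
    - - (ιℕ (suc m) * ιℕ (suc n))     ≈⟨ -‿cong (-‿distribˡ-* _ _) ⟩
    - (- ιℕ (suc m) * ιℕ (suc n))     ≈⟨ -‿distribʳ-* _ _ ⟩
    - ιℕ (suc m) * - ιℕ (suc n)       ∎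

  ι-- : ∀ i j → ι (i ℤ.- j) ≈ ι i - ι j
  ι-- i j = trans (ι-+ i (ℤ.- j)) (+-congˡ (ι-neg j))

  private
    ι-morphism : ℤ.+-*-rawRing -Raw-AlmostCommutative⟶ fromCommutativeRing commRing
    ι-morphism = record
      { ⟦_⟧ = ι ; +-homo = ι-+ ; *-homo = ι-* ; -‿homo = ι-neg ; 0-homo = refl ; 1-homo = +-identityʳ 1# }

    ι-≟ : WeaklyDecidable (Induced-equivalence ι-morphism)
    ι-≟ i j with i ℤ.≟ j
    ... | yes eq = just (reflexive (≡.cong ι eq))
    ... | no _   = nothing

  module Solver = Algebra.Solver.Ring ℤ.+-*-rawRing (fromCommutativeRing commRing) ι-morphism ι-≟
  open Solver using (solve; _:=_; _:+_; _:*_; _:-_; :-_)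

  infix 4 _≤_ _<?_ _≈?_

  _≤_ : Carrier → Carrier → Set
  a ≤ b = ¬ (b < a)

  <-asym : ∀ {a b} → a < b → ¬ (b < a)
  <-asym p q = <-irrefl (<-trans p q)

  <⇒≤ : ∀ {a b} → a < b → a ≤ b
  <⇒≤ = <-asym

  <⇒≉ : ∀ {a b} → a < b → a ≉ b
  <⇒≉ p eq = <-irrefl (<-resp-≈ eq refl p)

  ≈⇒≤ : ∀ {a b} → a ≈ b → a ≤ b
  ≈⇒≤ eq p = <⇒≉ p (sym eq)

  ≤-refl : ∀ {a} → a ≤ a
  ≤-refl = <-irrefl

  _<?_ : ∀ a b → Dec (a < b)
  a <? b with <-trichotomy a b
  ... | inj₁ p        = yes p
  ... | inj₂ (inj₁ p) = no λ q → <⇒≉ q p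
  ... | inj₂ (inj₂ p) = no (<-asym p)

  _≈?_ : ∀ a b → Dec (a ≈ b)
  a ≈? b with <-trichotomy a b
  ... | inj₁ p        = no (<⇒≉ p)
  ... | inj₂ (inj₁ p) = yes p
  ... | inj₂ (inj₂ p) = no λ q → <⇒≉ p (sym q)

  ≤⇒<⊎≈ : ∀ {a b} → a ≤ b → a < b ⊎ a ≈ b
  ≤⇒<⊎≈ {a} {b} h with <-trichotomy a b
  ... | inj₁ p        = inj₁ p
  ... | inj₂ (inj₁ p) = inj₂ p
  ... | inj₂ (inj₂ p) = contradiction p h

  ≤-total : ∀ a b → a ≤ b ⊎ b ≤ a
  ≤-total a b with a <? b
  ... | yes p = inj₁ (<⇒≤ p)
  ... | no p  = inj₂ p

  ≤∧≉⇒< : ∀ {a b} → a ≤ b → a ≉ b → a < b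
  ≤∧≉⇒< h ne with ≤⇒<⊎≈ h
  ... | inj₁ p = p
  ... | inj₂ p = contradiction p ne

  ≤-antisym : ∀ {a b} → a ≤ b → b ≤ a → a ≈ b
  ≤-antisym p q with ≤⇒<⊎≈ p
  ... | inj₁ r = contradiction r q
  ... | inj₂ r = r

  ≤-<-trans : ∀ {a b c} → a ≤ b → b < c → a < c
  ≤-<-trans p q with ≤⇒<⊎≈ p
  ... | inj₁ r = <-trans r q
  ... | inj₂ r = <-resp-≈ (sym r) refl q

  <-≤-trans : ∀ {a b c} → a < b → b ≤ c → a < c
  <-≤-trans p q with ≤⇒<⊎≈ q
  ... | inj₁ r = <-trans p r
  ... | inj₂ r = <-resp-≈ refl r p

  ≤-trans : ∀ {a b c} → a ≤ b → b ≤ c → a ≤ c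
  ≤-trans p q r = p (≤-<-trans q r)

  ≤-resp-≈ : ∀ {a a′ b b′} → a ≈ a′ → b ≈ b′ → a ≤ b → a′ ≤ b′
  ≤-resp-≈ p q h r = h (<-resp-≈ (sym q) (sym p) r)

  <⇒0<- : ∀ {a b} → a < b → 0# < b - a
  <⇒0<- {a} {b} p = <-resp-≈ (-‿inverseʳ a) refl (+-mono-< (- a) p)

  0<-⇒< : ∀ {a b} → 0# < b - a → a < b
  0<-⇒< {a} {b} p = <-resp-≈ (+-identityˡ a) (solve 2 (λ a b → (b :- a) :+ a := b) refl a b) (+-mono-< a p)

  0<+ : ∀ {a b} → 0# < a → 0# < b → 0# < a + b
  0<+ {a} {b} p q = <-trans q (<-resp-≈ (+-identityˡ b) refl (+-mono-< b p))

  0≤+0< : ∀ {a b} → 0# ≤ a → 0# < b → 0# < a + b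
  0≤+0< {a} {b} p q with ≤⇒<⊎≈ p
  ... | inj₁ r = 0<+ r q
  ... | inj₂ r = <-resp-≈ refl (trans (sym (+-identityˡ b)) (+-congʳ r)) q

  0≤+ : ∀ {a b} → 0# ≤ a → 0# ≤ b → 0# ≤ a + b
  0≤+ {a} {b} p q with ≤⇒<⊎≈ q
  ... | inj₁ r = <⇒≤ (0≤+0< p r)
  ... | inj₂ r = ≤-resp-≈ refl (trans (sym (+-identityʳ a)) (+-congˡ r)) p

  0≤* : ∀ {a b} → 0# ≤ a → 0# ≤ b → 0# ≤ a * b
  0≤* {a} {b} p q with ≤⇒<⊎≈ p | ≤⇒<⊎≈ q
  ... | inj₁ r | inj₁ t = <⇒≤ (*-pos r t)
  ... | inj₂ r | _      = ≈⇒≤ (trans (sym (zeroˡ b)) (*-congʳ r))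
  ... | inj₁ _ | inj₂ t = ≈⇒≤ (trans (sym (zeroʳ a)) (*-congˡ t))

  ≤⇒0≤- : ∀ {a b} → a ≤ b → 0# ≤ b - a
  ≤⇒0≤- {a} {b} p q = p (<-resp-≈ (solve 2 (λ a b → (b :- a) :+ a := b) refl a b) (+-identityˡ a) (+-mono-< a q))

  *≈0⇒≈0 : ∀ {a b} → a ≉ 0# → a * b ≈ 0# → b ≈ 0#
  *≈0⇒≈0 {a} {b} a≉0 h = let a⁻¹ , e = inverse a a≉0 in begin
    b              ≈⟨ *-identityˡ b ⟨
    1# * b         ≈⟨ *-congʳ e ⟨
    a * a⁻¹ * b    ≈⟨ solve 3 (λ a i b → a :* i :* b := i :* (a :* b)) refl a a⁻¹ b ⟩
    a⁻¹ * (a * b)  ≈⟨ *-congˡ h ⟩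
    a⁻¹ * 0#       ≈⟨ zeroʳ _ ⟩
    0#             ∎

  -≈0⇒≈ : ∀ {a b} → a - b ≈ 0# → a ≈ b
  -≈0⇒≈ {a} {b} h = begin
    a            ≈⟨ solve 2 (λ a b → a := (a :- b) :+ b) refl a b ⟩
    (a - b) + b  ≈⟨ +-congʳ h ⟩
    0# + b       ≈⟨ +-identityˡ b ⟩
    b            ∎

  ≈⇒-≈0 : ∀ {a b} → a ≈ b → a - b ≈ 0#
  ≈⇒-≈0 {a} {b} h = trans (+-congʳ h) (-‿inverseʳ b)

  -≉0 : ∀ {a b} → a ≉ b → a - b ≉ 0#
  -≉0 a≉b p = a≉b (-≈0⇒≈ p)

  *-cancel : ∀ {a b c} → a ≉ b → a * c ≈ b * c → c ≈ 0#
  *-cancel {a} {b} {c} a≉b h = *≈0⇒≈0 (-≉0 a≉b)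
    (trans (solve 3 (λ a b c → (a :- b) :* c := a :* c :- b :* c) refl a b c) (≈⇒-≈0 h))

  0<ιsuc : ∀ n → 0# < ιℕ (suc n)
  0<ιsuc zero    = <-resp-≈ refl (sym (+-identityʳ 1#)) 0<1
  0<ιsuc (suc n) = 0<+ 0<1 (0<ιsuc n)

  ι-≈0 : ∀ i → ι i ≈ 0# → i ≡ + 0
  ι-≈0 (+ zero)  _ = ≡.refl
  ι-≈0 (+ suc n) p = contradiction (sym p) (<⇒≉ (0<ιsuc n))
  ι-≈0 -[1+ n ]  p = contradiction (trans (sym -0#≈0#) (trans (-‿cong (sym p)) (-‿involutive _))) (<⇒≉ (0<ιsuc n))

  ι-injective : ∀ {i j} → ι i ≈ ι j → i ≡ j
  ι-injective {i} {j} p = ℤ.i-j≡0⇒i≡j i j (ι-≈0 (i ℤ.- j) (trans (ι-- i j) (≈⇒-≈0 p)))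

  ιℕ-injective : ∀ {m n} → ιℕ m ≈ ιℕ n → m ≡ n
  ιℕ-injective {m} {n} p = ℤ.+-injective (ι-injective {+ m} {+ n} p)

  ι-cross : ∀ a b c d → ι ((a ℤ.- b) ℤ.* (c ℤ.- d)) ≈ (ι a - ι b) * (ι c - ι d)
  ι-cross a b c d = trans (ι-* (a ℤ.- b) (c ℤ.- d)) (*-cong (ι-- a b) (ι-- c d))

  -- Slope and intercept: vertical lines do not arise between points with distinct abscissae.
  Line : Set
  Line = Carrier × Carrier

  infixl 8 _⟪_⟫
  _⟪_⟫ : Line → Carrier → Carrier
  (m , c) ⟪ x ⟫ = m * x + c

  ⟪⟫-cong : ∀ L {x y} → x ≈ y → L ⟪ x ⟫ ≈ L ⟪ y ⟫
  ⟪⟫-cong (m , c) p = +-congʳ (*-congˡ p)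

  infix 4 _≈ₗ_
  _≈ₗ_ : Line → Line → Set
  (m , c) ≈ₗ (m′ , c′) = m ≈ m′ × c ≈ c′

  ≈ₗ-sym : ∀ {L M} → L ≈ₗ M → M ≈ₗ L
  ≈ₗ-sym (p , q) = sym p , sym q

  ≈ₗ-trans : ∀ {L M N} → L ≈ₗ M → M ≈ₗ N → L ≈ₗ N
  ≈ₗ-trans (p , q) (p′ , q′) = trans p p′ , trans q q′

  ⟪⟫-congₗ : ∀ {L M} → L ≈ₗ M → ∀ x → L ⟪ x ⟫ ≈ M ⟪ x ⟫
  ⟪⟫-congₗ (p , q) x = +-cong (*-congʳ p) q

  two-points : ∀ L M {x y} → x ≉ y → L ⟪ x ⟫ ≈ M ⟪ x ⟫ → L ⟪ y ⟫ ≈ M ⟪ y ⟫ → L ≈ₗ M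
  two-points (m , c) (m′ , c′) {x} {y} ne p q = m≈ , (begin
      c                     ≈⟨ solve 3 (λ m x c → c := (m :* x :+ c) :- m :* x) refl m x c ⟩
      (m * x + c) - m * x   ≈⟨ +-cong p (-‿cong (*-congʳ m≈)) ⟩
      (m′ * x + c′) - m′ * x ≈⟨ solve 3 (λ m x c → c := (m :* x :+ c) :- m :* x) refl m′ x c′ ⟨
      c′                    ∎)
    where
    m≈ : m ≈ m′
    m≈ = -≈0⇒≈ (*-cancel ne (-≈0⇒≈ (begin
      x * (m - m′) - y * (m - m′)
        ≈⟨ solve 6 (λ m m′ c c′ x y → x :* (m :- m′) :- y :* (m :- m′) :=
             ((m :* x :+ c) :- (m′ :* x :+ c′)) :- ((m :* y :+ c) :- (m′ :* y :+ c′))) refl m m′ c c′ x y ⟩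
      ((m * x + c) - (m′ * x + c′)) - ((m * y + c) - (m′ * y + c′))
        ≈⟨ +-cong (≈⇒-≈0 p) (-‿cong (≈⇒-≈0 q)) ⟩
      0# - 0#  ≈⟨ -‿inverseʳ 0# ⟩
      0#       ∎)))

  -- M - L is affine, so its value at v is a weighted mean of its values at u and w; the identity
  -- given to the solver is this mean multiplied by w - u.
  between : ∀ L M {u v w} → u ≤ v → v ≤ w → L ⟪ u ⟫ ≤ M ⟪ u ⟫ → L ⟪ w ⟫ ≤ M ⟪ w ⟫ → L ⟪ v ⟫ ≤ M ⟪ v ⟫
  between L@(m , c) M@(m′ , c′) {u} {v} {w} u≤v v≤w p q r with ≤⇒<⊎≈ u≤v | ≤⇒<⊎≈ v≤w
  ... | inj₂ e | _      = p (<-resp-≈ (⟪⟫-cong M (sym e)) (⟪⟫-cong L (sym e)) r)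
  ... | inj₁ _ | inj₂ e = q (<-resp-≈ (⟪⟫-cong M e) (⟪⟫-cong L e) r)
  ... | inj₁ a | inj₁ b = <-irrefl (<-resp-≈ refl (solve 7 (λ m c m′ c′ u v w →
          ((w :- v) :* ((m′ :* u :+ c′) :- (m :* u :+ c)) :+ (v :- u) :* ((m′ :* w :+ c′) :- (m :* w :+ c)))
          :+ (w :- u) :* ((m :* v :+ c) :- (m′ :* v :+ c′)) := Solver.con (+ 0)) refl m c m′ c′ u v w)
        (0≤+0< (0≤+ (0≤* (≤⇒0≤- v≤w) (≤⇒0≤- p)) (0≤* (≤⇒0≤- u≤v) (≤⇒0≤- q)))
               (*-pos (<⇒0<- (<-trans a b)) (<⇒0<- r))))

  steeper : ∀ L M {x₀ x} → L ⟪ x₀ ⟫ ≈ M ⟪ x₀ ⟫ → x₀ < x → proj₁ L < proj₁ M → L ⟪ x ⟫ < M ⟪ x ⟫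
  steeper (m , c) (m′ , c′) {x₀} {x} p x₀<x h = 0<-⇒< (<-resp-≈ refl (begin
      (m′ - m) * (x - x₀)
        ≈⟨ +-identityʳ _ ⟨
      (m′ - m) * (x - x₀) + 0#
        ≈⟨ +-congˡ (≈⇒-≈0 (sym p)) ⟨
      (m′ - m) * (x - x₀) + ((m′ * x₀ + c′) - (m * x₀ + c))
        ≈⟨ solve 6 (λ m m′ c c′ x y → (m′ :- m) :* (x :- y) :+ ((m′ :* y :+ c′) :- (m :* y :+ c)) :=
             (m′ :* x :+ c′) :- (m :* x :+ c)) refl m m′ c c′ x x₀ ⟩
      (m′ * x + c′) - (m * x + c) ∎) (*-pos (<⇒0<- h) (<⇒0<- x₀<x)))

-- Natural number estimates for the incidence bound.

m<n+m/n*n : ∀ m n .{{_ : ℕ.NonZero n}} → m ℕ.< n ℕ.+ m / n ℕ.* n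
m<n+m/n*n m n = ℕ.≤-<-trans (ℕ.≤-reflexive (m≡m%n+[m/n]*n m n)) (ℕ.+-monoˡ-< (m / n ℕ.* n) (m%n<n m n))

-- For E ≥ 6 n take r = ⌊E / 6n⌋. The term 3 n r³ t² is then at most half of E r² t², so r² t² ≤ 8
-- E; and E ≤ 12 n r turns this into t² E ≤ 12² · 8 n² = 1152 n². For smaller E the second summand
-- suffices.
edges-arithmetic : ∀ n t E .{{_ : ℕ.NonZero n}} →
  (∀ ρ → E ℕ.* suc ρ ℕ.^ 2 ℕ.* (t ℕ.* t) ℕ.≤ 3 ℕ.* n ℕ.* suc ρ ℕ.^ 3 ℕ.* (t ℕ.* t) ℕ.+ 4 ℕ.* (E ℕ.* E)) →
  t ℕ.* t ℕ.* E ℕ.≤ n ℕ.* n ℕ.* 1152 ℕ.+ 6 ℕ.* n ℕ.* (t ℕ.* t)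
edges-arithmetic n t E h with E ℕ.<? 6 ℕ.* n
... | yes small = ℕ.≤-trans (ℕ.*-monoʳ-≤ (t ℕ.* t) (ℕ.<⇒≤ small))
        (ℕ.≤-trans (ℕ.≤-reflexive (ℕ.*-comm (t ℕ.* t) (6 ℕ.* n))) (ℕ.m≤n+m (6 ℕ.* n ℕ.* (t ℕ.* t)) (n ℕ.* n ℕ.* 1152)))
... | no large = ℕ.≤-trans (ℕ.*-cancelˡ-≤ E {{E≢0}} final) (ℕ.m≤m+n (n ℕ.* n ℕ.* 1152) (6 ℕ.* n ℕ.* (t ℕ.* t)))
  where
  open ℕ.≤-Reasoning
  instance
    6n≢0 : ℕ.NonZero (6 ℕ.* n)
    6n≢0 = ℕ.m*n≢0 6 n
  r : ℕ
  r = E / (6 ℕ.* n)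
  6n≤E : 6 ℕ.* n ℕ.≤ E
  6n≤E = ℕ.≮⇒≥ large
  E≢0 : ℕ.NonZero E
  E≢0 = ℕ.>-nonZero (ℕ.<-≤-trans (ℕ.>-nonZero⁻¹ (6 ℕ.* n)) 6n≤E)
  below : r ℕ.* (6 ℕ.* n) ℕ.≤ E
  below = m/n*n≤m E (6 ℕ.* n)
  r≥1 : 1 ℕ.≤ r
  r≥1 with r in eq
  ... | suc _ = ℕ.s≤s ℕ.z≤n
  ... | zero  = contradiction (≡.subst (λ q → E ℕ.< 6 ℕ.* n ℕ.+ q ℕ.* (6 ℕ.* n)) eq (m<n+m/n*n E (6 ℕ.* n)))
                  (ℕ.≤⇒≯ (ℕ.≤-trans (ℕ.≤-reflexive (ℕ.+-identityʳ (6 ℕ.* n))) 6n≤E))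
  above : E ℕ.≤ 12 ℕ.* n ℕ.* r
  above = begin
    E                                    ≤⟨ ℕ.<⇒≤ (m<n+m/n*n E (6 ℕ.* n)) ⟩
    6 ℕ.* n ℕ.+ r ℕ.* (6 ℕ.* n)          ≤⟨ ℕ.+-monoˡ-≤ (r ℕ.* (6 ℕ.* n)) (ℕ.≤-trans (ℕ.≤-reflexive (≡.sym (ℕ.*-identityˡ (6 ℕ.* n)))) (ℕ.*-monoˡ-≤ (6 ℕ.* n) r≥1)) ⟩
    r ℕ.* (6 ℕ.* n) ℕ.+ r ℕ.* (6 ℕ.* n)  ≡⟨ lemma r n ⟩
    12 ℕ.* n ℕ.* r                       ∎
    where
    lemma : ∀ r n → r ℕ.* (6 ℕ.* n) ℕ.+ r ℕ.* (6 ℕ.* n) ≡ 12 ℕ.* n ℕ.* r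
    lemma = solve-∀
  at : ∀ r → 1 ℕ.≤ r → E ℕ.* r ℕ.^ 2 ℕ.* (t ℕ.* t) ℕ.≤ 3 ℕ.* n ℕ.* r ℕ.^ 3 ℕ.* (t ℕ.* t) ℕ.+ 4 ℕ.* (E ℕ.* E)
  at (suc ρ) _ = h ρ
  A : ℕ
  A = E ℕ.* r ℕ.^ 2 ℕ.* (t ℕ.* t)
  A≤8EE : A ℕ.≤ 8 ℕ.* (E ℕ.* E)
  A≤8EE = ℕ.+-cancelˡ-≤ A _ _ (begin
    A ℕ.+ A                                                      ≤⟨ ℕ.+-mono-≤ (at r r≥1) (at r r≥1) ⟩
    (3 ℕ.* n ℕ.* r ℕ.^ 3 ℕ.* (t ℕ.* t) ℕ.+ 4 ℕ.* (E ℕ.* E)) ℕ.+ (3 ℕ.* n ℕ.* r ℕ.^ 3 ℕ.* (t ℕ.* t) ℕ.+ 4 ℕ.* (E ℕ.* E)) ≡⟨ lemma n r t E ⟩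
    r ℕ.* (6 ℕ.* n) ℕ.* (r ℕ.^ 2 ℕ.* (t ℕ.* t)) ℕ.+ 8 ℕ.* (E ℕ.* E)  ≤⟨ ℕ.+-monoˡ-≤ _ (ℕ.*-monoˡ-≤ (r ℕ.^ 2 ℕ.* (t ℕ.* t)) below) ⟩
    E ℕ.* (r ℕ.^ 2 ℕ.* (t ℕ.* t)) ℕ.+ 8 ℕ.* (E ℕ.* E)            ≡⟨ ≡.cong (ℕ._+ 8 ℕ.* (E ℕ.* E)) (ℕ.*-assoc E (r ℕ.^ 2) (t ℕ.* t)) ⟨
    A ℕ.+ 8 ℕ.* (E ℕ.* E)                                        ∎)
    where
    lemma : ∀ n r t E → (3 ℕ.* n ℕ.* (r ℕ.* (r ℕ.* (r ℕ.* 1))) ℕ.* (t ℕ.* t) ℕ.+ 4 ℕ.* (E ℕ.* E)) ℕ.+ (3 ℕ.* n ℕ.* (r ℕ.* (r ℕ.* (r ℕ.* 1))) ℕ.* (t ℕ.* t) ℕ.+ 4 ℕ.* (E ℕ.* E))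
            ≡ r ℕ.* (6 ℕ.* n) ℕ.* ((r ℕ.* (r ℕ.* 1)) ℕ.* (t ℕ.* t)) ℕ.+ 8 ℕ.* (E ℕ.* E)
    lemma = solve-∀
  final : E ℕ.* (t ℕ.* t ℕ.* E) ℕ.≤ E ℕ.* (n ℕ.* n ℕ.* 1152)
  final = begin
    E ℕ.* (t ℕ.* t ℕ.* E)                                   ≡⟨ l₁ E t ⟩
    E ℕ.* E ℕ.* (t ℕ.* t)                                   ≤⟨ ℕ.*-monoˡ-≤ (t ℕ.* t) (ℕ.*-mono-≤ above above) ⟩
    12 ℕ.* n ℕ.* r ℕ.* (12 ℕ.* n ℕ.* r) ℕ.* (t ℕ.* t)       ≡⟨ l₂ n r t ⟩
    n ℕ.* n ℕ.* 144 ℕ.* (r ℕ.^ 2 ℕ.* (t ℕ.* t))           ≤⟨ ℕ.*-monoʳ-≤ (n ℕ.* n ℕ.* 144) (ℕ.*-cancelˡ-≤ E {{E≢0}}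
                                                                 (ℕ.≤-trans (ℕ.≤-reflexive (≡.sym (ℕ.*-assoc E (r ℕ.^ 2) (t ℕ.* t)))) (ℕ.≤-trans A≤8EE (ℕ.≤-reflexive (l₃ E))))) ⟩
    n ℕ.* n ℕ.* 144 ℕ.* (8 ℕ.* E)                         ≡⟨ l₄ n E ⟩
    E ℕ.* (n ℕ.* n ℕ.* 1152)                              ∎
    where
    l₁ : ∀ E t → E ℕ.* (t ℕ.* t ℕ.* E) ≡ E ℕ.* E ℕ.* (t ℕ.* t)
    l₁ = solve-∀
    l₂ : ∀ n r t → 12 ℕ.* n ℕ.* r ℕ.* (12 ℕ.* n ℕ.* r) ℕ.* (t ℕ.* t) ≡ n ℕ.* n ℕ.* 144 ℕ.* ((r ℕ.* (r ℕ.* 1)) ℕ.* (t ℕ.* t))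
    l₂ = solve-∀
    l₃ : ∀ E → 8 ℕ.* (E ℕ.* E) ≡ E ℕ.* (8 ℕ.* E)
    l₃ = solve-∀
    l₄ : ∀ n E → n ℕ.* n ℕ.* 144 ℕ.* (8 ℕ.* E) ≡ E ℕ.* (n ℕ.* n ℕ.* 1152)
    l₄ = solve-∀

dyadic : ∀ m → 1 ℕ.≤ m → ∃ λ l → 2 ℕ.^ l ℕ.≤ m × m ℕ.< 2 ℕ.^ suc l
dyadic (suc zero)    _ = 0 , ℕ.≤-refl , ℕ.≤-refl
dyadic (suc (suc m)) _ with dyadic (suc m) (ℕ.s≤s ℕ.z≤n)
... | l , lo , hi with suc (suc m) ℕ.<? 2 ℕ.^ suc l
... | yes p = l , ℕ.m≤n⇒m≤1+n lo , p
... | no p  = suc l , ℕ.≮⇒≥ p , ℕ.<-≤-trans (ℕ.s≤s hi) (begin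
    suc (2 ℕ.^ suc l)             ≤⟨ ℕ.+-monoˡ-≤ (2 ℕ.^ suc l) (ℕ.m^n>0 2 (suc l)) ⟩
    2 ℕ.^ suc l ℕ.+ 2 ℕ.^ suc l   ≡⟨ ≡.cong (2 ℕ.^ suc l ℕ.+_) (ℕ.+-identityʳ (2 ℕ.^ suc l)) ⟨
    2 ℕ.^ suc (suc l)             ∎)
  where open ℕ.≤-Reasoning

-- Configurations with distinct abscissae: slopes and lines.

module Configuration (𝔽 : RealClosedField) (n : ℕ)
  (X Y : Fin n → RealClosedField.Carrier 𝔽)
  (X-distinct : ∀ i j → i ≢ j → ¬ (RealClosedField._≈_ 𝔽 (X i) (X j))) where

  open RealClosedField 𝔽 hiding (zero)
  open OrderedField 𝔽
  open Solver using (solve; _:=_; _:+_; _:*_; _:-_; :-_)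

  X-injective : ∀ {i j} → X i ≈ X j → i ≡ j
  X-injective {i} {j} p with i ≟ j
  ... | yes e = e
  ... | no ne = contradiction p (X-distinct i j ne)

  <⇒≢ : ∀ {i j} → X i < X j → i ≢ j
  <⇒≢ p ≡.refl = <-irrefl p

  abstract
    slope : Fin n → Fin n → Carrier
    slope i j with i ≟ j
    -- A default for equal indices, which makes `slope` total.
    ... | yes _ = 0#
    ... | no ne = (Y j - Y i) * proj₁ (inverse (X j - X i) (λ p → ne (≡.sym (X-injective (-≈0⇒≈ p)))))

    slope-spec : ∀ {i j} → i ≢ j → slope i j * (X j - X i) ≈ Y j - Y i
    slope-spec {i} {j} ne with i ≟ j
    ... | yes e = contradiction e ne
    ... | no ne′ with inverse (X j - X i) (λ p → ne′ (≡.sym (X-injective (-≈0⇒≈ p))))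
    ... | b , e = trans (solve 3 (λ y b d → y :* b :* d := y :* (d :* b)) refl (Y j - Y i) b (X j - X i))
                        (trans (*-congˡ e) (*-identityʳ _))

  line : Fin n → Fin n → Line
  line i j = slope i j , Y i - slope i j * X i

  On : Line → Fin n → Set
  On L k = Y k ≈ L ⟪ X k ⟫

  On? : ∀ L k → Dec (On L k)
  On? L k = Y k ≈? L ⟪ X k ⟫

  On-resp : ∀ {L M k} → L ≈ₗ M → On L k → On M k
  On-resp p q = trans q (⟪⟫-congₗ p _)

  onˡ : ∀ i j → On (line i j) i
  onˡ i j = solve 3 (λ m x y → y := m :* x :+ (y :- m :* x)) refl (slope i j) (X i) (Y i)

  onʳ : ∀ {i j} → i ≢ j → On (line i j) j
  onʳ {i} {j} ne = trans (solve 2 (λ y y′ → y′ := (y′ :- y) :+ y) refl (Y i) (Y j)) (trans (+-congʳ (sym (slope-spec ne)))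
    (solve 4 (λ m x x′ y → m :* (x′ :- x) :+ y := m :* x′ :+ (y :- m :* x)) refl (slope i j) (X i) (X j) (Y i)))

  on-two : ∀ L {i j} → i ≢ j → On L i → On L j → line i j ≈ₗ L
  on-two L {i} {j} ne p q = two-points (line i j) L (X-distinct i j ne)
    (trans (sym (onˡ i j)) p) (trans (sym (onʳ ne)) q)

  -- Crossing-free straight-line graphs.

  Edge : Set
  Edge = Fin n × Fin n

  lineOf : Edge → Line
  lineOf (a , b) = line a b

  Within : Edge → Fin n → Set
  Within (a , b) u = X a ≤ X u × X u ≤ X b

  -- The interiors of two edges meet transversally iff the difference of the two
  -- affine functions changes sign between two vertices of the common x-range.
  Cross : Edge → Edge → Set
  Cross e e′ = (∃ λ u → Within e u × Within e′ u × lineOf e ⟪ X u ⟫ < lineOf e′ ⟪ X u ⟫)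
             × (∃ λ v → Within e v × Within e′ v × lineOf e′ ⟪ X v ⟫ < lineOf e ⟪ X v ⟫)

  module NonCrossing
    (V : List (Fin n)) (E : List Edge) (E! : Unique E)
    (endpoints : ∀ {a b} → (a , b) ∈ E → a ∈ V × b ∈ V)
    (ordered : ∀ {a b} → (a , b) ∈ E → X a < X b)
    (interior-free : ∀ {a b v} → (a , b) ∈ E → v ∈ V → X a < X v → X v < X b → ¬ On (line a b) v)
    (noncrossing : ∀ {e e′} → e ∈ E → e′ ∈ E → ¬ Cross e e′) where

    -- If two edges leave `a` along one line, the shorter one ends in the interior of the longer.
    same-slope : ∀ {a b b′} → (a , b) ∈ E → (a , b′) ∈ E → slope a b ≈ slope a b′ → b ≡ b′
    same-slope {a} {b} {b′} e e′ p with <-trichotomy (X b) (X b′)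
    ... | inj₂ (inj₁ q) = X-injective q
    ... | inj₁ q = contradiction (On-resp {line a b} {line a b′} (p , +-congˡ (-‿cong (*-congʳ p))) (onʳ (<⇒≢ (ordered e))))
                     (interior-free e′ (proj₂ (endpoints e)) (ordered e) q)
    ... | inj₂ (inj₂ q) = contradiction (On-resp {line a b′} {line a b} (sym p , +-congˡ (-‿cong (*-congʳ (sym p)))) (onʳ (<⇒≢ (ordered e′))))
                     (interior-free e (proj₂ (endpoints e′)) (ordered e′) q)

    steeper-edge : ∀ {a} b c {x} → X a < x → slope a b < slope a c → line a b ⟪ x ⟫ < line a c ⟪ x ⟫
    steeper-edge {a} b c = steeper (line a b) (line a c) (trans (sym (onˡ a b)) (onˡ a c))

    steeper-edge-≤ : ∀ {a} b c {x} → X a < x → slope a b ≤ slope a c → line a b ⟪ x ⟫ ≤ line a c ⟪ x ⟫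
    steeper-edge-≤ {a} b c {x} h p with ≤⇒<⊎≈ p
    ... | inj₁ q = <⇒≤ (steeper-edge b c h q)
    ... | inj₂ q = ≈⇒≤ (⟪⟫-congₗ {line a b} {line a c} (q , +-congˡ (-‿cong (*-congʳ q))) x)

    InWedge : Fin n → Fin n → Fin n → Fin n → Set
    InWedge a b c v = X a < X v × line a c ⟪ X v ⟫ ≤ Y v × Y v ≤ line a b ⟪ X v ⟫

    -- (a , c) is the edge just below (a , b) among those going right from a,
    -- and q is the leftmost vertex of the closed wedge between them.
    record Wedge (a b c q : Fin n) : Set where
      field
        b-edge : (a , b) ∈ E
        c-edge : (a , c) ∈ E
        lower  : slope a c < slope a b
        next   : ∀ {c′} → (a , c′) ∈ E → slope a c′ < slope a b → slope a c′ ≤ slope a c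
        inside : InWedge a b c q
        first  : ∀ {v} → v ∈ V → InWedge a b c v → X q ≤ X v

      a<q : X a < X q
      a<q = proj₁ inside
      c≤q : line a c ⟪ X q ⟫ ≤ Y q
      c≤q = proj₁ (proj₂ inside)
      q≤b : Y q ≤ line a b ⟪ X q ⟫
      q≤b = proj₂ (proj₂ inside)

      Xq≤Xb : X q ≤ X b
      Xq≤Xb = first (proj₂ (endpoints b-edge))
        ( ordered b-edge
        , ≤-resp-≈ refl (sym (onʳ (<⇒≢ (ordered b-edge)))) (<⇒≤ (steeper-edge c b (ordered b-edge) lower))
        , ≈⇒≤ (onʳ (<⇒≢ (ordered b-edge))))

      Xq≤Xc : X q ≤ X c
      Xq≤Xc = first (proj₂ (endpoints c-edge))
        ( ordered c-edge
        , ≈⇒≤ (sym (onʳ (<⇒≢ (ordered c-edge))))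
        , ≤-resp-≈ (sym (onʳ (<⇒≢ (ordered c-edge)))) refl (<⇒≤ (steeper-edge c b (ordered c-edge) lower)))

      q<b : q ∈ V → q ≢ b → Y q < line a b ⟪ X q ⟫
      q<b q∈ ne = ≤∧≉⇒< q≤b (interior-free b-edge q∈ a<q (≤∧≉⇒< Xq≤Xb (ne ∘ X-injective)))

    -- This takes the place of Euler's formula. The leftmost vertex q of the wedge under (a , b) is
    -- either b or a vertex strictly below the edge; treating the two cases separately, and the
    -- lowest edges from each a on their own, a vertex is charged at most once in each of three
    -- ways.
    data Charge : Edge → Fin 3 × Fin n → Set where
      lowest : ∀ {a b} → (∀ {c} → (a , c) ∈ E → ¬ slope a c < slope a b) → Charge (a , b) (zero , a)
      at-end : ∀ {a b c} → Wedge a b c b → Charge (a , b) (suc zero , b)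
      before : ∀ {a b c q} → q ∈ V → Wedge a b c q → q ≢ b → Charge (a , b) (suc (suc zero) , q)

    charge : ∀ {e} → e ∈ E → ∃ λ y → y ∈ cartesianProduct (allFin 3) V × Charge e y
    charge {a , b} e∈ = go (filter Below? E) ≡.refl
      where
      Below : Edge → Set
      Below (a′ , c) = a′ ≡ a × slope a c < slope a b
      Below? : ∀ e → Dec (Below e)
      Below? (a′ , c) = (a′ ≟ a) ×-dec (slope a c <? slope a b)
      max : ∀ {e′} → e′ ∈ filter Below? E → ∃ λ m → m ∈ filter Below? E ×
              (∀ {z} → z ∈ filter Below? E → slope a (proj₂ z) ≤ slope a (proj₂ m))
      max = extremum (λ e f → slope a (proj₂ f) ≤ slope a (proj₂ e)) (λ p q → ≤-trans q p) λ e f → ≤-total (slope a (proj₂ f)) (slope a (proj₂ e))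
      InWedge? : ∀ c v → Dec (InWedge a b c v)
      InWedge? c v = (X a <? X v) ×-dec (¬? (Y v <? line a c ⟪ X v ⟫) ×-dec ¬? (line a b ⟪ X v ⟫ <? Y v))
      min : ∀ c {v} → v ∈ filter (InWedge? c) V → ∃ λ m → m ∈ filter (InWedge? c) V ×
              (∀ {z} → z ∈ filter (InWedge? c) V → X m ≤ X z)
      min c = extremum (λ u v → X u ≤ X v) ≤-trans λ u v → ≤-total (X u) (X v)
      go : ∀ es → es ≡ filter Below? E → ∃ λ y → y ∈ cartesianProduct (allFin 3) V × Charge (a , b) y
      go [] eq = (zero , a) , ∈-cartesianProduct⁺ (∈-allFin zero) (proj₁ (endpoints e∈)) , lowest λ c∈ p →
        case ≡.subst (_ ∈_) (≡.sym eq) (∈-filter⁺ Below? c∈ (≡.refl , p)) of λ ()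
      go (e′ ∷ es) eq = let m , m∈ , most = max (≡.subst (e′ ∈_) eq (here ≡.refl)) in
        below m (∈-filter⁻ Below? {xs = E} m∈) (λ e r → most (∈-filter⁺ Below? e (≡.refl , r)))
        where
        below : ∀ e → e ∈ E × Below e → (∀ {c′} → (a , c′) ∈ E → slope a c′ < slope a b → slope a c′ ≤ slope a (proj₂ e)) →
                ∃ λ y → y ∈ cartesianProduct (allFin 3) V × Charge (a , b) y
        below (_ , c) (c∈ , ≡.refl , p) next =
          -- The closed wedge contains `b`, so it has a leftmost vertex.
          let q , q∈W , least = min c (∈-filter⁺ (InWedge? c) (proj₂ (endpoints e∈))
                ( ordered e∈
                , ≤-resp-≈ refl (sym (onʳ (<⇒≢ (ordered e∈)))) (<⇒≤ (steeper-edge c b (ordered e∈) p))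
                , ≈⇒≤ (onʳ (<⇒≢ (ordered e∈)))))
          in leftmost q (∈-filter⁻ (InWedge? c) {xs = V} q∈W) (λ v∈ r → least (∈-filter⁺ (InWedge? c) v∈ r)) (q ≟ b)
          where
          leftmost : ∀ q → q ∈ V × InWedge a b c q → (∀ {v} → v ∈ V → InWedge a b c v → X q ≤ X v) → Dec (q ≡ b) →
                     ∃ λ y → y ∈ cartesianProduct (allFin 3) V × Charge (a , b) y
          leftmost q (q∈ , w) first (no q≢b) = _ , ∈-cartesianProduct⁺ (∈-allFin (suc (suc zero))) q∈ , before q∈ (record
            { b-edge = e∈ ; c-edge = c∈ ; lower = p ; next = next ; inside = w ; first = first }) q≢b
          leftmost q (q∈ , w) first (yes ≡.refl) = _ , ∈-cartesianProduct⁺ (∈-allFin (suc zero)) q∈ , at-end (record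
            { b-edge = e∈ ; c-edge = c∈ ; lower = p ; next = next ; inside = w ; first = first })

    -- As a′ lies left of q, it is outside the wedge at a; so an edge bounding the wedge at a′, which
    -- reaches q, has to cross an edge bounding the wedge at a.
    module _ {a b c a′ b′ c′ q} (W : Wedge a b c q) (W′ : Wedge a′ b′ c′ q) (a<a′ : X a < X a′) where
      private
        module W = Wedge W
        module W′ = Wedge W′
        a′∈ : a′ ∈ V
        a′∈ = proj₁ (endpoints W′.b-edge)

      before-conflict : q ∈ V → q ≢ b → q ≢ b′ → ⊥
      before-conflict q∈ q≢b q≢b′ with Y a′ <? line a c ⟪ X a′ ⟫ | line a b ⟪ X a′ ⟫ <? Y a′
      ... | no p  | no r  = W.first a′∈ (a<a′ , p , r) W′.a<q
      ... | yes p | _     = noncrossing W′.b-edge W.c-edge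
            ( (a′ , (≤-refl , <⇒≤ (ordered W′.b-edge)) , (<⇒≤ a<a′ , <⇒≤ (<-≤-trans W′.a<q W.Xq≤Xc))
              , <-resp-≈ (onˡ a′ b′) refl p)
            , (q , (<⇒≤ W′.a<q , W′.Xq≤Xb) , (<⇒≤ W.a<q , W.Xq≤Xc) , ≤-<-trans W.c≤q (W′.q<b q∈ q≢b′)))
      ... | no _  | yes r = noncrossing W.b-edge W′.c-edge
            ( (a′ , (<⇒≤ a<a′ , <⇒≤ (<-≤-trans W′.a<q W.Xq≤Xb)) , (≤-refl , <⇒≤ (ordered W′.c-edge))
              , <-resp-≈ refl (onˡ a′ c′) r)
            , (q , (<⇒≤ W.a<q , W.Xq≤Xb) , (<⇒≤ W′.a<q , W′.Xq≤Xc) , ≤-<-trans W′.c≤q (W.q<b q∈ q≢b)))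

      at-end-conflict : q ≡ b → q ≡ b′ → ⊥
      at-end-conflict ≡.refl ≡.refl with Y a′ <? line a c ⟪ X a′ ⟫ | line a b ⟪ X a′ ⟫ <? Y a′
      ... | no p  | no r  = W.first a′∈ (a<a′ , p , r) W′.a<q
      ... | yes p | _     = noncrossing W′.b-edge W.c-edge
            ( (a′ , (≤-refl , <⇒≤ W′.a<q) , (<⇒≤ a<a′ , <⇒≤ (<-≤-trans W′.a<q W.Xq≤Xc)) , <-resp-≈ (onˡ a′ b) refl p)
            , (q , (<⇒≤ W′.a<q , ≤-refl) , (<⇒≤ W.a<q , W.Xq≤Xc)
              , <-resp-≈ refl (trans (sym (onʳ (<⇒≢ W.a<q))) (onʳ (<⇒≢ W′.a<q))) (steeper-edge c b W.a<q W.lower)))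
      ... | no _  | yes r = noncrossing W.b-edge W′.c-edge
            ( (a′ , (<⇒≤ a<a′ , <⇒≤ W′.a<q) , (≤-refl , <⇒≤ (ordered W′.c-edge)) , <-resp-≈ refl (onˡ a′ c′) r)
            , (q , (<⇒≤ W.a<q , ≤-refl) , (<⇒≤ W′.a<q , W′.Xq≤Xc)
              , <-resp-≈ refl (trans (sym (onʳ (<⇒≢ W′.a<q))) (onʳ (<⇒≢ W.a<q))) (steeper-edge c′ b W′.a<q W′.lower)))

    -- Right of `a`, the lower edge (a , b) stays weakly below (a , c′), the edge next below (a ,
    -- b′). But q is strictly below the former and not below the latter.
    before-overlap : ∀ {a b c b′ c′ q} → Wedge a b c q → Wedge a b′ c′ q → q ∈ V → q ≢ b → ¬ slope a b < slope a b′
    before-overlap {b = b} {c′ = c′} W W′ q∈ q≢b p =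
      steeper-edge-≤ b c′ (Wedge.a<q W) (Wedge.next W′ (Wedge.b-edge W) p)
        (≤-<-trans (Wedge.c≤q W′) (Wedge.q<b W q∈ q≢b))

    charge-injective : ∀ {e e′ y} → e ∈ E → e′ ∈ E → Charge e y → Charge e′ y → e ≡ e′
    charge-injective {a , b} {_ , b′} e∈ e′∈ (lowest l) (lowest l′) =
      ≡.cong (a ,_) (same-slope e∈ e′∈ (≤-antisym (l e′∈) (l′ e∈)))
    charge-injective {a , b} {a′ , _} _ _ (at-end W) (at-end W′) with <-trichotomy (X a) (X a′)
    ... | inj₁ p        = ⊥-elim (at-end-conflict W W′ p ≡.refl ≡.refl)
    ... | inj₂ (inj₁ p) = ≡.cong (_, b) (X-injective p)
    ... | inj₂ (inj₂ p) = ⊥-elim (at-end-conflict W′ W p ≡.refl ≡.refl)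
    charge-injective {a , b} {a′ , b′} e∈ e′∈ (before q∈ W ne) (before _ W′ ne′) with <-trichotomy (X a) (X a′)
    ... | inj₁ p        = ⊥-elim (before-conflict W W′ p q∈ ne ne′)
    ... | inj₂ (inj₂ p) = ⊥-elim (before-conflict W′ W p q∈ ne′ ne)
    ... | inj₂ (inj₁ p) with X-injective p
    ... | ≡.refl with <-trichotomy (slope a b) (slope a b′)
    ... | inj₁ r        = ⊥-elim (before-overlap W W′ q∈ ne r)
    ... | inj₂ (inj₁ r) = ≡.cong (a ,_) (same-slope e∈ e′∈ r)
    ... | inj₂ (inj₂ r) = ⊥-elim (before-overlap W′ W q∈ ne′ r)

    edges≤3vertices : length E ℕ.≤ 3 ℕ.* length V
    edges≤3vertices = ℕ.≤-trans (length-≤-via Charge E! charge charge-injective)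
      (ℕ.≤-reflexive (length-× (allFin 3) V))

  Cross? : ∀ e e′ → Dec (Cross e e′)
  Cross? e e′ = Fin.any? (λ u → within? e u ×-dec (within? e′ u ×-dec (lineOf e ⟪ X u ⟫ <? lineOf e′ ⟪ X u ⟫)))
          ×-dec Fin.any? (λ u → within? e u ×-dec (within? e′ u ×-dec (lineOf e′ ⟪ X u ⟫ <? lineOf e ⟪ X u ⟫)))
    where
    within? : ∀ e u → Dec (Within e u)
    within? (a , b) u = ¬? (X u <? X a) ×-dec ¬? (X b <? X u)

  -- A nonzero affine function keeps its sign on each side of a zero.
  no-zigzag : ∀ L M {z u v} → L ⟪ z ⟫ ≈ M ⟪ z ⟫ → (z ≤ u × z ≤ v) ⊎ (u ≤ z × v ≤ z) →
              L ⟪ u ⟫ < M ⟪ u ⟫ → ¬ M ⟪ v ⟫ < L ⟪ v ⟫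
  no-zigzag L M {z} {u} {v} e side p q with u <? v | side
  ... | yes u<v | inj₁ (z≤u , z≤v) = between M L z≤u (<⇒≤ u<v) (≈⇒≤ (sym e)) (<⇒≤ q) p
  ... | yes u<v | inj₂ (u≤z , v≤z) = between L M (<⇒≤ u<v) v≤z (<⇒≤ p) (≈⇒≤ e) q
  ... | no v≤u  | inj₁ (z≤u , z≤v) = between L M z≤v v≤u (≈⇒≤ e) (<⇒≤ p) q
  ... | no v≤u  | inj₂ (u≤z , v≤z) = between M L v≤u u≤z (<⇒≤ q) (≈⇒≤ (sym e)) p

  -- A common endpoint would be a zero of the difference with the whole common range on one side.
  -- Having four different endpoints, a crossing survives sampling with probability r⁻⁴, against r⁻²
  -- for an edge.
  cross-distinct : ∀ {a b a′ b′} → X a < X b → X a′ < X b′ → Cross (a , b) (a′ , b′) →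
                   Unique (a ∷ b ∷ a′ ∷ b′ ∷ [])
  cross-distinct {a} {b} {a′} {b′} ab ab′ ((u , (au , ub) , (a′u , ub′) , p) , (v , (av , vb) , (a′v , vb′) , q)) =
    (<⇒≢ ab ∷ a≢a′ ∷ a≢b′ ∷ []) ∷ (b≢a′ ∷ b≢b′ ∷ []) ∷ (<⇒≢ ab′ ∷ []) ∷ [] ∷ []
    where
    a≢a′ : a ≢ a′
    a≢a′ ≡.refl = no-zigzag (line a b) (line a b′) (trans (sym (onˡ a b)) (onˡ a b′)) (inj₁ (au , av)) p q
    a≢b′ : a ≢ b′
    a≢b′ ≡.refl = no-zigzag (line a b) (line a′ a) (trans (sym (onˡ a b)) (onʳ (<⇒≢ ab′))) (inj₁ (au , av)) p q
    b≢a′ : b ≢ a′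
    b≢a′ ≡.refl = no-zigzag (line a b) (line b b′) (trans (sym (onʳ (<⇒≢ ab))) (onˡ b b′)) (inj₁ (a′u , a′v)) p q
    b≢b′ : b ≢ b′
    b≢b′ ≡.refl = no-zigzag (line a b) (line a′ b) (trans (sym (onʳ (<⇒≢ ab))) (onʳ (<⇒≢ ab′))) (inj₂ (ub , vb)) p q

  -- The crossing inequality by sampling.

  Consecutive : Edge → Set
  Consecutive (a , b) = X a < X b × (∀ v → X a < X v → X v < X b → ¬ On (line a b) v)

  Consecutive? : ∀ e → Dec (Consecutive e)
  Consecutive? (a , b) = (X a <? X b) ×-dec
    Fin.all? (λ v → (X a <? X v) →-dec ((X v <? X b) →-dec ¬? (On? (line a b) v)))

  module Sampling (E : List Edge) (E! : Unique E) (consecutive : ∀ {e} → e ∈ E → Consecutive e) where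

    crossings : ℕ
    crossings = ∑ E (λ e → ∑ E (λ e′ → χ (Cross? e e′)))

    private
      In : Vec Bool n → Fin n → Set
      In V i = T (Vec.lookup V i)
      In? : ∀ V → Decidable (In V)
      In? V i = T? (Vec.lookup V i)
      InE? : ∀ V → Decidable (λ (e : Edge) → In V (proj₁ e) × In V (proj₂ e))
      InE? V (a , b) = In? V a ×-dec In? V b
      points : Vec Bool n → List (Fin n)
      points V = filter (In? V) (allFin n)
      edges : Vec Bool n → List Edge
      edges V = filter (InE? V) E
      crossed : Vec Bool n → Edge → ℕ
      crossed V e = ∑ (edges V) (λ e′ → χ (Cross? e e′))

      isolated : ∀ V → List Edge
      isolated V = filter (λ e → crossed V e ℕ.≟ 0) (edges V)

      -- The sampled edges that cross no sampled edge form a crossing-free graph; no sampled vertex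
      -- lies inside such an edge because consecutive points have no point at all between them on
      -- their line.
      isolated≤ : ∀ V → length (isolated V) ℕ.≤ 3 ℕ.* length (points V)
      isolated≤ V = NonCrossing.edges≤3vertices (points V) (isolated V)
          (Unique.filter⁺ _ (Unique.filter⁺ (InE? V) E!))
          (λ e∈ → let _ , a∈ , b∈ = ∈-filter⁻ (InE? V) {xs = E} (proj₁ (∈-filter⁻ (λ e → crossed V e ℕ.≟ 0) {xs = edges V} e∈))
                  in ∈-filter⁺ (In? V) (∈-allFin _) a∈ , ∈-filter⁺ (In? V) (∈-allFin _) b∈)
          (λ e∈ → proj₁ (cons e∈))
          (λ e∈ _ → proj₂ (cons e∈) _)
          (λ {e} {e′} e∈ e′∈ → χ≡0 (Cross? e e′)
             (∑≡0 {f = λ e′ → χ (Cross? e e′)} (proj₂ (∈-filter⁻ (λ e → crossed V e ℕ.≟ 0) {xs = edges V} e∈))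
               (proj₁ (∈-filter⁻ (λ e → crossed V e ℕ.≟ 0) {xs = edges V} e′∈))))
        where
        cons : ∀ {e} → e ∈ isolated V → Consecutive e
        cons e∈ = consecutive (proj₁ (∈-filter⁻ (InE? V) {xs = E} (proj₁ (∈-filter⁻ (λ e → crossed V e ℕ.≟ 0) {xs = edges V} e∈))))

    module _ (ρ : ℕ) where
      open Expectation ρ
      private
        r rⁿ : ℕ
        r = suc ρ
        rⁿ = r ℕ.^ n
        ends : Edge → List (Fin n)
        ends (a , b) = a ∷ b ∷ []
        quad : Edge → Edge → List (Fin n)
        quad (a , b) (c , d) = a ∷ b ∷ c ∷ d ∷ []

        χ-ends : ∀ V e → χ (InE? V e) ≡ contains (ends e) V
        χ-ends V (a , b) = ≡.trans (χ-× (In? V a) (In? V b)) (≡.cong (χ (In? V a) ℕ.*_) (≡.sym (ℕ.*-identityʳ _)))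

        χ-quad : ∀ V e e′ → contains (ends e) V ℕ.* contains (ends e′) V ≡ contains (quad e e′) V
        χ-quad V (a , b) (c , d) = lemma (χ (In? V a)) (χ (In? V b)) (contains (c ∷ d ∷ []) V)
          where
          lemma : ∀ x y z → (x ℕ.* (y ℕ.* 1)) ℕ.* z ≡ x ℕ.* (y ℕ.* z)
          lemma = solve-∀

        length-edges : ∀ V → length (edges V) ≡ ∑ E (λ e → contains (ends e) V)
        length-edges V = ≡.trans (length-filter≡∑ (InE? V) E) (∑-cong E (χ-ends V))

        ∑-crossed : ∀ V → ∑ (edges V) (crossed V) ≡ ∑ E (λ e → ∑ E (λ e′ → χ (Cross? e e′) ℕ.* contains (quad e e′) V))
        ∑-crossed V = ≡.trans (∑-filter (InE? V) E (crossed V)) (∑-cong E λ e →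
            ≡.trans (≡.cong (χ (InE? V e) ℕ.*_) (∑-filter (InE? V) E (λ e′ → χ (Cross? e e′))))
              (≡.trans (≡.sym (∑-*ˡ (χ (InE? V e)) E _)) (∑-cong E λ e′ →
                ≡.trans (lemma (χ (InE? V e)) (χ (InE? V e′)) (χ (Cross? e e′)))
                  (≡.cong (χ (Cross? e e′) ℕ.*_) (≡.trans (≡.cong₂ ℕ._*_ (χ-ends V e) (χ-ends V e′)) (χ-quad V e e′))))))
          where
          lemma : ∀ x y z → x ℕ.* (y ℕ.* z) ≡ z ℕ.* (x ℕ.* y)
          lemma = solve-∀

        step : 𝔼 (λ V → length (edges V)) ℕ.≤ 3 ℕ.* 𝔼 (λ V → length (points V)) ℕ.+ 𝔼 (λ V → ∑ (edges V) (crossed V))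
        step = ℕ.≤-trans
          (𝔼-mono (λ V → ℕ.≤-trans (length-zeros (crossed V) (edges V)) (ℕ.+-monoˡ-≤ _ (isolated≤ V))))
          (ℕ.≤-reflexive (≡.trans (𝔼-+ (λ V → 3 ℕ.* length (points V)) (λ V → ∑ (edges V) (crossed V)))
            (≡.cong (ℕ._+ 𝔼 (λ V → ∑ (edges V) (crossed V))) (𝔼-*ˡ 3 (λ V → length (points V))))))

        𝔼-edges : 𝔼 (λ V → length (edges V)) ℕ.* r ℕ.^ 2 ≡ length E ℕ.* rⁿ
        𝔼-edges = ≡.trans (≡.cong (ℕ._* r ℕ.^ 2) (≡.trans (𝔼-cong length-edges) (𝔼-∑ E (λ e → contains (ends e)))))
          (≡.trans (≡.sym (∑-*ʳ (r ℕ.^ 2) E _)) (≡.trans (∑-cong-∈ E (λ { {a , b} e∈ →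
            𝔼-contains {l = a ∷ b ∷ []} ((<⇒≢ (proj₁ (consecutive e∈)) ∷ []) ∷ [] ∷ []) })) (∑-const E rⁿ)))

        𝔼-points : 𝔼 (λ V → length (points V)) ℕ.* r ≡ n ℕ.* rⁿ
        𝔼-points = 𝔼-length {n}

        𝔼-crossed : 𝔼 (λ V → ∑ (edges V) (crossed V)) ℕ.* r ℕ.^ 4 ≡ crossings ℕ.* rⁿ
        𝔼-crossed = ≡.trans (≡.cong (ℕ._* r ℕ.^ 4) (≡.trans (𝔼-cong ∑-crossed)
            (≡.trans (𝔼-∑ {n = n} E (λ e V → ∑ E (λ e′ → term e e′ V))) (∑-cong E λ e → ≡.trans (𝔼-∑ {n = n} E (term e)) (∑-cong E λ e′ → 𝔼-*ˡ (χ (Cross? e e′)) (contains (quad e e′)))))))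
          (≡.trans (≡.sym (∑-*ʳ (r ℕ.^ 4) E _)) (≡.trans (∑-cong-∈ E λ {e} e∈ →
            ≡.trans (≡.sym (∑-*ʳ (r ℕ.^ 4) E _)) (≡.trans (∑-cong-∈ E λ {e′} e′∈ → each e e′ e∈ e′∈) (∑-*ʳ rⁿ E _)))
            (∑-*ʳ rⁿ E _)))
          where
          term : Edge → Edge → Vec Bool n → ℕ
          term e e′ V = χ (Cross? e e′) ℕ.* contains (quad e e′) V
          each : ∀ e e′ → e ∈ E → e′ ∈ E → χ (Cross? e e′) ℕ.* 𝔼 (contains (quad e e′)) ℕ.* r ℕ.^ 4 ≡ χ (Cross? e e′) ℕ.* rⁿ
          each e@(a , b) e′@(c , d) e∈ e′∈ with Cross? e e′
          ... | no _  = ≡.refl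
          ... | yes x = ≡.trans (ℕ.*-assoc 1 (𝔼 (contains (quad e e′))) (r ℕ.^ 4)) (≡.cong (1 ℕ.*_)
                          (𝔼-contains {l = quad e e′} (cross-distinct (proj₁ (consecutive e∈)) (proj₁ (consecutive e′∈)) x)))

      -- On average, |E| / r² sampled edges are at most 3 n / r uncrossed ones plus crossings / r⁴
      -- crossed ones, crossings being ordered pairs; the inequality is this one multiplied by r⁴.
      sampling-bound : length E ℕ.* r ℕ.^ 2 ℕ.≤ 3 ℕ.* n ℕ.* r ℕ.^ 3 ℕ.+ crossings
      sampling-bound = ℕ.*-cancelʳ-≤ _ _ rⁿ {{ℕ.m^n≢0 r n}} (begin
        length E ℕ.* r ℕ.^ 2 ℕ.* rⁿ                 ≡⟨ swap₁ (length E) (r ℕ.^ 2) rⁿ ⟩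
        length E ℕ.* rⁿ ℕ.* r ℕ.^ 2                 ≡⟨ ≡.cong (ℕ._* r ℕ.^ 2) 𝔼-edges ⟨
        𝔼e ℕ.* r ℕ.^ 2 ℕ.* r ℕ.^ 2                  ≡⟨ pow₄ 𝔼e r ⟩
        𝔼e ℕ.* r ℕ.^ 4                              ≤⟨ ℕ.*-monoˡ-≤ (r ℕ.^ 4) step ⟩
        (3 ℕ.* 𝔼p ℕ.+ 𝔼c) ℕ.* r ℕ.^ 4               ≡⟨ expand 𝔼p 𝔼c r ⟩
        3 ℕ.* (𝔼p ℕ.* r) ℕ.* r ℕ.^ 3 ℕ.+ 𝔼c ℕ.* r ℕ.^ 4 ≡⟨ ≡.cong₂ (λ a b → 3 ℕ.* a ℕ.* r ℕ.^ 3 ℕ.+ b) 𝔼-points 𝔼-crossed ⟩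
        3 ℕ.* (n ℕ.* rⁿ) ℕ.* r ℕ.^ 3 ℕ.+ crossings ℕ.* rⁿ ≡⟨ collect n rⁿ (r ℕ.^ 3) crossings ⟩
        (3 ℕ.* n ℕ.* r ℕ.^ 3 ℕ.+ crossings) ℕ.* rⁿ  ∎)
        where
        open ℕ.≤-Reasoning
        𝔼e 𝔼p 𝔼c : ℕ
        𝔼e = 𝔼 (λ V → length (edges V))
        𝔼p = 𝔼 (λ V → length (points V))
        𝔼c = 𝔼 (λ V → ∑ (edges V) (crossed V))
        swap₁ : ∀ a b c → a ℕ.* b ℕ.* c ≡ a ℕ.* c ℕ.* b
        swap₁ = solve-∀
        pow₄ : ∀ a r → a ℕ.* (r ℕ.* (r ℕ.* 1)) ℕ.* (r ℕ.* (r ℕ.* 1)) ≡ a ℕ.* (r ℕ.* (r ℕ.* (r ℕ.* (r ℕ.* 1))))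
        pow₄ = solve-∀
        expand : ∀ a b r → (3 ℕ.* a ℕ.+ b) ℕ.* (r ℕ.* (r ℕ.* (r ℕ.* (r ℕ.* 1)))) ≡ 3 ℕ.* (a ℕ.* r) ℕ.* (r ℕ.* (r ℕ.* (r ℕ.* 1))) ℕ.+ b ℕ.* (r ℕ.* (r ℕ.* (r ℕ.* (r ℕ.* 1))))
        expand = solve-∀
        collect : ∀ a b c d → 3 ℕ.* (a ℕ.* b) ℕ.* c ℕ.+ d ℕ.* b ≡ (3 ℕ.* a ℕ.* c ℕ.+ d) ℕ.* b
        collect = solve-∀

  -- Incidences of points and rich lines.

  richness : Line → ℕ
  richness L = ∑ (allFin n) (λ k → χ (On? L k))

  richness-mono : ∀ {L M} → (∀ {k} → On L k → On M k) → richness L ℕ.≤ richness M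
  richness-mono {L} {M} h = ∑-mono (allFin n) (λ {k} _ → χ-mono (On? L k) (On? M k) h)

  richness-cong : ∀ {L M} → L ≈ₗ M → richness L ≡ richness M
  richness-cong {L} {M} p = ℕ.≤-antisym (richness-mono {L} {M} (On-resp {L} {M} p))
                                        (richness-mono {M} {L} (On-resp {M} {L} (≈ₗ-sym {L} {M} p)))

  -- The point of the line nearest to `i` on the side of `j` gives the edge. Edges run from left to
  -- right, so `i` can be either end.
  neighbour : ∀ {i j} → i ≢ j → ∃ λ e → Consecutive e × lineOf e ≈ₗ line i j × (proj₁ e ≡ i ⊎ proj₂ e ≡ i)
  neighbour {i} {j} i≢j with <-trichotomy (X i) (X j)
  ... | inj₂ (inj₁ p) = contradiction (X-injective p) i≢j
  ... | inj₁ p = right (extremum (λ u v → X u ≤ X v) ≤-trans (λ u v → ≤-total (X u) (X v)) (∈-filter⁺ Right? (∈-allFin j) (p , onʳ i≢j)))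
    where
    Right? : ∀ k → Dec (X i < X k × On (line i j) k)
    Right? k = (X i <? X k) ×-dec On? (line i j) k
    right : (∃ λ b → b ∈ filter Right? (allFin n) × (∀ {z} → z ∈ filter Right? (allFin n) → X b ≤ X z)) →
            ∃ λ e → Consecutive e × lineOf e ≈ₗ line i j × (proj₁ e ≡ i ⊎ proj₂ e ≡ i)
    right (b , b∈ , least) with ∈-filter⁻ Right? {xs = allFin n} b∈
    ... | _ , i<b , on = (i , b) , (i<b , λ v i<v v<b on′ →
              least (∈-filter⁺ Right? (∈-allFin v) (i<v , On-resp {line i b} {line i j} same on′)) v<b) , same , inj₁ ≡.refl
      where
      same : line i b ≈ₗ line i j
      same = on-two (line i j) (<⇒≢ i<b) (onˡ i j) on
  ... | inj₂ (inj₂ p) = left (extremum (λ u v → X v ≤ X u) (λ p q → ≤-trans q p) (λ u v → ≤-total (X v) (X u)) (∈-filter⁺ Left? (∈-allFin j) (p , onʳ i≢j)))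
    where
    Left? : ∀ k → Dec (X k < X i × On (line i j) k)
    Left? k = (X k <? X i) ×-dec On? (line i j) k
    left : (∃ λ b → b ∈ filter Left? (allFin n) × (∀ {z} → z ∈ filter Left? (allFin n) → X z ≤ X b)) →
            ∃ λ e → Consecutive e × lineOf e ≈ₗ line i j × (proj₁ e ≡ i ⊎ proj₂ e ≡ i)
    left (b , b∈ , most) with ∈-filter⁻ Left? {xs = allFin n} b∈
    ... | _ , b<i , on = (b , i) , (b<i , λ v b<v v<i on′ →
              most (∈-filter⁺ Left? (∈-allFin v) (v<i , On-resp {line b i} {line i j} same on′)) b<v) , same , inj₂ ≡.refl
      where
      same : line b i ≈ₗ line i j
      same = on-two (line i j) (<⇒≢ b<i) on (onˡ i j)

  _≈ₗ?_ : ∀ L M → Dec (L ≈ₗ M)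
  (m , c) ≈ₗ? (m′ , c′) = (m ≈? m′) ×-dec (c ≈? c′)

  consecutive-disjoint : ∀ {a b c d} → Consecutive (a , b) → Consecutive (c , d) → line a b ≈ₗ line c d →
                         (a , b) ≡ (c , d) ⊎ X b ≤ X c ⊎ X d ≤ X a
  consecutive-disjoint {a} {b} {c} {d} (a<b , free) (c<d , free′) same with <-trichotomy (X a) (X c)
  ... | inj₁ p = inj₂ (inj₁ λ q → free c p q (On-resp {line c d} {line a b} (≈ₗ-sym {line a b} {line c d} same) (onˡ c d)))
  ... | inj₂ (inj₂ p) = inj₂ (inj₂ λ q → free′ a p q (On-resp {line a b} {line c d} same (onˡ a b)))
  ... | inj₂ (inj₁ p) with X-injective p | <-trichotomy (X b) (X d)
  ... | ≡.refl | inj₁ q        = contradiction (On-resp {line a b} {line c d} same (onʳ (<⇒≢ a<b))) (free′ b a<b q)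
  ... | ≡.refl | inj₂ (inj₂ q) = contradiction (On-resp {line c d} {line a b} (≈ₗ-sym {line a b} {line c d} same) (onʳ (<⇒≢ c<d))) (free d c<d q)
  ... | ≡.refl | inj₂ (inj₁ q) = inj₁ (≡.cong (a ,_) (X-injective q))

  -- Both crossings would be sign changes of the same affine difference, on two ranges that overlap
  -- in at most one point; an affine function changes sign only once.
  cross-separated : ∀ {a b c d e′ f′} → line a b ≈ₗ line c d → lineOf e′ ≈ₗ lineOf f′ → X b ≤ X c →
                    Cross (a , b) e′ → ¬ Cross (c , d) f′
  cross-separated {a} {b} {c} {d} {e′} {f′} p q b≤c
    ((u , (_ , u≤b) , _ , Lu<Mu) , (v , (_ , v≤b) , _ , Mv<Lv))
    ((u′ , (c≤u′ , _) , _ , Lu′<Mu′) , (v′ , (c≤v′ , _) , _ , Mv′<Lv′)) with X u <? X v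
  ... | yes u<v = between (line a b) (lineOf e′) (<⇒≤ u<v) (≤-trans v≤b (≤-trans b≤c c≤u′)) (<⇒≤ Lu<Mu)
          (<⇒≤ (<-resp-≈ (sym (⟪⟫-congₗ {line a b} {line c d} p _)) (sym (⟪⟫-congₗ {lineOf e′} {lineOf f′} q _)) Lu′<Mu′)) Mv<Lv
  ... | no v≤u  = between (lineOf e′) (line a b) v≤u (≤-trans u≤b (≤-trans b≤c c≤v′)) (<⇒≤ Mv<Lv)
          (<⇒≤ (<-resp-≈ (sym (⟪⟫-congₗ {lineOf e′} {lineOf f′} q _)) (sym (⟪⟫-congₗ {line a b} {line c d} p _)) Mv′<Lv′)) Lu<Mu

  cross-sym : ∀ {e e′} → Cross e e′ → Cross e′ e
  cross-sym ((u , i , j , p) , (v , k , l , q)) = (v , l , k , q) , (u , j , i , p)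

  cross-unique : ∀ {e f e′ f′} → Consecutive e → Consecutive f → lineOf e ≈ₗ lineOf f → lineOf e′ ≈ₗ lineOf f′ →
                 Cross e e′ → Cross f f′ → e ≡ f
  cross-unique {e} {f} {e′} {f′} ce cf p q x x′ with consecutive-disjoint ce cf p
  ... | inj₁ r = r
  ... | inj₂ (inj₁ r) = contradiction x′ (cross-separated {e′ = e′} {f′} p q r x)
  ... | inj₂ (inj₂ r) = contradiction x (cross-separated {e′ = f′} {e′} (≈ₗ-sym {lineOf e} {lineOf f} p) (≈ₗ-sym {lineOf e′} {lineOf f′} q) r x′)

  square : List Edge
  square = cartesianProduct (allFin n) (allFin n)

  pairs : List Edge
  pairs = filter (λ p → ¬? (proj₁ p ≟ proj₂ p)) square

  square! : Unique square
  square! = Unique.cartesianProduct⁺ (Unique.allFin⁺ n) (Unique.allFin⁺ n)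

  ∈-pairs⇒≢ : ∀ {i j} → (i , j) ∈ pairs → i ≢ j
  ∈-pairs⇒≢ p∈ = proj₂ (∈-filter⁻ (λ p → ¬? (proj₁ p ≟ proj₂ p)) {xs = square} p∈)

  module Class (lo hi : ℕ) where

    InClass : Line → Set
    InClass L = lo ℕ.≤ richness L × richness L ℕ.< hi

    InClass? : ∀ L → Dec (InClass L)
    InClass? L = (lo ℕ.≤? richness L) ×-dec (richness L ℕ.<? hi)

    InClass-resp : ∀ {L M} → L ≈ₗ M → InClass L → InClass M
    InClass-resp {L} {M} p = ≡.subst (λ r → lo ℕ.≤ r × r ℕ.< hi) (richness-cong {L} {M} p)

    Edge? : ∀ e → Dec (Consecutive e × InClass (lineOf e))
    Edge? e = Consecutive? e ×-dec InClass? (lineOf e)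

    E : List Edge
    E = filter Edge? square

    E! : Unique E
    E! = Unique.filter⁺ Edge? square!

    ∈E : ∀ {e} → e ∈ E → Consecutive e × InClass (lineOf e)
    ∈E e∈ = proj₂ (∈-filter⁻ Edge? {xs = square} e∈)

    E∋ : ∀ {e} → Consecutive e → InClass (lineOf e) → e ∈ E
    E∋ c i = ∈-filter⁺ Edge? (∈-cartesianProduct⁺ (∈-allFin _) (∈-allFin _)) (c , i)

    open Sampling E E! (λ e∈ → proj₁ (∈E e∈)) public

    same? : ∀ e f → Dec (lineOf e ≈ₗ lineOf f)
    same? e f = lineOf e ≈ₗ? lineOf f

    -- The size of a line measured by its edges, which makes a list of lines unnecessary.
    edgesOn : Edge → ℕ
    edgesOn e = ∑ E (λ f → χ (same? e f))

    private
      endpoint : Fin 2 → Edge → Fin n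
      endpoint zero       = proj₁
      endpoint (suc zero) = proj₂

    -- By `neighbour` every point of the line is an end of one of its edges, and an edge has two
    -- ends.
    richness≤2edgesOn : ∀ {e} → e ∈ E → richness (lineOf e) ℕ.≤ 2 ℕ.* edgesOn e
    richness≤2edgesOn {e@(a , b)} e∈ = begin
        richness (line a b)                                         ≡⟨ length-filter≡∑ (On? (line a b)) (allFin n) ⟨
        length (filter (On? (line a b)) (allFin n))                 ≤⟨ length-≤-via (λ k y → endpoint (proj₁ y) (proj₂ y) ≡ k)
                                                                         (Unique.filter⁺ (On? (line a b)) (Unique.allFin⁺ n)) total
                                                                         (λ _ _ p q → ≡.trans (≡.sym p) q) ⟩
        length (cartesianProduct (allFin 2) (filter (same? e) E))   ≡⟨ length-× (allFin 2) (filter (same? e) E) ⟩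
        2 ℕ.* length (filter (same? e) E)                           ≡⟨ ≡.cong (2 ℕ.*_) (length-filter≡∑ (same? e) E) ⟩
        2 ℕ.* edgesOn e                                             ∎
      where
      open ℕ.≤-Reasoning
      a≢b : a ≢ b
      a≢b = <⇒≢ (proj₁ (proj₁ (∈E e∈)))
      other : ∀ k → ∃ λ j → k ≢ j × On (line a b) j
      other k with k ≟ a
      ... | yes ≡.refl = b , a≢b , onʳ a≢b
      ... | no k≢a     = a , k≢a , onˡ a b
      total : ∀ {k} → k ∈ filter (On? (line a b)) (allFin n) →
              ∃ λ y → y ∈ cartesianProduct (allFin 2) (filter (same? e) E) × endpoint (proj₁ y) (proj₂ y) ≡ k
      total {k} k∈ with ∈-filter⁻ (On? (line a b)) {xs = allFin n} k∈ | other k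
      ... | _ , on | j , k≢j , on′ with neighbour k≢j
      ... | f , c , same , end = at-endpoint end
        where
        same′ : lineOf e ≈ₗ lineOf f
        same′ = ≈ₗ-sym {lineOf f} {lineOf e} (≈ₗ-trans {lineOf f} {line k j} {line a b} same (on-two (line a b) k≢j on on′))
        f∈ : f ∈ filter (same? e) E
        f∈ = ∈-filter⁺ (same? e) (E∋ c (InClass-resp {lineOf e} {lineOf f} same′ (proj₂ (∈E e∈)))) same′
        at-endpoint : proj₁ f ≡ k ⊎ proj₂ f ≡ k → ∃ λ y → y ∈ cartesianProduct (allFin 2) (filter (same? e) E) × endpoint (proj₁ y) (proj₂ y) ≡ k
        at-endpoint (inj₁ p) = (zero , f) , ∈-cartesianProduct⁺ (∈-allFin zero) f∈ , p
        at-endpoint (inj₂ p) = (suc zero , f) , ∈-cartesianProduct⁺ (∈-allFin (suc zero)) f∈ , p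

    -- Double counting of crossings (e , e′) against pairs (f , f′) of edges on the same two lines:
    -- a crossing has at least lo² / 4 such pairs, and by `cross-unique` a pair belongs to at most
    -- one crossing, since two lines meet once.
    crossings-bound : crossings ℕ.* (lo ℕ.* lo) ℕ.≤ 4 ℕ.* (length E ℕ.* length E)
    crossings-bound = begin
        crossings ℕ.* (lo ℕ.* lo)
          ≡⟨ ≡.cong (ℕ._* (lo ℕ.* lo)) (≡.sym (∑-× E E (λ p → χ (C? p)))) ⟩
        ∑ EE (λ p → χ (C? p)) ℕ.* (lo ℕ.* lo)
          ≡⟨ ∑-*ʳ (lo ℕ.* lo) EE _ ⟨
        ∑ EE (λ p → χ (C? p) ℕ.* (lo ℕ.* lo))
          ≤⟨ ∑-mono EE (λ {p} p∈ → ℕ.*-monoʳ-≤ (χ (C? p)) (rich p p∈)) ⟩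
        ∑ EE (λ p → χ (C? p) ℕ.* (4 ℕ.* ∑ EE (λ q → χ (S? p q))))
          ≡⟨ ∑-cong EE (λ p → rearrange (χ (C? p)) _) ⟩
        ∑ EE (λ p → 4 ℕ.* (χ (C? p) ℕ.* ∑ EE (λ q → χ (S? p q))))
          ≡⟨ ∑-*ˡ 4 EE _ ⟩
        4 ℕ.* ∑ EE (λ p → χ (C? p) ℕ.* ∑ EE (λ q → χ (S? p q)))
          ≡⟨ ≡.cong (4 ℕ.*_) (∑-cong EE (λ p → ≡.trans (≡.sym (∑-*ˡ (χ (C? p)) EE _))
               (∑-cong EE (λ q → ≡.sym (χ-× (C? p) (S? p q)))))) ⟩
        4 ℕ.* ∑ EE (λ p → ∑ EE (λ q → χ (C? p ×-dec S? p q)))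
          ≡⟨ ≡.cong (4 ℕ.*_) (∑-swap EE EE _) ⟩
        4 ℕ.* ∑ EE (λ q → ∑ EE (λ p → χ (C? p ×-dec S? p q)))
          ≤⟨ ℕ.*-monoʳ-≤ 4 (∑-bound EE (λ {q} _ → ∑χ≤1 (λ p → C? p ×-dec S? p q) (Unique.cartesianProduct⁺ E! E!) (unique q))) ⟩
        4 ℕ.* (length EE ℕ.* 1)
          ≡⟨ ≡.cong (4 ℕ.*_) (≡.trans (ℕ.*-identityʳ _) (length-× E E)) ⟩
        4 ℕ.* (length E ℕ.* length E) ∎
      where
      open ℕ.≤-Reasoning
      EE : List (Edge × Edge)
      EE = cartesianProduct E E
      C? : ∀ p → Dec (Cross (proj₁ p) (proj₂ p))
      C? p = Cross? (proj₁ p) (proj₂ p)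
      S? : ∀ (p q : Edge × Edge) → Dec (lineOf (proj₁ p) ≈ₗ lineOf (proj₁ q) × lineOf (proj₂ p) ≈ₗ lineOf (proj₂ q))
      S? p q = same? (proj₁ p) (proj₁ q) ×-dec same? (proj₂ p) (proj₂ q)
      rearrange : ∀ c s → c ℕ.* (4 ℕ.* s) ≡ 4 ℕ.* (c ℕ.* s)
      rearrange = solve-∀
      double : ∀ a b → 2 ℕ.* a ℕ.* (2 ℕ.* b) ≡ 4 ℕ.* (a ℕ.* b)
      double = solve-∀
      rich : ∀ p → p ∈ EE → lo ℕ.* lo ℕ.≤ 4 ℕ.* ∑ EE (λ q → χ (S? p q))
      rich (e , e′) p∈ = let e∈ , e′∈ = ∈-cartesianProduct⁻ E E p∈ in begin
        lo ℕ.* lo                               ≤⟨ ℕ.*-mono-≤ (ℕ.≤-trans (proj₁ (proj₂ (∈E e∈))) (richness≤2edgesOn e∈))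
                                                              (ℕ.≤-trans (proj₁ (proj₂ (∈E e′∈))) (richness≤2edgesOn e′∈)) ⟩
        2 ℕ.* edgesOn e ℕ.* (2 ℕ.* edgesOn e′)  ≡⟨ double (edgesOn e) (edgesOn e′) ⟩
        4 ℕ.* (edgesOn e ℕ.* edgesOn e′)        ≡⟨ ≡.cong (4 ℕ.*_) (∑-*-∑ E E (λ f → χ (same? e f)) (λ f → χ (same? e′ f))) ⟨
        4 ℕ.* ∑ E (λ f → ∑ E (λ f′ → χ (same? e f) ℕ.* χ (same? e′ f′)))
          ≡⟨ ≡.cong (4 ℕ.*_) (∑-cong E (λ f → ∑-cong E (λ f′ → ≡.sym (χ-× (same? e f) (same? e′ f′))))) ⟩
        4 ℕ.* ∑ E (λ f → ∑ E (λ f′ → χ (S? (e , e′) (f , f′))))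
          ≡⟨ ≡.cong (4 ℕ.*_) (∑-× E E (λ q → χ (S? (e , e′) q))) ⟨
        4 ℕ.* ∑ EE (λ q → χ (S? (e , e′) q)) ∎
      unique : ∀ q {p p′} → p ∈ EE → p′ ∈ EE →
               Cross (proj₁ p) (proj₂ p) × lineOf (proj₁ p) ≈ₗ lineOf (proj₁ q) × lineOf (proj₂ p) ≈ₗ lineOf (proj₂ q) →
               Cross (proj₁ p′) (proj₂ p′) × lineOf (proj₁ p′) ≈ₗ lineOf (proj₁ q) × lineOf (proj₂ p′) ≈ₗ lineOf (proj₂ q) →
               p ≡ p′
      unique (g , g′) {e , e′} {f , f′} p∈ p′∈ (x , s , s′) (y , t , t′) =
        let e∈ , e′∈ = ∈-cartesianProduct⁻ E E p∈
            f∈ , f′∈ = ∈-cartesianProduct⁻ E E p′∈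
            l = ≈ₗ-trans {lineOf e} {lineOf g} {lineOf f} s (≈ₗ-sym {lineOf f} {lineOf g} t)
            l′ = ≈ₗ-trans {lineOf e′} {lineOf g′} {lineOf f′} s′ (≈ₗ-sym {lineOf f′} {lineOf g′} t′)
        in ≡.cong₂ _,_ (cross-unique {e} {f} {e′} {f′} (proj₁ (∈E e∈)) (proj₁ (∈E f∈)) l l′ x y)
                       (cross-unique {e′} {f′} {e} {f} (proj₁ (∈E e′∈)) (proj₁ (∈E f′∈)) l′ l
                         (cross-sym {e} {e′} x) (cross-sym {f} {f′} y))

    -- A pair (i , j) is charged to an edge of its line that ends at i. An edge is charged for two
    -- choices of i and fewer than hi choices of j, each with weight less than hi.
    triples-bound : ∑ pairs (λ p → χ (InClass? (lineOf p)) ℕ.* richness (lineOf p)) ℕ.≤ length E ℕ.* (2 ℕ.* (hi ℕ.* hi))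
    triples-bound = begin
        ∑ pairs (λ p → χ (InClass? (lineOf p)) ℕ.* richness (lineOf p))
          ≤⟨ ∑-mono pairs (λ {p} p∈ → χ*≤ (InClass? (lineOf p)) (witness p p∈)) ⟩
        ∑ pairs (λ p → ∑ E (λ e → term e (proj₁ p) (proj₂ p)))
          ≤⟨ ∑-filter-≤ (λ p → ¬? (proj₁ p ≟ proj₂ p)) square _ ⟩
        ∑ square (λ p → ∑ E (λ e → term e (proj₁ p) (proj₂ p)))
          ≡⟨ ∑-swap square E _ ⟩
        ∑ E (λ e → ∑ square (λ p → term e (proj₁ p) (proj₂ p)))
          ≡⟨ ∑-cong E (λ e → ≡.trans (∑-× (allFin n) (allFin n) _)
               (≡.trans (∑-*-∑ (allFin n) (allFin n) (touches e) (λ j → χ (On? (lineOf e) j) ℕ.* richness (lineOf e)))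
                        (≡.cong (∑ (allFin n) (touches e) ℕ.*_) (∑-*ʳ (richness (lineOf e)) (allFin n) _)))) ⟩
        ∑ E (λ e → ∑ (allFin n) (touches e) ℕ.* (richness (lineOf e) ℕ.* richness (lineOf e)))
          ≤⟨ ∑-bound E (λ {e} e∈ → let r<hi = ℕ.<⇒≤ (proj₂ (proj₂ (∈E e∈))) in
               ℕ.*-mono-≤ (touches≤2 e) (ℕ.*-mono-≤ r<hi r<hi)) ⟩
        length E ℕ.* (2 ℕ.* (hi ℕ.* hi)) ∎
      where
      open ℕ.≤-Reasoning
      touches : Edge → Fin n → ℕ
      touches e i = χ (proj₁ e ≟ i) ℕ.+ χ (proj₂ e ≟ i)
      term : Edge → Fin n → Fin n → ℕ
      term e i j = touches e i ℕ.* (χ (On? (lineOf e) j) ℕ.* richness (lineOf e))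
      touches≤2 : ∀ e → ∑ (allFin n) (touches e) ℕ.≤ 2
      touches≤2 e = ℕ.≤-trans (ℕ.≤-reflexive (∑-+ (allFin n) (λ i → χ (proj₁ e ≟ i)) (λ i → χ (proj₂ e ≟ i))))
        (ℕ.+-mono-≤ (∑χ≤1 (proj₁ e ≟_) (Unique.allFin⁺ n) (λ _ _ p q → ≡.trans (≡.sym p) q))
                    (∑χ≤1 (proj₂ e ≟_) (Unique.allFin⁺ n) (λ _ _ p q → ≡.trans (≡.sym p) q)))
      touched : ∀ e i → proj₁ e ≡ i ⊎ proj₂ e ≡ i → 1 ℕ.≤ touches e i
      touched e i (inj₁ p) = ℕ.≤-trans (ℕ.≤-reflexive (≡.sym (χ-yes (proj₁ e ≟ i) p))) (ℕ.m≤m+n _ _)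
      touched e i (inj₂ p) = ℕ.≤-trans (ℕ.≤-reflexive (≡.sym (χ-yes (proj₂ e ≟ i) p))) (ℕ.m≤n+m _ _)
      witness : ∀ p → p ∈ pairs → InClass (lineOf p) → richness (lineOf p) ℕ.≤ ∑ E (λ e → term e (proj₁ p) (proj₂ p))
      witness (i , j) p∈ inc with neighbour (∈-pairs⇒≢ p∈)
      ... | e , c , same , end = begin
          richness (line i j)   ≡⟨ richness-cong {lineOf e} {line i j} same ⟨
          richness (lineOf e)   ≡⟨ ≡.trans (ℕ.*-identityˡ _) (ℕ.*-identityˡ _) ⟨
          1 ℕ.* (1 ℕ.* richness (lineOf e))
            ≤⟨ ℕ.*-mono-≤ (touched e i end) (ℕ.*-monoˡ-≤ (richness (lineOf e)) (ℕ.≤-reflexive (≡.sym (χ-yes (On? (lineOf e) j)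
                 (On-resp {line i j} {lineOf e} (≈ₗ-sym {lineOf e} {line i j} same) (onʳ (∈-pairs⇒≢ p∈))))))) ⟩
          term e i j            ≤⟨ ∑-∈ (λ e → term e i j) (E∋ c (InClass-resp {line i j} {lineOf e} (≈ₗ-sym {lineOf e} {line i j} same) inc)) ⟩
          ∑ E (λ e → term e i j) ∎

  class-bound : .{{_ : ℕ.NonZero n}} → ∀ t →
    ∑ pairs (λ p → χ (Class.InClass? t (2 ℕ.* t) (lineOf p)) ℕ.* richness (lineOf p)) ℕ.≤
    8 ℕ.* (n ℕ.* n ℕ.* 1152 ℕ.+ 6 ℕ.* n ℕ.* (t ℕ.* t))
  class-bound t = begin
      ∑ pairs (λ p → χ (InClass? (lineOf p)) ℕ.* richness (lineOf p))  ≤⟨ triples-bound ⟩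
      length E ℕ.* (2 ℕ.* (2 ℕ.* t ℕ.* (2 ℕ.* t)))                     ≡⟨ lemma (length E) t ⟩
      8 ℕ.* (t ℕ.* t ℕ.* length E)                                     ≤⟨ ℕ.*-monoʳ-≤ 8 (edges-arithmetic n t (length E) sampled) ⟩
      8 ℕ.* (n ℕ.* n ℕ.* 1152 ℕ.+ 6 ℕ.* n ℕ.* (t ℕ.* t))             ∎
    where
    open Class t (2 ℕ.* t)
    open ℕ.≤-Reasoning
    lemma : ∀ e t → e ℕ.* (2 ℕ.* (2 ℕ.* t ℕ.* (2 ℕ.* t))) ≡ 8 ℕ.* (t ℕ.* t ℕ.* e)
    lemma = solve-∀
    sampled : ∀ ρ → length E ℕ.* suc ρ ℕ.^ 2 ℕ.* (t ℕ.* t) ℕ.≤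
                    3 ℕ.* n ℕ.* suc ρ ℕ.^ 3 ℕ.* (t ℕ.* t) ℕ.+ 4 ℕ.* (length E ℕ.* length E)
    sampled ρ = begin
      length E ℕ.* suc ρ ℕ.^ 2 ℕ.* (t ℕ.* t)                              ≤⟨ ℕ.*-monoˡ-≤ (t ℕ.* t) (sampling-bound ρ) ⟩
      (3 ℕ.* n ℕ.* suc ρ ℕ.^ 3 ℕ.+ crossings) ℕ.* (t ℕ.* t)               ≡⟨ ℕ.*-distribʳ-+ (t ℕ.* t) (3 ℕ.* n ℕ.* suc ρ ℕ.^ 3) crossings ⟩
      3 ℕ.* n ℕ.* suc ρ ℕ.^ 3 ℕ.* (t ℕ.* t) ℕ.+ crossings ℕ.* (t ℕ.* t)   ≤⟨ ℕ.+-monoʳ-≤ _ crossings-bound ⟩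
      3 ℕ.* n ℕ.* suc ρ ℕ.^ 3 ℕ.* (t ℕ.* t) ℕ.+ 4 ℕ.* (length E ℕ.* length E) ∎

  -- Collinear triples and parallel pairs.

  collinear : ℕ
  collinear = ∑ pairs (λ p → richness (lineOf p))

  -- `collinear` counts a third point on the line of each ordered pair, the pair's own points
  -- included. No dyadic range of richness dominates: each contributes O(n² + n s²), and the number
  -- `suc L` of ranges becomes log s.
  collinear-bound : .{{_ : ℕ.NonZero n}} → ∀ {s L} → 1 ℕ.≤ s → 2 ℕ.^ L ℕ.≤ s → s ℕ.< 2 ℕ.^ suc L →
    (∀ {p} → p ∈ pairs → richness (lineOf p) ℕ.≤ s) →
    collinear ℕ.≤ suc L ℕ.* (8 ℕ.* (n ℕ.* n ℕ.* 1152 ℕ.+ 6 ℕ.* n ℕ.* (s ℕ.* s)))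
  collinear-bound {s} {L} s≥1 2^L≤s s<2^1+L poor = begin
      ∑ pairs (λ p → richness (lineOf p))
        ≤⟨ ∑-mono pairs (λ {p} p∈ → some-class p p∈) ⟩
      ∑ pairs (λ p → ∑ (upTo (suc L)) (λ l → term l p))
        ≡⟨ ∑-swap pairs (upTo (suc L)) _ ⟩
      ∑ (upTo (suc L)) (λ l → ∑ pairs (term l))
        ≤⟨ ∑-bound (upTo (suc L)) (λ {l} l∈ → ℕ.≤-trans (class-bound (2 ℕ.^ l)) (ℕ.*-monoʳ-≤ 8 (ℕ.+-monoʳ-≤ (n ℕ.* n ℕ.* 1152)
             (ℕ.*-monoʳ-≤ (6 ℕ.* n) (ℕ.*-mono-≤ (2^l≤s l∈) (2^l≤s l∈)))))) ⟩
      length (upTo (suc L)) ℕ.* bound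
        ≡⟨ ≡.cong (ℕ._* bound) (length-upTo (suc L)) ⟩
      suc L ℕ.* bound ∎
    where
    open ℕ.≤-Reasoning
    bound : ℕ
    bound = 8 ℕ.* (n ℕ.* n ℕ.* 1152 ℕ.+ 6 ℕ.* n ℕ.* (s ℕ.* s))
    term : ℕ → Edge → ℕ
    term l p = χ (Class.InClass? (2 ℕ.^ l) (2 ℕ.* 2 ℕ.^ l) (lineOf p)) ℕ.* richness (lineOf p)
    2^l≤s : ∀ {l} → l ∈ upTo (suc L) → 2 ℕ.^ l ℕ.≤ s
    2^l≤s l∈ = ℕ.≤-trans (ℕ.^-monoʳ-≤ 2 (ℕ.≤-pred (∈-upTo⁻ l∈))) 2^L≤s
    some-class : ∀ p → p ∈ pairs → richness (lineOf p) ℕ.≤ ∑ (upTo (suc L)) (λ l → term l p)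
    some-class p@(i , j) p∈ with dyadic (richness (line i j)) (ℕ.≤-trans (ℕ.≤-reflexive (≡.sym (χ-yes (On? (line i j) i) (onˡ i j)))) (∑-∈ (λ k → χ (On? (line i j) k)) (∈-allFin i)))
    ... | l , lo , hi = ℕ.≤-trans
          (ℕ.≤-reflexive (≡.sym (≡.trans (≡.cong (ℕ._* richness (line i j)) (χ-yes (Class.InClass? (2 ℕ.^ l) (2 ℕ.* 2 ℕ.^ l) (line i j)) (lo , hi))) (ℕ.*-identityˡ _))))
          -- The range is among those summed: 2^l ≤ richness ≤ s < 2^(L+1) forces l ≤ L.
          (∑-∈ {x = l} (λ l → term l p) (∈-upTo⁺ {suc L} (ℕ.≰⇒> λ L<l → ℕ.<⇒≱ s<2^1+L (ℕ.≤-trans (ℕ.^-monoʳ-≤ 2 L<l) (ℕ.≤-trans lo (poor p∈))))))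

  slopeOf : Edge → Carrier
  slopeOf (i , j) = slope i j

  through-same-slope : ∀ {i j k} → slope i j ≈ slope i k → line i j ≈ₗ line i k
  through-same-slope p = p , +-congˡ (-‿cong (*-congʳ p))

  slope-sym : ∀ {i j} → i ≢ j → slope i j ≈ slope j i
  slope-sym {i} {j} i≢j = proj₁ (on-two (line j i) i≢j (onʳ (i≢j ∘ ≡.sym)) (onˡ j i))

  parallel : ℕ
  parallel = ∑ pairs (λ p → ∑ pairs (λ q → χ (slopeOf p ≈? slopeOf q)))

  -- Of two parallel pairs, let (k , l) be the one on the less rich line: given the other pair (i , j)
  -- and k, there are at most richness (line i j) choices for l.
  parallel-bound : parallel ℕ.≤ 2 ℕ.* (n ℕ.* collinear)
  parallel-bound = begin
      parallel
        ≤⟨ ∑-mono pairs (λ {p} _ → ∑-mono pairs (λ {q} _ → split p q)) ⟩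
      ∑ pairs (λ p → ∑ pairs (λ q → χ (D? p q) ℕ.+ χ (D? q p)))
        ≡⟨ ∑-cong pairs (λ p → ∑-+ pairs (λ q → χ (D? p q)) (λ q → χ (D? q p))) ⟩
      ∑ pairs (λ p → ∑ pairs (λ q → χ (D? p q)) ℕ.+ ∑ pairs (λ q → χ (D? q p)))
        ≡⟨ ∑-+ pairs (λ p → ∑ pairs (λ q → χ (D? p q))) (λ p → ∑ pairs (λ q → χ (D? q p))) ⟩
      ∑ pairs (λ p → ∑ pairs (λ q → χ (D? p q))) ℕ.+ ∑ pairs (λ p → ∑ pairs (λ q → χ (D? q p)))
        ≡⟨ ≡.cong (∑ pairs (λ p → ∑ pairs (λ q → χ (D? p q))) ℕ.+_) (∑-swap pairs pairs (λ p q → χ (D? q p))) ⟩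
      ∑ pairs (λ p → ∑ pairs (λ q → χ (D? p q))) ℕ.+ ∑ pairs (λ p → ∑ pairs (λ q → χ (D? p q)))
        ≤⟨ ℕ.+-mono-≤ half half ⟩
      n ℕ.* collinear ℕ.+ n ℕ.* collinear
        ≡⟨ ≡.cong (n ℕ.* collinear ℕ.+_) (ℕ.+-identityʳ (n ℕ.* collinear)) ⟨
      2 ℕ.* (n ℕ.* collinear) ∎
    where
    open ℕ.≤-Reasoning
    D : Edge → Edge → Set
    D p q = slopeOf p ≈ slopeOf q × richness (lineOf q) ℕ.≤ richness (lineOf p)
    D? : ∀ p q → Dec (D p q)
    D? p q = (slopeOf p ≈? slopeOf q) ×-dec (richness (lineOf q) ℕ.≤? richness (lineOf p))
    split : ∀ p q → χ (slopeOf p ≈? slopeOf q) ℕ.≤ χ (D? p q) ℕ.+ χ (D? q p)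
    split p q with ℕ.≤-total (richness (lineOf q)) (richness (lineOf p))
    ... | inj₁ h = ℕ.≤-trans (χ-mono (slopeOf p ≈? slopeOf q) (D? p q) (_, h)) (ℕ.m≤m+n _ _)
    ... | inj₂ h = ℕ.≤-trans (χ-mono (slopeOf p ≈? slopeOf q) (D? q p) (λ e → sym e , h)) (ℕ.m≤n+m _ _)
    N? : ∀ p k l → Dec (k ≢ l × D p (k , l))
    N? p k l = ¬? (k ≟ l) ×-dec D? p (k , l)
    -- All these l lie on the line through k parallel to p. Any one of them, l₀, names that line,
    -- and `D` says that it is no richer than the line of p.
    pencil : ∀ p k → ∑ (allFin n) (λ l → χ (N? p k l)) ℕ.≤ richness (lineOf p)
    pencil p k = ∑χ-witness (N? p k) (allFin n) (λ l₀ (k≢l₀ , e₀ , r₀) → ℕ.≤-trans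
      (∑-mono (allFin n) (λ {l} _ → χ-mono (N? p k l) (On? (line k l₀) l) (λ (k≢l , e , _) →
        On-resp {line k l} {line k l₀} (through-same-slope (trans (sym e) e₀)) (onʳ k≢l)))) r₀)
    inner : ∀ p → ∑ pairs (λ q → χ (D? p q)) ℕ.≤ n ℕ.* richness (lineOf p)
    inner p = begin
      ∑ pairs (λ q → χ (D? p q))
        ≡⟨ ∑-filter (λ q → ¬? (proj₁ q ≟ proj₂ q)) square (λ q → χ (D? p q)) ⟩
      ∑ square (λ q → χ (¬? (proj₁ q ≟ proj₂ q)) ℕ.* χ (D? p q))
        ≡⟨ ∑-cong square (λ q → ≡.sym (χ-× (¬? (proj₁ q ≟ proj₂ q)) (D? p q))) ⟩
      ∑ square (λ q → χ (N? p (proj₁ q) (proj₂ q)))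
        ≡⟨ ∑-× (allFin n) (allFin n) (λ q → χ (N? p (proj₁ q) (proj₂ q))) ⟩
      ∑ (allFin n) (λ k → ∑ (allFin n) (λ l → χ (N? p k l)))
        ≤⟨ ∑-bound (allFin n) (λ {k} _ → pencil p k) ⟩
      length (allFin n) ℕ.* richness (lineOf p)
        ≡⟨ ≡.cong (ℕ._* richness (lineOf p)) (length-allFin n) ⟩
      n ℕ.* richness (lineOf p) ∎
    half : ∑ pairs (λ p → ∑ pairs (λ q → χ (D? p q))) ℕ.≤ n ℕ.* collinear
    half = ℕ.≤-trans (∑-mono pairs (λ {p} _ → inner p)) (ℕ.≤-reflexive (∑-*ˡ n pairs (λ p → richness (lineOf p))))

  -- A subset with distinct slopes, by deletion.

  SlopesDistinct : List (Fin n) → Set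
  SlopesDistinct K = ∀ {a b c d} → a ∈ K → b ∈ K → c ∈ K → d ∈ K → a ≢ b → c ≢ d →
    ¬ ((a ≡ c × b ≡ d) ⊎ (a ≡ d × b ≡ c)) → ¬ slope a b ≈ slope c d

  -- Two pairs with equal slope either share a point, and then three points are collinear, or
  -- involve four points. The two kinds are separate hyperedges because sampling keeps them with
  -- different probabilities.
  distinct-slopes : ∀ ρ → 2 ℕ.* (suc ρ ℕ.* collinear ℕ.+ 2 ℕ.* (n ℕ.* collinear)) ℕ.≤ n ℕ.* suc ρ ℕ.^ 3 →
    ∃ λ K → Unique K × n ℕ.≤ 2 ℕ.* suc ρ ℕ.* length K × SlopesDistinct K
  distinct-slopes ρ few = go (independent-set H₃ H₄ u₃ u₄ (ℕ.≤-trans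
      (ℕ.*-monoʳ-≤ 2 (ℕ.+-mono-≤ (ℕ.*-monoʳ-≤ (suc ρ) small₃) (ℕ.≤-trans small₄ parallel-bound))) few))
    where
    open Deletion {n} ρ
    triple : Edge × Fin n → Hyperedge
    triple ((i , j) , k) = i , j ∷ k ∷ []
    quadruple : Edge × Edge → Hyperedge
    quadruple ((i , j) , (k , l)) = i , j ∷ k ∷ l ∷ []
    B₃ : Edge × Fin n → Set
    B₃ x = Unique (vertices (triple x)) × On (lineOf (proj₁ x)) (proj₂ x)
    B₃? : ∀ x → Dec (B₃ x)
    B₃? x = unique? _≟_ (vertices (triple x)) ×-dec On? (lineOf (proj₁ x)) (proj₂ x)
    B₄ : Edge × Edge → Set
    B₄ x = Unique (vertices (quadruple x)) × slopeOf (proj₁ x) ≈ slopeOf (proj₂ x)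
    B₄? : ∀ x → Dec (B₄ x)
    B₄? x = unique? _≟_ (vertices (quadruple x)) ×-dec (slopeOf (proj₁ x) ≈? slopeOf (proj₂ x))
    L₃ : List (Edge × Fin n)
    L₃ = filter B₃? (cartesianProduct pairs (allFin n))
    L₄ : List (Edge × Edge)
    L₄ = filter B₄? (cartesianProduct pairs pairs)
    H₃ H₄ : List Hyperedge
    H₃ = map triple L₃
    H₄ = map quadruple L₄
    u₃ : ∀ {h} → h ∈ H₃ → Unique (vertices h) × length (vertices h) ≡ 3
    u₃ h∈ with ∈-map⁻ triple h∈
    ... | x , x∈ , ≡.refl = proj₁ (proj₂ (∈-filter⁻ B₃? {xs = cartesianProduct pairs (allFin n)} x∈)) , ≡.refl
    u₄ : ∀ {h} → h ∈ H₄ → Unique (vertices h) × length (vertices h) ≡ 4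
    u₄ h∈ with ∈-map⁻ quadruple h∈
    ... | x , x∈ , ≡.refl = proj₁ (proj₂ (∈-filter⁻ B₄? {xs = cartesianProduct pairs pairs} x∈)) , ≡.refl
    open ℕ.≤-Reasoning
    small₃ : length H₃ ℕ.≤ collinear
    small₃ = begin
      length H₃                                          ≡⟨ length-map triple L₃ ⟩
      length L₃                                          ≡⟨ length-filter≡∑ B₃? (cartesianProduct pairs (allFin n)) ⟩
      ∑ (cartesianProduct pairs (allFin n)) (χ ∘ B₃?)    ≡⟨ ∑-× pairs (allFin n) (χ ∘ B₃?) ⟩
      ∑ pairs (λ p → ∑ (allFin n) (λ k → χ (B₃? (p , k)))) ≤⟨ ∑-mono pairs (λ {p} _ → ∑-mono (allFin n) (λ {k} _ → χ-mono (B₃? (p , k)) (On? (lineOf p) k) proj₂)) ⟩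
      collinear                                          ∎
    small₄ : length H₄ ℕ.≤ parallel
    small₄ = begin
      length H₄                                          ≡⟨ length-map quadruple L₄ ⟩
      length L₄                                          ≡⟨ length-filter≡∑ B₄? (cartesianProduct pairs pairs) ⟩
      ∑ (cartesianProduct pairs pairs) (χ ∘ B₄?)         ≡⟨ ∑-× pairs pairs (χ ∘ B₄?) ⟩
      ∑ pairs (λ p → ∑ pairs (λ q → χ (B₄? (p , q))))    ≤⟨ ∑-mono pairs (λ {p} _ → ∑-mono pairs (λ {q} _ → χ-mono (B₄? (p , q)) (slopeOf p ≈? slopeOf q) proj₂)) ⟩
      parallel                                           ∎
    ∈pairs : ∀ {i j} → i ≢ j → (i , j) ∈ pairs
    ∈pairs i≢j = ∈-filter⁺ (λ p → ¬? (proj₁ p ≟ proj₂ p)) (∈-cartesianProduct⁺ (∈-allFin _) (∈-allFin _)) i≢j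
    go : (∃ λ K → Unique K × n ℕ.≤ 2 ℕ.* suc ρ ℕ.* length K × (∀ {h} → h ∈ H₃ ++ H₄ → ¬ All (_∈ K) (vertices h))) →
         ∃ λ K → Unique K × n ℕ.≤ 2 ℕ.* suc ρ ℕ.* length K × SlopesDistinct K
    go (K , K! , size , independent) = K , K! , size , distinct
      where
      common : ∀ {a b d} → a ∈ K → b ∈ K → d ∈ K → a ≢ b → a ≢ d → b ≢ d → ¬ slope a b ≈ slope a d
      common {a} {b} {d} a∈ b∈ d∈ a≢b a≢d b≢d e = independent
        (∈-++⁺ˡ (∈-map⁺ triple (∈-filter⁺ B₃? (∈-cartesianProduct⁺ (∈pairs a≢b) (∈-allFin d))
          ((a≢b ∷ a≢d ∷ []) ∷ (b≢d ∷ []) ∷ [] ∷ [] , On-resp {line a d} {line a b} (through-same-slope (sym e)) (onʳ a≢d)))))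
        (a∈ ∷ b∈ ∷ d∈ ∷ [])
      distinct : SlopesDistinct K
      -- When the pairs share a point, `slope-sym` reverses them until that point comes first in
      -- both.
      distinct {a} {b} {c} {d} a∈ b∈ c∈ d∈ a≢b c≢d ne e with a ≟ c | a ≟ d | b ≟ c | b ≟ d
      ... | yes ≡.refl | _ | _ | _ = common a∈ b∈ d∈ a≢b c≢d (λ p → ne (inj₁ (≡.refl , p))) e
      ... | no a≢c | yes ≡.refl | _ | _ = common a∈ b∈ c∈ a≢b a≢c (λ p → ne (inj₂ (≡.refl , p))) (trans e (slope-sym c≢d))
      ... | no a≢c | no a≢d | yes ≡.refl | _ = common b∈ a∈ d∈ (a≢b ∘ ≡.sym) c≢d a≢d (trans (slope-sym (a≢b ∘ ≡.sym)) e)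
      ... | no a≢c | no a≢d | no b≢c | yes ≡.refl = common b∈ a∈ c∈ (a≢b ∘ ≡.sym) b≢c a≢c
              (trans (slope-sym (a≢b ∘ ≡.sym)) (trans e (slope-sym c≢d)))
      ... | no a≢c | no a≢d | no b≢c | no b≢d = independent
              (∈-++⁺ʳ H₃ (∈-map⁺ quadruple (∈-filter⁺ B₄? (∈-cartesianProduct⁺ (∈pairs a≢b) (∈pairs c≢d))
                ((a≢b ∷ a≢c ∷ a≢d ∷ []) ∷ (b≢c ∷ b≢d ∷ []) ∷ (c≢d ∷ []) ∷ [] ∷ [] , e))))
              (a∈ ∷ b∈ ∷ c∈ ∷ d∈ ∷ [])

-- Let M = κ n² l and let r = 1 + ρ be least with 8 M ≤ r³. As κ l ≤ n gives r ≤ 2 n, the r T term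
-- is at most the size of the 2 n T term and the total is at most 8 n T ≤ n r³. Minimality gives r³
-- = O(M), so k ≈ n / (2 r) satisfies n³ = O(M k³), which is n = O(k³ l) after division by n².
lower-arithmetic : ∀ κ n l .{{_ : ℕ.NonZero κ}} .{{_ : ℕ.NonZero n}} → 1 ℕ.≤ l → κ ℕ.* l ℕ.≤ n →
  ∃ λ ρ → ∃ λ k → (∀ {T} → T ℕ.≤ n ℕ.* n ℕ.* l ℕ.* κ → 2 ℕ.* (suc ρ ℕ.* T ℕ.+ 2 ℕ.* (n ℕ.* T)) ℕ.≤ n ℕ.* suc ρ ℕ.^ 3)
    × (∀ {m} → n ℕ.≤ 2 ℕ.* suc ρ ℕ.* m → k ℕ.≤ m) × n ℕ.≤ κ ℕ.* 512 ℕ.* (k ℕ.^ 3 ℕ.* l)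
lower-arithmetic κ n l l≥1 κl≤n = pick (least (λ r → 8 ℕ.* M ℕ.≤? r ℕ.^ 3) (2 ℕ.* n) 8M≤[2n]³)
  where
  open ℕ.≤-Reasoning
  M : ℕ
  M = n ℕ.* n ℕ.* l ℕ.* κ
  M>0 : 1 ℕ.≤ M
  M>0 = ℕ.>-nonZero⁻¹ M {{ℕ.m*n≢0 (n ℕ.* n ℕ.* l) κ {{ℕ.m*n≢0 (n ℕ.* n) l {{ℕ.m*n≢0 n n}} {{ℕ.>-nonZero l≥1}}}}}}
  8M≤[2n]³ : 8 ℕ.* M ℕ.≤ (2 ℕ.* n) ℕ.^ 3
  8M≤[2n]³ = begin
    8 ℕ.* M                        ≡⟨ ≡.cong (8 ℕ.*_) (lemma n l κ) ⟩
    8 ℕ.* (n ℕ.* n ℕ.* (κ ℕ.* l))  ≤⟨ ℕ.*-monoʳ-≤ 8 (ℕ.*-monoʳ-≤ (n ℕ.* n) κl≤n) ⟩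
    8 ℕ.* (n ℕ.* n ℕ.* n)          ≡⟨ cube n ⟩
    (2 ℕ.* n) ℕ.^ 3                ∎
    where
    lemma : ∀ n l κ → n ℕ.* n ℕ.* l ℕ.* κ ≡ n ℕ.* n ℕ.* (κ ℕ.* l)
    lemma = solve-∀
    cube : ∀ n → 8 ℕ.* (n ℕ.* n ℕ.* n) ≡ 2 ℕ.* n ℕ.* (2 ℕ.* n ℕ.* (2 ℕ.* n ℕ.* 1))
    cube = solve-∀
  pick : (∃ λ r → 8 ℕ.* M ℕ.≤ r ℕ.^ 3 × (∀ {j} → 8 ℕ.* M ℕ.≤ j ℕ.^ 3 → r ℕ.≤ j)) →
    ∃ λ ρ → ∃ λ k → (∀ {T} → T ℕ.≤ M → 2 ℕ.* (suc ρ ℕ.* T ℕ.+ 2 ℕ.* (n ℕ.* T)) ℕ.≤ n ℕ.* suc ρ ℕ.^ 3)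
      × (∀ {m} → n ℕ.≤ 2 ℕ.* suc ρ ℕ.* m → k ℕ.≤ m) × n ℕ.≤ κ ℕ.* 512 ℕ.* (k ℕ.^ 3 ℕ.* l)
  -- 8 M ≥ 8 excludes r ≤ 1. Hence ρ ≥ 1 and r ≤ 2 ρ, so minimality at ρ loses only a factor 2 in r.
  pick (zero , h , _) = contradiction (ℕ.≤-trans (ℕ.*-monoʳ-≤ 8 M>0) h) λ ()
  pick (suc zero , h , _) = contradiction (ℕ.≤-trans (ℕ.*-monoʳ-≤ 8 M>0) h) λ { (ℕ.s≤s ()) }
  pick (suc ρ@(suc _) , h , min) with least (λ k → n ℕ.≤? 2 ℕ.* suc ρ ℕ.* k) n (ℕ.m≤n*m n (2 ℕ.* suc ρ))
  ... | k , n≤2rk , k-min = ρ , k , sparse , k-min , ℕ.*-cancelˡ-≤ (n ℕ.* n) {{ℕ.m*n≢0 n n}} large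
    where
    r : ℕ
    r = suc ρ
    r≤2n : r ℕ.≤ 2 ℕ.* n
    r≤2n = min 8M≤[2n]³
    sparse : ∀ {T} → T ℕ.≤ M → 2 ℕ.* (r ℕ.* T ℕ.+ 2 ℕ.* (n ℕ.* T)) ℕ.≤ n ℕ.* r ℕ.^ 3
    sparse {T} T≤M = begin
      2 ℕ.* (r ℕ.* T ℕ.+ 2 ℕ.* (n ℕ.* T))              ≤⟨ ℕ.*-monoʳ-≤ 2 (ℕ.+-monoˡ-≤ _ (ℕ.*-monoˡ-≤ T r≤2n)) ⟩
      2 ℕ.* (2 ℕ.* n ℕ.* T ℕ.+ 2 ℕ.* (n ℕ.* T))        ≡⟨ lemma n T ⟩
      n ℕ.* (8 ℕ.* T)                                  ≤⟨ ℕ.*-monoʳ-≤ n (ℕ.≤-trans (ℕ.*-monoʳ-≤ 8 T≤M) h) ⟩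
      n ℕ.* r ℕ.^ 3                                    ∎
      where
      lemma : ∀ n T → 2 ℕ.* (2 ℕ.* n ℕ.* T ℕ.+ 2 ℕ.* (n ℕ.* T)) ≡ n ℕ.* (8 ℕ.* T)
      lemma = solve-∀
    ρ³≤8M : ρ ℕ.^ 3 ℕ.≤ 8 ℕ.* M
    ρ³≤8M = ℕ.<⇒≤ (ℕ.≰⇒> λ q → ℕ.1+n≰n (min q))
    r≤2ρ : r ℕ.≤ 2 ℕ.* ρ
    r≤2ρ = ℕ.≤-trans (ℕ.+-monoˡ-≤ ρ (ℕ.s≤s ℕ.z≤n)) (ℕ.≤-reflexive (≡.cong (ρ ℕ.+_) (≡.sym (ℕ.+-identityʳ ρ))))
    large : n ℕ.* n ℕ.* n ℕ.≤ n ℕ.* n ℕ.* (κ ℕ.* 512 ℕ.* (k ℕ.^ 3 ℕ.* l))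
    large = begin
      n ℕ.* n ℕ.* n                                       ≡⟨ l₁ n ⟩
      n ℕ.^ 3                                             ≤⟨ ℕ.^-monoˡ-≤ 3 (ℕ.≤-trans n≤2rk (ℕ.*-monoˡ-≤ k (ℕ.*-monoʳ-≤ 2 r≤2ρ))) ⟩
      (2 ℕ.* (2 ℕ.* ρ) ℕ.* k) ℕ.^ 3                       ≡⟨ l₂ ρ k ⟩
      ρ ℕ.^ 3 ℕ.* (k ℕ.^ 3 ℕ.* 64)                        ≤⟨ ℕ.*-monoˡ-≤ (k ℕ.^ 3 ℕ.* 64) ρ³≤8M ⟩
      8 ℕ.* M ℕ.* (k ℕ.^ 3 ℕ.* 64)                        ≡⟨ l₃ n l κ (k ℕ.^ 3) ⟩
      n ℕ.* n ℕ.* (κ ℕ.* 512 ℕ.* (k ℕ.^ 3 ℕ.* l))         ∎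
      where
      l₁ : ∀ n → n ℕ.* n ℕ.* n ≡ n ℕ.* (n ℕ.* (n ℕ.* 1))
      l₁ = solve-∀
      l₂ : ∀ ρ k → (2 ℕ.* (2 ℕ.* ρ) ℕ.* k) ℕ.* ((2 ℕ.* (2 ℕ.* ρ) ℕ.* k) ℕ.* ((2 ℕ.* (2 ℕ.* ρ) ℕ.* k) ℕ.* 1)) ≡ ρ ℕ.* (ρ ℕ.* (ρ ℕ.* 1)) ℕ.* (k ℕ.* (k ℕ.* (k ℕ.* 1)) ℕ.* 64)
      l₂ = solve-∀
      l₃ : ∀ n l κ c → 8 ℕ.* (n ℕ.* n ℕ.* l ℕ.* κ) ℕ.* (c ℕ.* 64) ≡ n ℕ.* n ℕ.* (κ ℕ.* 512 ℕ.* (c ℕ.* l))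
      l₃ = solve-∀

-- The lower bound: from an arbitrary point set to distinct abscissae.

module LowerBound (𝔽 : RealClosedField) where
  open RealClosedField 𝔽 hiding (zero)
  open OrderedField 𝔽
  open Plane 𝔽
  open Algebra.Properties.Ring ring using (-‿distribˡ-*)
  open Solver using (solve; _:=_; _:+_; _:*_; _:-_; :-_)

  -- A pair of points spoils at most one ε, for two of them would force both coordinates to agree.
  -- Among the n² + 1 values 0, ..., n² one is therefore good, by the pigeonhole principle on index
  -- pairs.
  shear : ∀ {n} ((P , _) : PointSet n) → ∃ λ ε → ∀ i j → i ≢ j → x (P i) + ε * y (P i) ≉ x (P j) + ε * y (P j)
  shear {n} (P , distinct) = search (Fin.any? (λ k → ¬? (bad? k)))
    where
    Bad : Fin (suc (n ℕ.* n)) → Fin n → Fin n → Set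
    Bad k i j = i ≢ j × x (P i) + ιℕ (toℕ k) * y (P i) ≈ x (P j) + ιℕ (toℕ k) * y (P j)
    bad? : ∀ k → Dec (∃ λ i → ∃ λ j → Bad k i j)
    bad? k = Fin.any? λ i → Fin.any? λ j → ¬? (i ≟ j) ×-dec (_ ≈? _)
    search : Dec (∃ λ k → ¬ ∃ λ i → ∃ λ j → Bad k i j) →
             ∃ λ ε → ∀ i j → i ≢ j → x (P i) + ε * y (P i) ≉ x (P j) + ε * y (P j)
    search (yes (k , good)) = ιℕ (toℕ k) , λ i j ne e → good (i , j , ne , e)
    search (no ¬good) = ⊥-elim (clash (Fin.pigeonhole ℕ.≤-refl pairIndex))
      where
      bad : ∀ k → ∃ λ i → ∃ λ j → Bad k i j
      bad k with bad? k
      ... | yes b = b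
      ... | no ¬b = contradiction (k , ¬b) ¬good
      pairIndex : Fin (suc (n ℕ.* n)) → Fin (n ℕ.* n)
      pairIndex k = combine (proj₁ (bad k)) (proj₁ (proj₂ (bad k)))
      clash : (∃ λ k → ∃ λ l → toℕ k ℕ.< toℕ l × pairIndex k ≡ pairIndex l) → ⊥
      clash (k , l , k<l , eq) with bad k | bad l | Fin.combine-injective (proj₁ (bad k)) (proj₁ (proj₂ (bad k))) _ _ eq
      ... | i , j , i≢j , p | .i , .j , _ , q | ≡.refl , ≡.refl = distinct i j i≢j (x≈ , y≈)
        where
        e≉f : ιℕ (toℕ k) ≉ ιℕ (toℕ l)
        e≉f r = ℕ.<⇒≢ k<l (ιℕ-injective r)
        y≈ : y (P i) ≈ y (P j)
        y≈ = -≈0⇒≈ (*-cancel e≉f (-≈0⇒≈ (trans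
          (solve 6 (λ e f a b c d → e :* (b :- d) :- f :* (b :- d) := ((a :+ e :* b) :- (c :+ e :* d)) :- ((a :+ f :* b) :- (c :+ f :* d)))
             refl (ιℕ (toℕ k)) (ιℕ (toℕ l)) (x (P i)) (y (P i)) (x (P j)) (y (P j)))
          (trans (+-cong (≈⇒-≈0 p) (-‿cong (≈⇒-≈0 q))) (-‿inverseʳ 0#)))))
        x≈ : x (P i) ≈ x (P j)
        x≈ = -≈0⇒≈ (trans
          (solve 5 (λ e a b c d → a :- c := ((a :+ e :* b) :- (c :+ e :* d)) :- e :* (b :- d)) refl (ιℕ (toℕ k)) (x (P i)) (y (P i)) (x (P j)) (y (P j)))
          (trans (+-cong (≈⇒-≈0 p) (-‿cong (trans (*-congˡ (≈⇒-≈0 y≈)) (zeroʳ _)))) (-‿inverseʳ 0#)))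

  private
    shear-line : ∀ m e c a b → (m * a + (m * e * b - b)) - (- c) ≈ (m * (a + e * b) + c) - b
    shear-line = solve 5 (λ m e c a b → (m :* a :+ (m :* e :* b :- b)) :- (:- c) := (m :* (a :+ e :* b) :+ c) :- b) refl

    shear-difference : ∀ e a b c d → (c + e * d) - (a + e * b) ≈ (c - a) + e * (d - b)
    shear-difference = solve 5 (λ e a b c d → (c :+ e :* d) :- (a :+ e :* b) := (c :- a) :+ e :* (d :- b)) refl

    shear-determinant : ∀ e s t s′ t′ → (s + e * t) * t′ - t * (s′ + e * t′) ≈ s * t′ - t * s′
    shear-determinant = solve 5 (λ e s t s′ t′ → (s :+ e :* t) :* t′ :- t :* (s′ :+ e :* t′) := s :* t′ :- t :* s′) refl

    slope-determinant : ∀ u v m m′ → v * (u * (m - m′)) ≈ (m * u) * v - u * (m′ * v)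
    slope-determinant = solve 4 (λ u v m m′ → v :* (u :* (m :- m′)) := (m :* u) :* v :- u :* (m′ :* v)) refl

  module Sheared {n : ℕ} (p : Fin n → Point) (ε : Carrier)
    (X-distinct : ∀ i j → i ≢ j → ¬ (x (p i) + ε * y (p i) ≈ x (p j) + ε * y (p j))) where

    X Y : Fin n → Carrier
    X i = x (p i) + ε * y (p i)
    Y i = y (p i)

    open Configuration 𝔽 n X Y X-distinct public

    -- The line Y = m X + c in sheared coordinates is m x + (m ε - 1) y = - c in the original ones;
    -- for m = 0 the coefficient of y is - 1, so this is always a line.
    richness≤ : ∀ {s} → AtMostOnLine s p → ∀ L → richness L ℕ.≤ s
    richness≤ {s} at-most L@(m , c) = ℕ.≮⇒≥ λ s<r →
      let g , g-inj , g∈ = choose (Unique.filter⁺ (On? L) (Unique.allFin⁺ n))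
                             (ℕ.≤-trans s<r (ℕ.≤-reflexive (≡.sym (length-filter≡∑ (On? L) (allFin n)))))
      in at-most m (m * ε - 1#) (- c) nonzero g g-inj λ i → on (g i) (proj₂ (∈-filter⁻ (On? L) {xs = allFin n} (g∈ i)))
      where
      nonzero : ¬ (m ≈ 0# × m * ε - 1# ≈ 0#)
      nonzero (m≈0 , q) = <⇒≉ 0<1 (trans (sym (trans (*-congʳ m≈0) (zeroˡ ε))) (-≈0⇒≈ q))
      on : ∀ k → On L k → OnLine m (m * ε - 1#) (- c) (p k)
      on k q = -≈0⇒≈ (trans (+-congʳ (+-congˡ (trans (distribʳ (y (p k)) (m * ε) (- 1#)) (+-congˡ (trans (sym (-‿distribˡ-* 1# (y (p k)))) (-‿cong (*-identityˡ _)))))))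
        (trans (shear-line m ε c (x (p k)) (y (p k)))
               (≈⇒-≈0 (sym q))))

    collinear≤ : .{{_ : ℕ.NonZero n}} → ∀ {s} L → 1 ℕ.≤ s → 2 ℕ.^ L ℕ.≤ s → s ℕ.< 2 ℕ.^ suc L → AtMostOnLine s p →
                 collinear ℕ.≤ suc L ℕ.* (8 ℕ.* (n ℕ.* n ℕ.* 1152 ℕ.+ 6 ℕ.* n ℕ.* (s ℕ.* s)))
    collinear≤ {s} L s≥1 2^L≤s s<2^1+L at-most =
      collinear-bound {s} {L} s≥1 2^L≤s s<2^1+L (λ {q} _ → richness≤ at-most (lineOf q))

    -- A shear has determinant 1, so the determinant of two difference vectors, whose vanishing is
    -- `SameSlope`, does not change.
    same-slope⇒ : ∀ {a b c d} → a ≢ b → c ≢ d → SameSlope (p a) (p b) (p c) (p d) → slope a b ≈ slope c d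
    same-slope⇒ {a} {b} {c} {d} a≢b c≢d h = -≈0⇒≈ (*≈0⇒≈0 (-≉0 (X-distinct b a (a≢b ∘ ≡.sym)))
        (*≈0⇒≈0 (-≉0 (X-distinct d c (c≢d ∘ ≡.sym))) zero-product))
      where
      open Relation.Binary.Reasoning.Setoid setoid
      u v : Carrier
      u = X b - X a
      v = X d - X c
      key : u * (Y d - Y c) ≈ (Y b - Y a) * v
      key = -≈0⇒≈ (trans (+-cong (*-congʳ (shear-difference ε (x (p a)) (Y a) (x (p b)) (Y b)))
        (-‿cong (*-congˡ (shear-difference ε (x (p c)) (Y c) (x (p d)) (Y d)))))
        (trans (shear-determinant ε (x (p b) - x (p a)) (Y b - Y a) (x (p d) - x (p c)) (Y d - Y c))
               (≈⇒-≈0 h)))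
      zero-product : v * (u * (slope a b - slope c d)) ≈ 0#
      zero-product = begin
        v * (u * (slope a b - slope c d))                  ≈⟨ slope-determinant u v (slope a b) (slope c d) ⟩
        (slope a b * u) * v - u * (slope c d * v)          ≈⟨ +-cong (*-congʳ (slope-spec a≢b)) (-‿cong (*-congˡ (slope-spec c≢d))) ⟩
        (Y b - Y a) * v - u * (Y d - Y c)                  ≈⟨ ≈⇒-≈0 (sym key) ⟩
        0#                                                 ∎

    extract : ∀ ρ k → 2 ℕ.* (suc ρ ℕ.* collinear ℕ.+ 2 ℕ.* (n ℕ.* collinear)) ℕ.≤ n ℕ.* suc ρ ℕ.^ 3 →
              (∀ {m} → n ℕ.≤ 2 ℕ.* suc ρ ℕ.* m → k ℕ.≤ m) → HasDistinctSlopeSubset k p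
    extract ρ k few k-min =
      let K , K! , size , distinct = distinct-slopes ρ few
          g , g-inj , g∈ = choose K! (k-min size)
      in g , g-inj , λ i j i′ j′ i≢j i′≢j′ ne same →
           distinct (g∈ i) (g∈ j) (g∈ i′) (g∈ j′) (i≢j ∘ g-inj) (i′≢j′ ∘ g-inj)
             (λ { (inj₁ (e , f)) → ne (inj₁ (g-inj e , g-inj f)) ; (inj₂ (e , f)) → ne (inj₂ (g-inj e , g-inj f)) })
             (same-slope⇒ (i≢j ∘ g-inj) (i′≢j′ ∘ g-inj) same)

  lower-bound : ∀ (C : ℕ) → ∃ λ (d : ℕ) → ∃ λ (N : ℕ) →
    ∀ (n s : ℕ) → N ℕ.≤ n → 2 ℕ.≤ s → s ℕ.≤ n → s ℕ.* s ℕ.≤ C ℕ.* C ℕ.* n →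
    ∃ λ (k : ℕ) → h≥ n s k × n ℕ.≤ d ℕ.* (k ℕ.^ 3 ℕ.* ⌈log₂ s ⌉)
  -- The constant is κ = 96 C² + 18432, from 2 l · 8 · (1152 + 6 C²) n² with s² ≤ C² n; 2 l with l =
  -- ⌈log₂ s⌉ ≥ 1 bounds the number 1 + L of dyadic classes. The factor 512 comes from
  -- `lower-arithmetic`.
  lower-bound C = suc (C ℕ.* C ℕ.* 96 ℕ.+ 18431) ℕ.* 512 , 1 , λ n s n≥1 2≤s _ ss≤ →
      bound (suc (C ℕ.* C ℕ.* 96 ℕ.+ 18431)) n s {{_}} {{ℕ.>-nonZero n≥1}} 2≤s (λ l → begin
        (l ℕ.+ l) ℕ.* (8 ℕ.* (n ℕ.* n ℕ.* 1152 ℕ.+ 6 ℕ.* n ℕ.* (s ℕ.* s)))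
          ≤⟨ ℕ.*-monoʳ-≤ (l ℕ.+ l) (ℕ.*-monoʳ-≤ 8 (ℕ.+-monoʳ-≤ (n ℕ.* n ℕ.* 1152) (ℕ.*-monoʳ-≤ (6 ℕ.* n) ss≤))) ⟩
        (l ℕ.+ l) ℕ.* (8 ℕ.* (n ℕ.* n ℕ.* 1152 ℕ.+ 6 ℕ.* n ℕ.* (C ℕ.* C ℕ.* n)))
          ≡⟨ collect n l C ⟩
        n ℕ.* n ℕ.* l ℕ.* (1 ℕ.+ (C ℕ.* C ℕ.* 96 ℕ.+ 18431)) ∎)
    where
    open ℕ.≤-Reasoning
    collect : ∀ n l C → (l ℕ.+ l) ℕ.* (8 ℕ.* (n ℕ.* n ℕ.* 1152 ℕ.+ 6 ℕ.* n ℕ.* (C ℕ.* C ℕ.* n))) ≡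
                        n ℕ.* n ℕ.* l ℕ.* (1 ℕ.+ (C ℕ.* C ℕ.* 96 ℕ.+ 18431))
    collect = solve-∀
    bound : ∀ κ n s .{{_ : ℕ.NonZero κ}} .{{_ : ℕ.NonZero n}} → 2 ℕ.≤ s →
            (∀ l → (l ℕ.+ l) ℕ.* (8 ℕ.* (n ℕ.* n ℕ.* 1152 ℕ.+ 6 ℕ.* n ℕ.* (s ℕ.* s))) ℕ.≤ n ℕ.* n ℕ.* l ℕ.* κ) →
            ∃ λ k → h≥ n s k × n ℕ.≤ κ ℕ.* 512 ℕ.* (k ℕ.^ 3 ℕ.* ⌈log₂ s ⌉)
    bound κ n s 2≤s κ-large with ℕ.≤-total n (κ ℕ.* ⌈log₂ s ⌉)
    -- For n ≤ κ log s a single point is enough, and it determines no slopes.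
    ... | inj₁ small = 1 , (λ _ _ → (λ _ → fromℕ< (ℕ.>-nonZero⁻¹ n))
                              , (λ { {zero} {zero} _ → ≡.refl })
                              , λ { zero zero _ _ i≢j → contradiction ≡.refl i≢j }) ,
            ℕ.≤-trans small (ℕ.*-mono-≤ (ℕ.m≤m*n κ 512) (ℕ.≤-reflexive (≡.sym (ℕ.+-identityʳ ⌈log₂ s ⌉))))
    ... | inj₂ large =
      let s≥1 = ℕ.≤-trans (ℕ.s≤s ℕ.z≤n) 2≤s
          L , 2^L≤s , s<2^1+L = dyadic s s≥1
          l≥1 = ⌈log₂⌉-mono-≤ 2≤s
          l≥L = ℕ.≤-trans (ℕ.≤-reflexive (≡.sym (⌈log₂2^n⌉≡n L))) (⌈log₂⌉-mono-≤ 2^L≤s)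
          ρ , k , sparse , k-min , size = lower-arithmetic κ n ⌈log₂ s ⌉ l≥1 large
      in k , (λ P at-most → let ε , X-distinct = shear P in
             Sheared.extract (proj₁ P) ε X-distinct ρ k
               (sparse (ℕ.≤-trans (Sheared.collinear≤ (proj₁ P) ε X-distinct L s≥1 2^L≤s s<2^1+L at-most)
                 (ℕ.≤-trans (ℕ.*-monoˡ-≤ _ (ℕ.+-mono-≤ l≥1 l≥L)) (κ-large ⌈log₂ s ⌉)))) k-min) , size

-- The upper bound for small s: points on a parabola.

module Parabola (𝔽 : RealClosedField) where
  open RealClosedField 𝔽 hiding (zero)
  open OrderedField 𝔽
  open Plane 𝔽
  open Solver using (solve; _:=_; _:+_; _:*_; _:-_; :-_)

  private
    secant : ∀ a b u v → (u - v) * (a + b * (u + v)) ≈ (a * u + b * (u * u)) - (a * v + b * (v * v))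
    secant = solve 4 (λ a b u v → (u :- v) :* (a :+ b :* (u :+ v)) := (a :* u :+ b :* (u :* u)) :- (a :* v :+ b :* (v :* v))) refl

    secant-difference : ∀ a b u v w → (v - w) * b ≈ (a + b * (u + v)) - (a + b * (u + w))
    secant-difference = solve 5 (λ a b u v w → (v :- w) :* b := (a :+ b :* (u :+ v)) :- (a :+ b :* (u :+ w))) refl

    chord : ∀ i j k l → (j - i) * (l * l - k * k) - (j * j - i * i) * (l - k) ≈ ((j - i) * (l - k)) * ((k + l) - (i + j))
    chord = solve 4 (λ i j k l → (j :- i) :* (l :* l :- k :* k) :- (j :* j :- i :* i) :* (l :- k) := ((j :- i) :* (l :- k)) :* ((k :+ l) :- (i :+ j))) refl

  parabola : ∀ n → Fin n → Point
  parabola n i = ιℕ (toℕ i) , ιℕ (toℕ i) * ιℕ (toℕ i)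

  parabola-x : ∀ {n} {i j : Fin n} → i ≢ j → ιℕ (toℕ i) ≉ ιℕ (toℕ j)
  parabola-x i≢j p = i≢j (Fin.toℕ-injective (ιℕ-injective p))

  -- Two points with parameters t, t′ on a line give a + b (t + t′) = 0; two such equations with a
  -- common parameter yield b = 0, then a = 0. Three points suffice, and 2 ≤ s supplies them.
  parabola-at-most : ∀ {n s} → 2 ℕ.≤ s → AtMostOnLine s (parabola n)
  parabola-at-most {n} {suc (suc s)} (ℕ.s≤s (ℕ.s≤s _)) a b c nonzero g g-inj on = nonzero (a≈0 , b≈0)
    where
    t : Fin (suc (suc (suc s))) → Carrier
    t i = ιℕ (toℕ (g i))
    i₁ : Fin (suc (suc (suc s)))
    i₁ = suc zero
    i₂ : Fin (suc (suc (suc s)))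
    i₂ = suc (suc zero)
    distinct : ∀ {i j} → i ≢ j → t i ≉ t j
    distinct i≢j = parabola-x (i≢j ∘ g-inj)
    slope : ∀ {i j} → i ≢ j → a + b * (t i + t j) ≈ 0#
    slope {i} {j} i≢j = *≈0⇒≈0 (-≉0 (distinct i≢j)) (trans (secant a b (t i) (t j)) (≈⇒-≈0 (trans (on i) (sym (on j)))))
    b≈0 : b ≈ 0#
    b≈0 = *≈0⇒≈0 (-≉0 (distinct {i₁} {i₂} λ ())) (trans (secant-difference a b (t zero) (t i₁) (t i₂))
            (trans (+-cong (slope λ ()) (-‿cong (slope λ ()))) (-‿inverseʳ 0#)))
    a≈0 : a ≈ 0#
    a≈0 = trans (sym (+-identityʳ a)) (trans (+-congˡ (sym (trans (*-congʳ b≈0) (zeroˡ _)))) (slope {zero} {i₁} λ ()))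

  equal-sums : ∀ {n} (i j k l : Fin n) → toℕ i ℕ.+ toℕ j ≡ toℕ k ℕ.+ toℕ l →
               SameSlope (parabola n i) (parabola n j) (parabola n k) (parabola n l)
  equal-sums i j k l eq = -≈0⇒≈ (trans (chord (ιℕ (toℕ i)) (ιℕ (toℕ j)) (ιℕ (toℕ k)) (ιℕ (toℕ l)))
    (trans (*-congˡ (≈⇒-≈0 sums)) (zeroʳ _)))
    where
    sums : ιℕ (toℕ k) + ιℕ (toℕ l) ≈ ιℕ (toℕ i) + ιℕ (toℕ j)
    sums = trans (sym (ι-+ (+ toℕ k) (+ toℕ l))) (trans (reflexive (≡.cong ιℕ (≡.sym eq))) (ι-+ (+ toℕ i) (+ toℕ j)))

  -- Among A + A points with distinct slopes, the sums of one of the first A and one of the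
  -- last A parameters are distinct.
  parabola-sparse : ∀ {n A} → n ℕ.+ n ℕ.< A ℕ.* A → ¬ HasDistinctSlopeSubset (A ℕ.+ A) (parabola n)
  parabola-sparse {n} {A} small (g , g-inj , distinct) = ℕ.<⇒≱ small (begin
      A ℕ.* A                                            ≡⟨ ≡.cong₂ ℕ._*_ (length-allFin A) (length-allFin A) ⟨
      length (allFin A) ℕ.* length (allFin A)            ≡⟨ length-× (allFin A) (allFin A) ⟨
      length (cartesianProduct (allFin A) (allFin A))    ≤⟨ length-≤-via {ys = upTo (n ℕ.+ n)} (λ p m → total p ≡ m)
                                                              (Unique.cartesianProduct⁺ (Unique.allFin⁺ A) (Unique.allFin⁺ A))
                                                              (λ {p} _ → total p , ∈-upTo⁺ (ℕ.+-mono-< (Fin.toℕ<n (g (proj₁ p ↑ˡ A))) (Fin.toℕ<n (g (A ↑ʳ proj₂ p)))) , ≡.refl)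
                                                              (λ {p} {q} _ _ e f → unique p q (≡.trans e (≡.sym f))) ⟩
      length (upTo (n ℕ.+ n))                            ≡⟨ length-upTo (n ℕ.+ n) ⟩
      n ℕ.+ n                                            ∎)
    where
    open ℕ.≤-Reasoning
    total : Fin A × Fin A → ℕ
    total (i , j) = toℕ (g (i ↑ˡ A)) ℕ.+ toℕ (g (A ↑ʳ j))
    ↑ˡ≢↑ʳ : ∀ i j → i ↑ˡ A ≢ A ↑ʳ j
    ↑ˡ≢↑ʳ i j e with ≡.trans (≡.sym (Fin.splitAt-↑ˡ A i A)) (≡.trans (≡.cong (splitAt A) e) (Fin.splitAt-↑ʳ A A j))
    ... | ()
    same : ∀ i j k l → total (i , j) ≡ total (k , l) →
           SameSlope (parabola n (g (i ↑ˡ A))) (parabola n (g (A ↑ʳ j))) (parabola n (g (k ↑ˡ A))) (parabola n (g (A ↑ʳ l)))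
    same i j k l = equal-sums (g (i ↑ˡ A)) (g (A ↑ʳ j)) (g (k ↑ˡ A)) (g (A ↑ʳ l))
    unique : ∀ p q → total p ≡ total q → p ≡ q
    unique (i , j) (k , l) e with i Fin.≟ k | j Fin.≟ l
    ... | yes ≡.refl | yes ≡.refl = ≡.refl
    ... | yes _ | no j≢l = contradiction (same i j k l e) (distinct _ _ _ _ (↑ˡ≢↑ʳ i j) (↑ˡ≢↑ʳ k l)
            -- A pair cannot be the other one reversed: its first index comes from the first half
            -- and its second from the last half.
            λ { (inj₁ (_ , q)) → j≢l (Fin.↑ʳ-injective A j l q) ; (inj₂ (q , _)) → ↑ˡ≢↑ʳ i l q })
    ... | no i≢k | _ = contradiction (same i j k l e) (distinct _ _ _ _ (↑ˡ≢↑ʳ i j) (↑ˡ≢↑ʳ k l)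
            λ { (inj₁ (q , _)) → i≢k (Fin.↑ˡ-injective A i k q) ; (inj₂ (q , _)) → ↑ˡ≢↑ʳ i l q })

  upper-bound-√n : ∃ λ (C : ℕ) → ∃ λ (N : ℕ) →
    ∀ (n s : ℕ) → N ℕ.≤ n → 2 ℕ.≤ s → s ℕ.≤ n → s ℕ.^ 8 ℕ.≤ n ℕ.^ 3 →
    ∃ λ (k : ℕ) → h≤ n s k × k ℕ.* k ℕ.≤ C ℕ.* C ℕ.* n
  upper-bound-√n = 6 , 1 , λ n s n≥1 2≤s _ _ → bound n s n≥1 2≤s
    where
    open ℕ.≤-Reasoning
    bound : ∀ n s → 1 ℕ.≤ n → 2 ℕ.≤ s → ∃ λ k → h≤ n s k × k ℕ.* k ℕ.≤ 6 ℕ.* 6 ℕ.* n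
    bound n s n≥1 2≤s with least (λ A → n ℕ.+ n ℕ.<? A ℕ.* A) (suc (n ℕ.+ n)) (ℕ.m≤m*n (suc (n ℕ.+ n)) (suc (n ℕ.+ n)))
    ... | suc zero , h , _ = contradiction h (ℕ.≤⇒≯ (ℕ.≤-trans n≥1 (ℕ.m≤m+n n n)))
    -- The least number with square above 2 n is `suc A`, and k + 1 = 2 (A + 1). As n ≥ 1 makes A ≥
    -- 1, k ≤ 3 A; with A² ≤ 2 n this gives k² ≤ 18 n, rounded up to 6² n.
    ... | suc A@(suc _) , h , min = A ℕ.+ suc A
          , ((parabola n , λ i j i≢j (p , _) → parabola-x i≢j p) , parabola-at-most 2≤s , parabola-sparse {A = suc A} h)
          , (begin
              (A ℕ.+ suc A) ℕ.* (A ℕ.+ suc A)              ≤⟨ ℕ.*-mono-≤ k≤3A k≤3A ⟩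
              3 ℕ.* A ℕ.* (3 ℕ.* A)                        ≡⟨ nine A ⟩
              9 ℕ.* (A ℕ.* A)                              ≤⟨ ℕ.*-monoʳ-≤ 9 (ℕ.≮⇒≥ λ q → ℕ.1+n≰n (min q)) ⟩
              9 ℕ.* (n ℕ.+ n)                              ≤⟨ ℕ.m≤m+n (9 ℕ.* (n ℕ.+ n)) (18 ℕ.* n) ⟩
              9 ℕ.* (n ℕ.+ n) ℕ.+ 18 ℕ.* n                 ≡⟨ thirty-six n ⟩
              6 ℕ.* 6 ℕ.* n                                ∎)
      where
      k≤3A : A ℕ.+ suc A ℕ.≤ 3 ℕ.* A
      k≤3A = ℕ.+-monoʳ-≤ A (ℕ.≤-trans (ℕ.+-monoˡ-≤ A (ℕ.s≤s ℕ.z≤n)) (ℕ.≤-reflexive (≡.cong (A ℕ.+_) (≡.sym (ℕ.+-identityʳ A)))))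
      nine : ∀ A → 3 ℕ.* A ℕ.* (3 ℕ.* A) ≡ 9 ℕ.* (A ℕ.* A)
      nine = solve-∀
      thirty-six : ∀ n → 9 ℕ.* (n ℕ.+ n) ℕ.+ 18 ℕ.* n ≡ 36 ℕ.* n
      thirty-six = solve-∀

-- Residue classes and blocks at a given scale.

quotient-<⇒< : ∀ {q r q′ r′} d → r ℕ.< d → q ℕ.< q′ → q ℕ.* d ℕ.+ r ℕ.< q′ ℕ.* d ℕ.+ r′
quotient-<⇒< {q} {r} {q′} {r′} d r<d q<q′ = ℕ.<-≤-trans (ℕ.+-monoʳ-< (q ℕ.* d) r<d)
  (ℕ.≤-trans (ℕ.≤-reflexive (ℕ.+-comm (q ℕ.* d) d)) (ℕ.≤-trans (ℕ.*-monoˡ-≤ d q<q′) (ℕ.m≤m+n (q′ ℕ.* d) r′)))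

quotient-remainder-unique : ∀ {q r q′ r′} d → r ℕ.< d → r′ ℕ.< d → q ℕ.* d ℕ.+ r ≡ q′ ℕ.* d ℕ.+ r′ → q ≡ q′ × r ≡ r′
quotient-remainder-unique {q} {r} {q′} {r′} d r<d r′<d e with ℕ.<-cmp q q′
... | tri≈ _ ≡.refl _ = ≡.refl , ℕ.+-cancelˡ-≡ (q ℕ.* d) r r′ e
... | tri< q<q′ _ _ = contradiction e (ℕ.<⇒≢ (quotient-<⇒< d r<d q<q′))
... | tri> _ _ q′<q = contradiction (≡.sym e) (ℕ.<⇒≢ (quotient-<⇒< d r′<d q′<q))

-- The residue of t modulo d together with the index of the block of length u d containing t.
code : (d u t : ℕ) .{{_ : ℕ.NonZero d}} .{{_ : ℕ.NonZero u}} → ℕ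
code d u t = t / d / u ℕ.* d ℕ.+ t % d

-- The number of codes does not grow with the scale: a larger d has more residues but
-- correspondingly fewer blocks. Here (block index) · d ≤ t / u ≤ v and the residue is below d ≤ v.
code< : ∀ d u {v t} .{{_ : ℕ.NonZero d}} .{{_ : ℕ.NonZero u}} → d ℕ.≤ v → t ℕ.< v ℕ.* u → code d u t ℕ.< 2 ℕ.* v
code< d u {v} {t} d≤v t<vu = ℕ.<-≤-trans (ℕ.+-mono-≤-< blocks (ℕ.<-≤-trans (m%n<n t d) d≤v))
  (ℕ.≤-reflexive (≡.cong (v ℕ.+_) (≡.sym (ℕ.+-identityʳ v))))
  where
  open ℕ.≤-Reasoning
  instance
    du≢0 : ℕ.NonZero (d ℕ.* u)
    du≢0 = ℕ.m*n≢0 d u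
    ud≢0 : ℕ.NonZero (u ℕ.* d)
    ud≢0 = ℕ.m*n≢0 u d
  blocks : t / d / u ℕ.* d ℕ.≤ v
  blocks = begin
    t / d / u ℕ.* d      ≡⟨ ≡.cong (ℕ._* d) (m/n/o≡m/[n*o] t d u) ⟩
    t / (d ℕ.* u) ℕ.* d  ≡⟨ ≡.cong (ℕ._* d) (/-congʳ {m = t} (ℕ.*-comm d u)) ⟩
    t / (u ℕ.* d) ℕ.* d  ≡⟨ ≡.cong (ℕ._* d) (m/n/o≡m/[n*o] t u d) ⟨
    t / u / d ℕ.* d      ≤⟨ m/n*n≤m (t / u) d ⟩
    t / u                ≤⟨ ℕ.<⇒≤ (m<n*o⇒m/o<n t<vu) ⟩
    v                    ∎

-- The integers of absolute value below u; 0 is listed twice, which makes the length exactly 2 u.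
smallIntegers : ℕ → List ℤ
smallIntegers u = map +_ (upTo u) ++ map (λ i → ℤ.- + i) (upTo u)

length-smallIntegers : ∀ u → length (smallIntegers u) ≡ 2 ℕ.* u
length-smallIntegers u = ≡.trans (length-++ (map +_ (upTo u)))
  (≡.cong₂ ℕ._+_ (≡.trans (length-map +_ (upTo u)) (length-upTo u))
                 (≡.trans (≡.trans (length-map (λ i → ℤ.- + i) (upTo u)) (length-upTo u)) (≡.sym (ℕ.+-identityʳ u))))

-- Equal residues make d divide the difference, and equal blocks put the two quotients by d at
-- distance less than u.
code-≡ : ∀ d u {t t′} .{{_ : ℕ.NonZero d}} .{{_ : ℕ.NonZero u}} → code d u t ≡ code d u t′ →
         ∃ λ w → w ∈ smallIntegers u × + t ℤ.- + t′ ≡ + d ℤ.* w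
code-≡ d u {t} {t′} eq with quotient-remainder-unique {t / d / u} {t % d} {t′ / d / u} {t′ % d} d (m%n<n t d) (m%n<n t′ d) eq
... | blocks , residues = + a ℤ.- + a′ , small , (begin
        + t ℤ.- + t′                                            ≡⟨ ≡.cong₂ (λ p q → + p ℤ.- + q) (m≡m%n+[m/n]*n t d) (m≡m%n+[m/n]*n t′ d) ⟩
        + (t % d ℕ.+ a ℕ.* d) ℤ.- + (t′ % d ℕ.+ a′ ℕ.* d)       ≡⟨ ≡.cong (λ ρ → + (ρ ℕ.+ a ℕ.* d) ℤ.- + (t′ % d ℕ.+ a′ ℕ.* d)) residues ⟩
        + (t′ % d ℕ.+ a ℕ.* d) ℤ.- + (t′ % d ℕ.+ a′ ℕ.* d)      ≡⟨ ≡.cong₂ ℤ._-_ (push a) (push a′) ⟩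
        (+ (t′ % d) ℤ.+ + a ℤ.* + d) ℤ.- (+ (t′ % d) ℤ.+ + a′ ℤ.* + d) ≡⟨ collect (+ (t′ % d)) (+ a) (+ a′) (+ d) ⟩
        + d ℤ.* (+ a ℤ.- + a′)                                  ∎)
  where
  open ≡.≡-Reasoning
  a a′ : ℕ
  a = t / d
  a′ = t′ / d
  push : ∀ a → + (t′ % d ℕ.+ a ℕ.* d) ≡ + (t′ % d) ℤ.+ + a ℤ.* + d
  push a = ≡.trans (ℤ.pos-+ (t′ % d) (a ℕ.* d)) (≡.cong (λ q → + (t′ % d) ℤ.+ q) (ℤ.pos-* a d))
  collect : ∀ ρ a a′ d → (ρ ℤ.+ a ℤ.* d) ℤ.- (ρ ℤ.+ a′ ℤ.* d) ≡ d ℤ.* (a ℤ.- a′)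
  collect = ℤ-Solver.solve-∀
  near : ∀ {a a′} → a / u ≡ a′ / u → a ℕ.< a′ ℕ.+ u
  near {a} {a′} e = ℕ.<-≤-trans (m<n+m/n*n a u) (ℕ.≤-trans (ℕ.≤-reflexive (≡.trans (≡.cong (λ q → u ℕ.+ q ℕ.* u) e) (ℕ.+-comm u _)))
    (ℕ.+-monoˡ-≤ u (m/n*n≤m a′ u)))
  distance : ∀ {a a′} → a ℕ.≤ a′ → a′ / u ≡ a / u → ∃ λ i → i ℕ.< u × a′ ≡ a ℕ.+ i
  distance {a} {a′} a≤a′ e = a′ ℕ.∸ a , ℕ.+-cancelˡ-< a (a′ ℕ.∸ a) u (ℕ.≤-<-trans (ℕ.≤-reflexive (ℕ.m+[n∸m]≡n a≤a′)) (near e)) , ≡.sym (ℕ.m+[n∸m]≡n a≤a′)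
  small : + a ℤ.- + a′ ∈ smallIntegers u
  small with ℕ.≤-total a′ a
  ... | inj₁ a′≤a = let i , i<u , e = distance a′≤a blocks in ≡.subst (_∈ smallIntegers u)
          (≡.sym (≡.trans (≡.cong (λ q → + q ℤ.- + a′) e) (≡.trans (≡.cong (ℤ._- + a′) (ℤ.pos-+ a′ i)) (cancel₁ (+ a′) (+ i)))))
          (∈-++⁺ˡ (∈-map⁺ +_ (∈-upTo⁺ i<u)))
    where
    cancel₁ : ∀ a i → (a ℤ.+ i) ℤ.- a ≡ i
    cancel₁ = ℤ-Solver.solve-∀
  ... | inj₂ a≤a′ = let i , i<u , e = distance a≤a′ (≡.sym blocks) in ≡.subst (_∈ smallIntegers u)
          (≡.sym (≡.trans (≡.cong (λ q → + a ℤ.- + q) e) (≡.trans (≡.cong (λ q → + a ℤ.- q) (ℤ.pos-+ a i)) (cancel₂ (+ a) (+ i)))))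
          (∈-++⁺ʳ (map +_ (upTo u)) (∈-map⁺ (λ i → ℤ.- + i) (∈-upTo⁺ i<u)))
    where
    cancel₂ : ∀ a i → a ℤ.- (a ℤ.+ i) ≡ ℤ.- i
    cancel₂ = ℤ-Solver.solve-∀

∣+-+∣ : ∀ m n → ℤ.∣ + m ℤ.- + n ∣ ≡ ∣ m - n ∣
∣+-+∣ m n with ℕ.≤-total m n
... | inj₁ m≤n = ≡.trans (≡.cong ℤ.∣_∣ (ℤ.m-n≡m⊖n m n)) (≡.trans (ℤ.∣⊖∣-≤ m≤n) (≡.sym (ℕ.m≤n⇒∣m-n∣≡n∸m m≤n)))
... | inj₂ n≤m = ≡.trans (≡.cong ℤ.∣_∣ (ℤ.m-n≡m⊖n m n)) (≡.trans (ℤ.∣m⊖n∣≡∣n⊖m∣ m n)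
                   (≡.trans (ℤ.∣⊖∣-≤ n≤m) (≡.sym (ℕ.m≤n⇒∣n-m∣≡n∸m n≤m))))

-- Copies of the s × s grid, the c-th one translated by (s c , 3 s² c).  Pairs in different copies are
-- steeper than all non-vertical pairs of one copy, so a line meeting some copy twice stays inside it.
module Copies (s : ℕ) .{{_ : ℕ.NonZero s}} where

  private
    instance
      ss≢0 : ℕ.NonZero (s ℕ.* s)
      ss≢0 = ℕ.m*n≢0 s s

  -- Mixed-radix digits of an index. Consecutive indices fill one copy after another, so only the
  -- last copy can be incomplete.
  copy column row : ℕ → ℕ
  copy m   = m / (s ℕ.* s)
  column m = m % (s ℕ.* s) / s
  row m    = m % (s ℕ.* s) % s

  column< : ∀ m → column m ℕ.< s
  column< m = m<n*o⇒m/o<n (m%n<n m (s ℕ.* s))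

  row< : ∀ m → row m ℕ.< s
  row< m = m%n<n (m % (s ℕ.* s)) s

  decode : ∀ {m m′} → copy m ≡ copy m′ → column m ≡ column m′ → row m ≡ row m′ → m ≡ m′
  decode {m} {m′} p q r = ≡.trans (m≡m%n+[m/n]*n m (s ℕ.* s)) (≡.trans
    (≡.cong₂ (λ a b → a ℕ.+ b ℕ.* (s ℕ.* s))
      (≡.trans (m≡m%n+[m/n]*n (m % (s ℕ.* s)) s) (≡.trans (≡.cong₂ (λ a b → a ℕ.+ b ℕ.* s) r q) (≡.sym (m≡m%n+[m/n]*n (m′ % (s ℕ.* s)) s)))) p)
    (≡.sym (m≡m%n+[m/n]*n m′ (s ℕ.* s))))

  xℕ yℕ : ℕ → ℕ
  xℕ m = copy m ℕ.* s ℕ.+ column m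
  yℕ m = copy m ℕ.* (3 ℕ.* (s ℕ.* s)) ℕ.+ row m

  xℕ-injective : ∀ {m m′} → xℕ m ≡ xℕ m′ → copy m ≡ copy m′ × column m ≡ column m′
  xℕ-injective {m} {m′} = quotient-remainder-unique s (column< m) (column< m′)

  xyℕ-injective : ∀ {m m′} → xℕ m ≡ xℕ m′ → yℕ m ≡ yℕ m′ → m ≡ m′
  xyℕ-injective {m} {m′} p q with xℕ-injective {m} {m′} p
  ... | c , e = decode c e (ℕ.+-cancelˡ-≡ (copy m ℕ.* (3 ℕ.* (s ℕ.* s))) (row m) (row m′)
                  (≡.trans q (≡.cong (λ c → c ℕ.* (3 ℕ.* (s ℕ.* s)) ℕ.+ row m′) (≡.sym c))))

  -- Let the copies be δ + 1 apart. Horizontally the points differ by at most B = (δ + 2) s,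
  -- vertically by at least 3 (δ + 1) s² - s², as rows vary by less than s ≤ s². The factor 3 makes
  -- the latter at least s B.
  separated : ∀ {m m′} → copy m ℕ.< copy m′ → 1 ℕ.≤ ∣ xℕ m - xℕ m′ ∣ × s ℕ.* ∣ xℕ m - xℕ m′ ∣ ℕ.≤ ∣ yℕ m - yℕ m′ ∣
  separated {m} {m′} c<c′ = ≡.subst (1 ℕ.≤_) (≡.sym ∣x∣) (ℕ.m<n⇒0<n∸m x<x′)
      , (begin
          s ℕ.* ∣ xℕ m - xℕ m′ ∣      ≡⟨ ≡.cong (s ℕ.*_) ∣x∣ ⟩
          s ℕ.* (xℕ m′ ℕ.∸ xℕ m)      ≤⟨ ℕ.*-monoʳ-≤ s (ℕ.m≤n+o⇒m∸n≤o (xℕ m′) (xℕ m) x′≤) ⟩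
          s ℕ.* B                     ≤⟨ ℕ.m+n≤o⇒m≤o∸n (s ℕ.* B) (ℕ.≤-trans (ℕ.≤-reflexive (ℕ.+-comm (s ℕ.* B) (yℕ m))) y≤) ⟩
          yℕ m′ ℕ.∸ yℕ m              ≡⟨ ℕ.m≤n⇒∣m-n∣≡n∸m (ℕ.≤-trans (ℕ.m≤m+n (yℕ m) (s ℕ.* B)) y≤) ⟨
          ∣ yℕ m - yℕ m′ ∣            ∎)
    where
    open ℕ.≤-Reasoning
    δ B : ℕ
    δ = copy m′ ℕ.∸ suc (copy m)
    B = (2 ℕ.+ δ) ℕ.* s
    c′≡ : copy m′ ≡ suc (copy m) ℕ.+ δ
    c′≡ = ≡.sym (ℕ.m+[n∸m]≡n c<c′)
    x<x′ : xℕ m ℕ.< xℕ m′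
    x<x′ = quotient-<⇒< s (column< m) c<c′
    ∣x∣ : ∣ xℕ m - xℕ m′ ∣ ≡ xℕ m′ ℕ.∸ xℕ m
    ∣x∣ = ℕ.m≤n⇒∣m-n∣≡n∸m (ℕ.<⇒≤ x<x′)
    x′≤ : xℕ m′ ℕ.≤ xℕ m ℕ.+ B
    x′≤ = begin
      copy m′ ℕ.* s ℕ.+ column m′                     ≤⟨ ℕ.+-monoʳ-≤ (copy m′ ℕ.* s) (ℕ.<⇒≤ (column< m′)) ⟩
      copy m′ ℕ.* s ℕ.+ s                             ≡⟨ ≡.cong (λ c → c ℕ.* s ℕ.+ s) c′≡ ⟩
      (suc (copy m) ℕ.+ δ) ℕ.* s ℕ.+ s                ≡⟨ regroup (copy m) δ s ⟩
      copy m ℕ.* s ℕ.+ B                              ≤⟨ ℕ.+-monoˡ-≤ B (ℕ.m≤m+n (copy m ℕ.* s) (column m)) ⟩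
      xℕ m ℕ.+ B                                      ∎
      where
      regroup : ∀ c δ s → (1 ℕ.+ c ℕ.+ δ) ℕ.* s ℕ.+ s ≡ c ℕ.* s ℕ.+ (2 ℕ.+ δ) ℕ.* s
      regroup = solve-∀
    y≤ : yℕ m ℕ.+ s ℕ.* B ℕ.≤ yℕ m′
    y≤ = begin
      copy m ℕ.* (3 ℕ.* (s ℕ.* s)) ℕ.+ row m ℕ.+ s ℕ.* B
        ≤⟨ ℕ.+-monoˡ-≤ (s ℕ.* B) (ℕ.+-monoʳ-≤ (copy m ℕ.* (3 ℕ.* (s ℕ.* s))) (ℕ.≤-trans (ℕ.<⇒≤ (row< m)) (ℕ.m≤m*n s s))) ⟩
      copy m ℕ.* (3 ℕ.* (s ℕ.* s)) ℕ.+ s ℕ.* s ℕ.+ s ℕ.* B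
        ≤⟨ ℕ.m≤m+n _ (2 ℕ.* (δ ℕ.* (s ℕ.* s))) ⟩
      copy m ℕ.* (3 ℕ.* (s ℕ.* s)) ℕ.+ s ℕ.* s ℕ.+ s ℕ.* B ℕ.+ 2 ℕ.* (δ ℕ.* (s ℕ.* s))
        ≡⟨ regroup (copy m) δ s ⟩
      (suc (copy m) ℕ.+ δ) ℕ.* (3 ℕ.* (s ℕ.* s))
        ≡⟨ ≡.cong (ℕ._* (3 ℕ.* (s ℕ.* s))) c′≡ ⟨
      copy m′ ℕ.* (3 ℕ.* (s ℕ.* s))
        ≤⟨ ℕ.m≤m+n _ (row m′) ⟩
      yℕ m′ ∎
      where
      regroup : ∀ c δ s → c ℕ.* (3 ℕ.* (s ℕ.* s)) ℕ.+ s ℕ.* s ℕ.+ s ℕ.* ((2 ℕ.+ δ) ℕ.* s) ℕ.+ 2 ℕ.* (δ ℕ.* (s ℕ.* s))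
                        ≡ (1 ℕ.+ c ℕ.+ δ) ℕ.* (3 ℕ.* (s ℕ.* s))
      regroup = solve-∀

  separated′ : ∀ {m m′} → copy m ≢ copy m′ → 1 ℕ.≤ ∣ xℕ m - xℕ m′ ∣ × s ℕ.* ∣ xℕ m - xℕ m′ ∣ ℕ.≤ ∣ yℕ m - yℕ m′ ∣
  separated′ {m} {m′} c≢c′ with ℕ.<-cmp (copy m) (copy m′)
  ... | tri< c<c′ _ _ = separated c<c′
  ... | tri≈ _ c≡c′ _ = contradiction c≡c′ c≢c′
  ... | tri> _ _ c′<c rewrite ℕ.∣-∣-comm (xℕ m) (xℕ m′) | ℕ.∣-∣-comm (yℕ m) (yℕ m′) = separated c′<c

  -- Inside the copy |dy| < s. For k elsewhere, dx ≥ 1 gives |y i - y k| ≤ dx |y i - y k| = dy |x i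
  -- - x k| < s |x i - x k| ≤ |y i - y k|; and dx = 0 forces dy = 0, so i = j.
  stays-in-copy : ∀ {i j k} → i ≢ j → copy i ≡ copy j →
    ∣ xℕ i - xℕ j ∣ ℕ.* ∣ yℕ i - yℕ k ∣ ≡ ∣ yℕ i - yℕ j ∣ ℕ.* ∣ xℕ i - xℕ k ∣ → copy i ≡ copy k
  stays-in-copy {i} {j} {k} i≢j same det with copy i ℕ.≟ copy k
  ... | yes e = e
  ... | no c≢ = contradiction det (clash (∣ xℕ i - xℕ j ∣) ≡.refl)
    where
    open ℕ.≤-Reasoning
    sep : 1 ℕ.≤ ∣ xℕ i - xℕ k ∣ × s ℕ.* ∣ xℕ i - xℕ k ∣ ℕ.≤ ∣ yℕ i - yℕ k ∣
    sep = separated′ c≢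
    instance
      X≢0 : ℕ.NonZero ∣ xℕ i - xℕ k ∣
      X≢0 = ℕ.>-nonZero (proj₁ sep)
    dy<s : ∣ yℕ i - yℕ j ∣ ℕ.< s
    dy<s = begin-strict
      ∣ yℕ i - yℕ j ∣        ≡⟨ ≡.cong (λ c → ∣ yℕ i - c ℕ.* (3 ℕ.* (s ℕ.* s)) ℕ.+ row j ∣) (≡.sym same) ⟩
      ∣ copy i ℕ.* (3 ℕ.* (s ℕ.* s)) ℕ.+ row i - copy i ℕ.* (3 ℕ.* (s ℕ.* s)) ℕ.+ row j ∣
                             ≡⟨ ℕ.∣m+n-m+o∣≡∣n-o∣ (copy i ℕ.* (3 ℕ.* (s ℕ.* s))) (row i) (row j) ⟩
      ∣ row i - row j ∣      ≤⟨ ℕ.∣m-n∣≤m⊔n (row i) (row j) ⟩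
      row i ℕ.⊔ row j        <⟨ ℕ.⊔-lub (row< i) (row< j) ⟩
      s                      ∎
    clash : ∀ dx → ∣ xℕ i - xℕ j ∣ ≡ dx → ∣ xℕ i - xℕ j ∣ ℕ.* ∣ yℕ i - yℕ k ∣ ≢ ∣ yℕ i - yℕ j ∣ ℕ.* ∣ xℕ i - xℕ k ∣
    clash zero e det = i≢j (xyℕ-injective (ℕ.∣m-n∣≡0⇒m≡n e) (ℕ.∣m-n∣≡0⇒m≡n
      (ℕ.m*n≡0⇒m≡0 ∣ yℕ i - yℕ j ∣ ∣ xℕ i - xℕ k ∣ (≡.trans (≡.sym det) (≡.cong (ℕ._* ∣ yℕ i - yℕ k ∣) e)))))
    clash (suc dx) e det = ℕ.<-irrefl ≡.refl (begin-strict
      ∣ yℕ i - yℕ k ∣                            ≤⟨ ℕ.m≤m+n ∣ yℕ i - yℕ k ∣ (dx ℕ.* ∣ yℕ i - yℕ k ∣) ⟩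
      suc dx ℕ.* ∣ yℕ i - yℕ k ∣                 ≡⟨ ≡.cong (ℕ._* ∣ yℕ i - yℕ k ∣) e ⟨
      ∣ xℕ i - xℕ j ∣ ℕ.* ∣ yℕ i - yℕ k ∣        ≡⟨ det ⟩
      ∣ yℕ i - yℕ j ∣ ℕ.* ∣ xℕ i - xℕ k ∣        <⟨ ℕ.*-monoˡ-< ∣ xℕ i - xℕ k ∣ dy<s ⟩
      s ℕ.* ∣ xℕ i - xℕ k ∣                      ≤⟨ proj₂ sep ⟩
      ∣ yℕ i - yℕ k ∣                            ∎)

-- Integer scalings and the choice of parameters.

private
  scale-injective : ∀ d d′ w → + suc d ℤ.* w ≡ + suc d′ ℤ.* w → w ≢ + 0 → d ≡ d′
  scale-injective d d′ w e w≢0 = ℕ.suc-injective (ℤ.+-injective (ℤ.*-cancelʳ-≡ (+ suc d) (+ suc d′) w {{ℤ.≢-nonZero w≢0}} e))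

  scale-opposite : ∀ d d′ w → + suc d ℤ.* w ≡ ℤ.- (+ suc d′ ℤ.* w) → w ≡ + 0
  scale-opposite d d′ w e with ℤ.i*j≡0⇒i≡0∨j≡0 (+ suc d ℤ.+ + suc d′) {w} (≡.trans (ℤ.*-distribʳ-+ w (+ suc d) (+ suc d′))
                                 (≡.trans (≡.cong (ℤ._+ + suc d′ ℤ.* w) e) (ℤ.+-inverseˡ (+ suc d′ ℤ.* w))))
  ... | inj₂ w≡0 = w≡0

  swap-difference : ∀ a b → a ℤ.- b ≡ ℤ.- (b ℤ.- a)
  swap-difference = ℤ-Solver.solve-∀

  cross-multiply : ∀ d d′ w w′ → (d ℤ.* w) ℤ.* (d′ ℤ.* w′) ≡ (d ℤ.* w′) ℤ.* (d′ ℤ.* w)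
  cross-multiply = ℤ-Solver.solve-∀

  translate : ∀ c a b → (c ℤ.+ a) ℤ.- (c ℤ.+ b) ≡ a ℤ.- b
  translate = ℤ-Solver.solve-∀

-- If n > s³ then n³ > s⁹ ≥ s⁸. This is how the lower bound n^(3/8) on s is used: it limits the
-- number of copies to s.
cube≤ : ∀ n s → 1 ℕ.≤ s → n ℕ.^ 3 ℕ.≤ s ℕ.^ 8 → n ℕ.≤ s ℕ.* (s ℕ.* s)
cube≤ n s s≥1 h = ℕ.≮⇒≥ λ s³<n → ℕ.<⇒≱ (begin-strict
    s ℕ.^ 8                              ≡⟨ ℕ.*-identityˡ (s ℕ.^ 8) ⟨
    1 ℕ.* s ℕ.^ 8                        ≤⟨ ℕ.*-monoˡ-≤ (s ℕ.^ 8) s≥1 ⟩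
    s ℕ.* s ℕ.^ 8                        ≡⟨ ninth s ⟩
    (s ℕ.* (s ℕ.* s)) ℕ.^ 3              <⟨ ℕ.^-monoˡ-< 3 s³<n ⟩
    n ℕ.^ 3                              ∎) h
  where
  open ℕ.≤-Reasoning
  ninth : ∀ s → s ℕ.* (s ℕ.* (s ℕ.* (s ℕ.* (s ℕ.* (s ℕ.* (s ℕ.* (s ℕ.* (s ℕ.* 1)))))))) ≡
                (s ℕ.* (s ℕ.* s)) ℕ.* ((s ℕ.* (s ℕ.* s)) ℕ.* ((s ℕ.* (s ℕ.* s)) ℕ.* 1))
  ninth = solve-∀

-- The scale bound v balances the number of classes against the number of small vectors.
balance : ∀ s z → 2 ℕ.≤ s → 1 ℕ.≤ z → z ℕ.≤ suc s →
  ∃ λ v → ∃ λ u → 1 ℕ.≤ v × 1 ℕ.≤ u × s ℕ.≤ v ℕ.* u × u ℕ.* u ℕ.≤ z ℕ.* (v ℕ.* (v ℕ.* v))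
    × z ℕ.* v ℕ.^ 5 ℕ.≤ 128 ℕ.* (s ℕ.* s)
balance s@(suc _) z 2≤s z≥1 z≤1+s = pick (least (λ v → 4 ℕ.* (s ℕ.* s) ℕ.<? z ℕ.* v ℕ.^ 5) s enough)
  where
  open ℕ.≤-Reasoning
  enough : 4 ℕ.* (s ℕ.* s) ℕ.< z ℕ.* s ℕ.^ 5
  enough = begin-strict
    4 ℕ.* (s ℕ.* s)                      <⟨ ℕ.*-monoˡ-< (s ℕ.* s) {4} {8} (ℕ.s≤s (ℕ.s≤s (ℕ.s≤s (ℕ.s≤s (ℕ.s≤s ℕ.z≤n))))) ⟩
    8 ℕ.* (s ℕ.* s)                      ≤⟨ ℕ.*-monoˡ-≤ (s ℕ.* s) (ℕ.^-monoˡ-≤ 3 2≤s) ⟩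
    s ℕ.^ 3 ℕ.* (s ℕ.* s)                ≡⟨ fifth s ⟩
    1 ℕ.* s ℕ.^ 5                        ≤⟨ ℕ.*-monoˡ-≤ (s ℕ.^ 5) z≥1 ⟩
    z ℕ.* s ℕ.^ 5                        ∎
    where
    fifth : ∀ s → s ℕ.* (s ℕ.* (s ℕ.* 1)) ℕ.* (s ℕ.* s) ≡ 1 ℕ.* (s ℕ.* (s ℕ.* (s ℕ.* (s ℕ.* (s ℕ.* 1)))))
    fifth = solve-∀
  pick : (∃ λ v → 4 ℕ.* (s ℕ.* s) ℕ.< z ℕ.* v ℕ.^ 5 × (∀ {j} → 4 ℕ.* (s ℕ.* s) ℕ.< z ℕ.* j ℕ.^ 5 → v ℕ.≤ j)) →
    ∃ λ v → ∃ λ u → 1 ℕ.≤ v × 1 ℕ.≤ u × s ℕ.≤ v ℕ.* u × u ℕ.* u ℕ.≤ z ℕ.* (v ℕ.* (v ℕ.* v))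
      × z ℕ.* v ℕ.^ 5 ℕ.≤ 128 ℕ.* (s ℕ.* s)
  pick (zero , h , _) = contradiction (ℕ.<-≤-trans h (ℕ.≤-reflexive (ℕ.*-zeroʳ z))) λ ()
  pick (suc zero , h , _) = contradiction h (ℕ.≤⇒≯ (begin
    z ℕ.* 1            ≡⟨ ℕ.*-identityʳ z ⟩
    z                  ≤⟨ z≤1+s ⟩
    suc s              ≤⟨ ℕ.+-monoˡ-≤ s (ℕ.≤-trans (ℕ.s≤s ℕ.z≤n) 2≤s) ⟩
    s ℕ.+ s            ≤⟨ ℕ.+-mono-≤ (ℕ.m≤m*n s s) (ℕ.m≤m*n s s) ⟩
    s ℕ.* s ℕ.+ s ℕ.* s ≤⟨ ℕ.m≤m+n _ (2 ℕ.* (s ℕ.* s)) ⟩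
    s ℕ.* s ℕ.+ s ℕ.* s ℕ.+ 2 ℕ.* (s ℕ.* s) ≡⟨ four (s ℕ.* s) ⟩
    4 ℕ.* (s ℕ.* s)    ∎))
    where
    four : ∀ a → a ℕ.+ a ℕ.+ 2 ℕ.* a ≡ 4 ℕ.* a
    four = solve-∀
  -- The smaller v are excluded by z ≤ 1 + s ≤ 4 s². So v ≤ 2 v′, and minimality at v′ gives z v⁵ ≤
  -- 2⁵ · 4 s² = 128 s². Taking u = 1 + ⌊s / v⌋ yields s ≤ u v ≤ 2 s, whence u² v² ≤ 4 s² < z v⁵.
  pick (v@(suc v′@(suc _)) , h , min) = v , suc (s / v) , ℕ.s≤s ℕ.z≤n , ℕ.s≤s ℕ.z≤n
      , ℕ.≤-trans (ℕ.<⇒≤ (m<n+m/n*n s v)) (ℕ.≤-reflexive (ℕ.*-comm (suc (s / v)) v))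
      , ℕ.*-cancelʳ-≤ _ _ (v ℕ.* v) u²v²≤
      , (begin
          z ℕ.* v ℕ.^ 5                   ≤⟨ ℕ.*-monoʳ-≤ z (ℕ.^-monoˡ-≤ 5 v≤2v′) ⟩
          z ℕ.* (2 ℕ.* v′) ℕ.^ 5          ≡⟨ thirty-two z v′ ⟩
          32 ℕ.* (z ℕ.* v′ ℕ.^ 5)         ≤⟨ ℕ.*-monoʳ-≤ 32 (ℕ.≮⇒≥ λ q → ℕ.1+n≰n (min q)) ⟩
          32 ℕ.* (4 ℕ.* (s ℕ.* s))        ≡⟨ ℕ.*-assoc 32 4 (s ℕ.* s) ⟨
          128 ℕ.* (s ℕ.* s)               ∎)
    where
    v≤2v′ : v ℕ.≤ 2 ℕ.* v′
    v≤2v′ = ℕ.≤-trans (ℕ.+-monoˡ-≤ v′ (ℕ.s≤s ℕ.z≤n)) (ℕ.≤-reflexive (≡.cong (v′ ℕ.+_) (≡.sym (ℕ.+-identityʳ v′))))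
    v≤s : v ℕ.≤ s
    v≤s = min enough
    thirty-two : ∀ z v → z ℕ.* (2 ℕ.* v ℕ.* (2 ℕ.* v ℕ.* (2 ℕ.* v ℕ.* (2 ℕ.* v ℕ.* (2 ℕ.* v ℕ.* 1))))) ≡ 32 ℕ.* (z ℕ.* (v ℕ.* (v ℕ.* (v ℕ.* (v ℕ.* (v ℕ.* 1))))))
    thirty-two = solve-∀
    uv≤2s : suc (s / v) ℕ.* v ℕ.≤ 2 ℕ.* s
    uv≤2s = ℕ.≤-trans (ℕ.+-mono-≤ v≤s (m/n*n≤m s v)) (ℕ.≤-reflexive (≡.cong (s ℕ.+_) (≡.sym (ℕ.+-identityʳ s))))
    u²v²≤ : suc (s / v) ℕ.* suc (s / v) ℕ.* (v ℕ.* v) ℕ.≤ z ℕ.* (v ℕ.* (v ℕ.* v)) ℕ.* (v ℕ.* v)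
    u²v²≤ = begin
      suc (s / v) ℕ.* suc (s / v) ℕ.* (v ℕ.* v)           ≡⟨ square (suc (s / v)) v ⟩
      suc (s / v) ℕ.* v ℕ.* (suc (s / v) ℕ.* v)           ≤⟨ ℕ.*-mono-≤ uv≤2s uv≤2s ⟩
      2 ℕ.* s ℕ.* (2 ℕ.* s)                               ≡⟨ four s ⟩
      4 ℕ.* (s ℕ.* s)                                     ≤⟨ ℕ.<⇒≤ h ⟩
      z ℕ.* v ℕ.^ 5                                       ≡⟨ fifth z v ⟩
      z ℕ.* (v ℕ.* (v ℕ.* v)) ℕ.* (v ℕ.* v)               ∎
      where
      square : ∀ u v → u ℕ.* u ℕ.* (v ℕ.* v) ≡ u ℕ.* v ℕ.* (u ℕ.* v)
      square = solve-∀
      four : ∀ s → 2 ℕ.* s ℕ.* (2 ℕ.* s) ≡ 4 ℕ.* (s ℕ.* s)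
      four = solve-∀
      fifth : ∀ z v → z ℕ.* (v ℕ.* (v ℕ.* (v ℕ.* (v ℕ.* (v ℕ.* 1))))) ≡ z ℕ.* (v ℕ.* (v ℕ.* v)) ℕ.* (v ℕ.* v)
      fifth = solve-∀

-- With k = a z v², the fifth power regroups as k⁵ = a⁵ (z v⁵)² z³, which removes v. What results is
-- k⁵ s⁴ = O((z s²)³ s²), where z s² = O(n), and s² = O(n) accounts for the last factor.
final-arithmetic : ∀ a b D z v s n → z ℕ.* v ℕ.^ 5 ℕ.≤ b ℕ.* (s ℕ.* s) → z ℕ.* (s ℕ.* s) ℕ.≤ (D ℕ.* D ℕ.+ 1) ℕ.* n → s ℕ.* s ℕ.≤ D ℕ.* D ℕ.* n →
  (a ℕ.* (z ℕ.* (v ℕ.* v))) ℕ.^ 5 ℕ.* s ℕ.^ 4 ℕ.≤ a ℕ.^ 5 ℕ.* (b ℕ.* b) ℕ.* ((D ℕ.* D ℕ.+ 1) ℕ.^ 3 ℕ.* (D ℕ.* D)) ℕ.* n ℕ.^ 4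
final-arithmetic a b D z v s n zv⁵≤ zs²≤ s²≤ = begin
    (a ℕ.* (z ℕ.* (v ℕ.* v))) ℕ.^ 5 ℕ.* s ℕ.^ 4
      ≡⟨ l₁ a z v s ⟩
    a ℕ.^ 5 ℕ.* (z ℕ.* v ℕ.^ 5 ℕ.* (z ℕ.* v ℕ.^ 5)) ℕ.* (z ℕ.^ 3 ℕ.* s ℕ.^ 4)
      ≤⟨ ℕ.*-monoˡ-≤ (z ℕ.^ 3 ℕ.* s ℕ.^ 4) (ℕ.*-monoʳ-≤ (a ℕ.^ 5) (ℕ.*-mono-≤ zv⁵≤ zv⁵≤)) ⟩
    a ℕ.^ 5 ℕ.* (b ℕ.* (s ℕ.* s) ℕ.* (b ℕ.* (s ℕ.* s))) ℕ.* (z ℕ.^ 3 ℕ.* s ℕ.^ 4)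
      ≡⟨ l₂ (a ℕ.^ 5) b z s ⟩
    a ℕ.^ 5 ℕ.* (b ℕ.* b) ℕ.* ((z ℕ.* (s ℕ.* s)) ℕ.^ 3 ℕ.* (s ℕ.* s))
      ≤⟨ ℕ.*-monoʳ-≤ (a ℕ.^ 5 ℕ.* (b ℕ.* b)) (ℕ.*-mono-≤ (ℕ.^-monoˡ-≤ 3 zs²≤) s²≤) ⟩
    a ℕ.^ 5 ℕ.* (b ℕ.* b) ℕ.* (((D ℕ.* D ℕ.+ 1) ℕ.* n) ℕ.^ 3 ℕ.* (D ℕ.* D ℕ.* n))
      ≡⟨ l₃ (a ℕ.^ 5) b (D ℕ.* D ℕ.+ 1) (D ℕ.* D) n ⟩
    a ℕ.^ 5 ℕ.* (b ℕ.* b) ℕ.* ((D ℕ.* D ℕ.+ 1) ℕ.^ 3 ℕ.* (D ℕ.* D)) ℕ.* n ℕ.^ 4 ∎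
  where
  open ℕ.≤-Reasoning
  l₁ : ∀ a z v s → ((a ℕ.* (z ℕ.* (v ℕ.* v))) ℕ.* ((a ℕ.* (z ℕ.* (v ℕ.* v))) ℕ.* ((a ℕ.* (z ℕ.* (v ℕ.* v))) ℕ.* ((a ℕ.* (z ℕ.* (v ℕ.* v))) ℕ.* ((a ℕ.* (z ℕ.* (v ℕ.* v))) ℕ.* 1))))) ℕ.* (s ℕ.* (s ℕ.* (s ℕ.* (s ℕ.* 1)))) ≡ (a ℕ.* (a ℕ.* (a ℕ.* (a ℕ.* (a ℕ.* 1))))) ℕ.* (z ℕ.* (v ℕ.* (v ℕ.* (v ℕ.* (v ℕ.* (v ℕ.* 1))))) ℕ.* (z ℕ.* (v ℕ.* (v ℕ.* (v ℕ.* (v ℕ.* (v ℕ.* 1))))))) ℕ.* ((z ℕ.* (z ℕ.* (z ℕ.* 1))) ℕ.* (s ℕ.* (s ℕ.* (s ℕ.* (s ℕ.* 1)))))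
  l₁ = solve-∀
  l₂ : ∀ c b z s → c ℕ.* (b ℕ.* (s ℕ.* s) ℕ.* (b ℕ.* (s ℕ.* s))) ℕ.* ((z ℕ.* (z ℕ.* (z ℕ.* 1))) ℕ.* (s ℕ.* (s ℕ.* (s ℕ.* (s ℕ.* 1))))) ≡ c ℕ.* (b ℕ.* b) ℕ.* (((z ℕ.* (s ℕ.* s)) ℕ.* ((z ℕ.* (s ℕ.* s)) ℕ.* ((z ℕ.* (s ℕ.* s)) ℕ.* 1))) ℕ.* (s ℕ.* s))
  l₂ = solve-∀
  l₃ : ∀ c b e f n → c ℕ.* (b ℕ.* b) ℕ.* (((e ℕ.* n) ℕ.* ((e ℕ.* n) ℕ.* ((e ℕ.* n) ℕ.* 1))) ℕ.* (f ℕ.* n)) ≡ c ℕ.* (b ℕ.* b) ℕ.* ((e ℕ.* (e ℕ.* (e ℕ.* 1))) ℕ.* f) ℕ.* (n ℕ.* (n ℕ.* (n ℕ.* (n ℕ.* 1))))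
  l₃ = solve-∀

-- The upper bound for large s: translated grids.

module GridBound (𝔽 : RealClosedField) where
  open RealClosedField 𝔽 hiding (zero)
  open OrderedField 𝔽
  open Plane 𝔽
  open Solver using (solve; _:=_; _:+_; _:*_; _:-_; :-_)

  private
    determinant-a : ∀ a b u v u′ v′ → a * (u * v′ - v * u′) ≈ (a * u + b * v) * v′ - v * (a * u′ + b * v′)
    determinant-a = solve 6 (λ a b u v u′ v′ → a :* (u :* v′ :- v :* u′) := (a :* u :+ b :* v) :* v′ :- v :* (a :* u′ :+ b :* v′)) refl

    determinant-b : ∀ a b u v u′ v′ → b * (u * v′ - v * u′) ≈ u * (a * u′ + b * v′) - (a * u + b * v) * u′
    determinant-b = solve 6 (λ a b u v u′ v′ → b :* (u :* v′ :- v :* u′) := u :* (a :* u′ :+ b :* v′) :- (a :* u :+ b :* v) :* u′) refl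

    along : ∀ a b u v u′ v′ → a * (u - u′) + b * (v - v′) ≈ (a * u + b * v) - (a * u′ + b * v′)
    along = solve 6 (λ a b u v u′ v′ → a :* (u :- u′) :+ b :* (v :- v′) := (a :* u :+ b :* v) :- (a :* u′ :+ b :* v′)) refl

  -- Cramer's rule: (a , b) is a nonzero solution of the homogeneous system given by the two
  -- difference vectors.
  collinear-determinant : ∀ {a b c} (p q r : Point) → ¬ (a ≈ 0# × b ≈ 0#) → OnLine a b c p → OnLine a b c q → OnLine a b c r →
    (x p - x q) * (y p - y r) ≈ (y p - y q) * (x p - x r)
  collinear-determinant {a} {b} {c} p q r nonzero on-p on-q on-r = -≈0⇒≈ vanish
    where
    first : a * (x p - x q) + b * (y p - y q) ≈ 0#
    first = trans (along a b (x p) (y p) (x q) (y q)) (≈⇒-≈0 (trans on-p (sym on-q)))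
    second : a * (x p - x r) + b * (y p - y r) ≈ 0#
    second = trans (along a b (x p) (y p) (x r) (y r)) (≈⇒-≈0 (trans on-p (sym on-r)))
    det : Carrier
    det = (x p - x q) * (y p - y r) - (y p - y q) * (x p - x r)
    vanish : det ≈ 0#
    vanish with a ≈? 0# | b ≈? 0#
    ... | yes a≈0 | yes b≈0 = contradiction (a≈0 , b≈0) nonzero
    ... | no a≉0  | _       = *≈0⇒≈0 a≉0 (trans (determinant-a a b (x p - x q) (y p - y q) (x p - x r) (y p - y r))
            (trans (+-cong (trans (*-congʳ first) (zeroˡ _)) (-‿cong (trans (*-congˡ second) (zeroʳ _)))) (-‿inverseʳ 0#)))
    ... | yes _   | no b≉0  = *≈0⇒≈0 b≉0 (trans (determinant-b a b (x p - x q) (y p - y q) (x p - x r) (y p - y r))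
            (trans (+-cong (trans (*-congˡ second) (zeroʳ _)) (-‿cong (trans (*-congʳ first) (zeroˡ _)))) (-‿inverseʳ 0#)))

  ι-determinant : ∀ a b c d e f g h → (ι a - ι b) * (ι c - ι d) ≈ (ι e - ι f) * (ι g - ι h) →
                  (a ℤ.- b) ℤ.* (c ℤ.- d) ≡ (e ℤ.- f) ℤ.* (g ℤ.- h)
  ι-determinant a b c d e f g h p = ι-injective (trans (ι-cross a b c d) (trans p (sym (ι-cross e f g h))))

  module Points (s n : ℕ) .{{_ : ℕ.NonZero s}} where
    open Copies s

    grid : Fin n → Point
    grid m = ιℕ (xℕ (toℕ m)) , ιℕ (yℕ (toℕ m))

    grid-distinct : ∀ i j → i ≢ j → grid i ≉ₚ grid j
    grid-distinct i j i≢j (p , q) = i≢j (Fin.toℕ-injective (xyℕ-injective (ιℕ-injective p) (ιℕ-injective q)))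

    module _ (n≤s³ : n ℕ.≤ s ℕ.* (s ℕ.* s)) where

      copy<s : ∀ (m : Fin n) → copy (toℕ m) ℕ.< s
      copy<s m = m<n*o⇒m/o<n {{ℕ.m*n≢0 s s}} (ℕ.<-≤-trans (Fin.toℕ<n m) n≤s³)

      -- Three pigeonholes for s + 1 points on a line. Two share one of the at most s copies, so all
      -- lie in it; two then share a column, so the line is vertical and all lie in that column;
      -- finally two share a row and coincide.
      grid-at-most : AtMostOnLine s grid
      grid-at-most a b c nonzero g g-inj on = conclude
          (Fin.pigeonhole ℕ.≤-refl (λ i → fromℕ< (copy<s (g i))))
          (Fin.pigeonhole ℕ.≤-refl (λ i → fromℕ< (column< (G i))))
          (Fin.pigeonhole ℕ.≤-refl (λ i → fromℕ< (row< (G i))))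
        where
        G : Fin (suc s) → ℕ
        G i = toℕ (g i)
        G-injective : ∀ {i j} → G i ≡ G j → i ≡ j
        G-injective e = g-inj (Fin.toℕ-injective e)
        det : ∀ i j k → ∣ xℕ (G i) - xℕ (G j) ∣ ℕ.* ∣ yℕ (G i) - yℕ (G k) ∣ ≡ ∣ yℕ (G i) - yℕ (G j) ∣ ℕ.* ∣ xℕ (G i) - xℕ (G k) ∣
        det i j k = ≡.trans (≡.sym (absolute (xℕ (G i)) (xℕ (G j)) (yℕ (G i)) (yℕ (G k))))
          (≡.trans (≡.cong ℤ.∣_∣ (ι-determinant (+ xℕ (G i)) (+ xℕ (G j)) (+ yℕ (G i)) (+ yℕ (G k)) (+ yℕ (G i)) (+ yℕ (G j)) (+ xℕ (G i)) (+ xℕ (G k))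
                    (collinear-determinant (grid (g i)) (grid (g j)) (grid (g k)) nonzero (on i) (on j) (on k))))
                  (absolute (yℕ (G i)) (yℕ (G j)) (xℕ (G i)) (xℕ (G k))))
          where
          absolute : ∀ a b c d → ℤ.∣ (+ a ℤ.- + b) ℤ.* (+ c ℤ.- + d) ∣ ≡ ∣ a - b ∣ ℕ.* ∣ c - d ∣
          absolute a b c d = ≡.trans (ℤ.abs-* (+ a ℤ.- + b) (+ c ℤ.- + d)) (≡.cong₂ ℕ._*_ (∣+-+∣ a b) (∣+-+∣ c d))
        fromℕ<-≡ : ∀ {i j} {i<s : i ℕ.< s} {j<s : j ℕ.< s} → fromℕ< i<s ≡ fromℕ< j<s → i ≡ j
        fromℕ<-≡ {i<s = i<s} {j<s} = Fin.fromℕ<-injective _ _ i<s j<s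
        Collision : (ℕ → ℕ) → Set
        Collision φ = ∃ λ i → ∃ λ j → i ≢ j × φ (G i) ≡ φ (G j)
        finish : Collision copy → Collision column → Collision row → ⊥
        finish (i , j , i≢j , c≡) (i′ , j′ , i′≢j′ , e≡) (i″ , j″ , i″≢j″ , f≡) =
            i″≢j″ (G-injective (decode (one-copy i″ j″) (one-column i″ j″) f≡))
          where
          same-copy : ∀ k → copy (G i) ≡ copy (G k)
          same-copy k = stays-in-copy (i≢j ∘ G-injective) c≡ (det i j k)
          one-copy : ∀ k l → copy (G k) ≡ copy (G l)
          one-copy k l = ≡.trans (≡.sym (same-copy k)) (same-copy l)
          x≡ : xℕ (G i′) ≡ xℕ (G j′)
          x≡ = ≡.cong₂ (λ c e → c ℕ.* s ℕ.+ e) (one-copy i′ j′) e≡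
          x≡0 : ∀ k → ∣ yℕ (G i′) - yℕ (G j′) ∣ ℕ.* ∣ xℕ (G i′) - xℕ (G k) ∣ ≡ 0
          x≡0 k = ≡.trans (≡.sym (det i′ j′ k)) (≡.cong (ℕ._* ∣ yℕ (G i′) - yℕ (G k) ∣) (ℕ.m≡n⇒∣m-n∣≡0 x≡))
          vertical : ∀ k → xℕ (G i′) ≡ xℕ (G k)
          vertical k = split (ℕ.m*n≡0⇒m≡0∨n≡0 ∣ yℕ (G i′) - yℕ (G j′) ∣ (x≡0 k))
            where
            split : ∣ yℕ (G i′) - yℕ (G j′) ∣ ≡ 0 ⊎ ∣ xℕ (G i′) - xℕ (G k) ∣ ≡ 0 → xℕ (G i′) ≡ xℕ (G k)
            split (inj₁ e) = contradiction (G-injective (xyℕ-injective x≡ (ℕ.∣m-n∣≡0⇒m≡n e))) i′≢j′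
            split (inj₂ e) = ℕ.∣m-n∣≡0⇒m≡n e
          one-column : ∀ k l → column (G k) ≡ column (G l)
          one-column k l = proj₂ (xℕ-injective {G k} {G l} (≡.trans (≡.sym (vertical k)) (vertical l)))
        conclude : _ → _ → _ → ⊥
        conclude (i , j , i<j , c≡) (i′ , j′ , i′<j′ , e≡) (i″ , j″ , i″<j″ , f≡) = finish
          (i , j , Fin.<⇒≢ i<j , fromℕ<-≡ {i<s = copy<s (g i)} {copy<s (g j)} c≡)
          (i′ , j′ , Fin.<⇒≢ i′<j′ , fromℕ<-≡ {i<s = column< (G i′)} {column< (G j′)} e≡)
          (i″ , j″ , Fin.<⇒≢ i″<j″ , fromℕ<-≡ {i<s = row< (G i″)} {row< (G j″)} f≡)

    -- For every scale d ≤ v, any two points in a common class differ by d w with w a small vector, and w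
    -- recovers the pair (by its slope) and d.  So all but one point of each class, for each scale,
    -- are charged injectively to the 4 u² small vectors.
    module _ {z u v K : ℕ} .{{_ : ℕ.NonZero u}} (copy<z : ∀ (m : Fin n) → copy (toℕ m) ℕ.< z) (s≤vu : s ℕ.≤ v ℕ.* u)
             (g : Fin K → Fin n) (g-inj : Injective _≡_ _≡_ g) (distinct : DistinctSlopes (λ i → grid (g i))) where

      private
        X Y : Fin K → ℕ
        X i = xℕ (toℕ (g i))
        Y i = yℕ (toℕ (g i))

        scale : Fin v → ℕ
        scale d = suc (toℕ d)

        Class : Set
        Class = ℕ × ℕ × ℕ

        class : Fin v → Fin K → Class
        class d i = copy (toℕ (g i)) , code (scale d) u (column (toℕ (g i))) , code (scale d) u (row (toℕ (g i)))

        classes : List Class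
        classes = cartesianProduct (upTo z) (cartesianProduct (upTo (2 ℕ.* v)) (upTo (2 ℕ.* v)))

        class∈ : ∀ d i → class d i ∈ classes
        class∈ d i = ∈-cartesianProduct⁺ (∈-upTo⁺ (copy<z (g i))) (∈-cartesianProduct⁺
          (∈-upTo⁺ (code< (scale d) u (Fin.toℕ<n d) (ℕ.<-≤-trans (column< (toℕ (g i))) s≤vu)))
          (∈-upTo⁺ (code< (scale d) u (Fin.toℕ<n d) (ℕ.<-≤-trans (row< (toℕ (g i))) s≤vu))))

        Target : Set
        Target = (Fin v × Class) ⊎ (ℤ × ℤ)

        vectors : List (ℤ × ℤ)
        vectors = cartesianProduct (smallIntegers u) (smallIntegers u)

        targets : List Target
        targets = map inj₁ (cartesianProduct (allFin v) classes) ++ map inj₂ vectors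

        -- Either `i` is the first point of its class at scale `d`, or a difference to another point
        -- is `d` times the vector. The second case need not remember the class: the vector's slope
        -- already identifies the pair.
        Charge : Fin v × Fin K → Target → Set
        Charge (d , i) (inj₁ (d′ , c)) = d ≡ d′ × class d i ≡ c × (∀ j → toℕ j ℕ.< toℕ i → class d j ≢ class d i)
        Charge (d , i) (inj₂ (w , w′)) = ∃ λ j → j ≢ i × (+ X i ℤ.- + X j ≡ + scale d ℤ.* w) × (+ Y i ℤ.- + Y j ≡ + scale d ℤ.* w′)

        class-≟ : ∀ (c c′ : Class) → Dec (c ≡ c′)
        class-≟ = ≡-dec ℕ._≟_ (≡-dec ℕ._≟_ ℕ._≟_)

        charge : ∀ x → ∃ λ y → y ∈ targets × Charge x y
        charge (d , i) with Fin.any? (λ j → (toℕ j ℕ.<? toℕ i) ×-dec class-≟ (class d j) (class d i))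
        ... | no none = inj₁ (d , class d i)
              , ∈-++⁺ˡ (∈-map⁺ inj₁ (∈-cartesianProduct⁺ (∈-allFin d) (class∈ d i)))
              , ≡.refl , ≡.refl , λ j j<i e → none (j , j<i , e)
        ... | yes (j , j<i , e) =
              let w , w∈ , p = code-≡ (scale d) u {column (toℕ (g i))} {column (toℕ (g j))} (≡.sym (,-injectiveˡ (,-injectiveʳ e)))
                  w′ , w′∈ , p′ = code-≡ (scale d) u {row (toℕ (g i))} {row (toℕ (g j))} (≡.sym (,-injectiveʳ (,-injectiveʳ e)))
              in inj₂ (w , w′)
              , ∈-++⁺ʳ (map inj₁ (cartesianProduct (allFin v) classes)) (∈-map⁺ inj₂ (∈-cartesianProduct⁺ w∈ w′∈))
              , j , (λ { ≡.refl → ℕ.<-irrefl ≡.refl j<i })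
              , ≡.trans (difference s (column (toℕ (g i))) (column (toℕ (g j)))) p
              , ≡.trans (difference (3 ℕ.* (s ℕ.* s)) (row (toℕ (g i))) (row (toℕ (g j)))) p′
          where
          ci cj : ℕ
          ci = copy (toℕ (g i))
          cj = copy (toℕ (g j))
          difference : ∀ t a b → + (ci ℕ.* t ℕ.+ a) ℤ.- + (cj ℕ.* t ℕ.+ b) ≡ + a ℤ.- + b
          difference t a b = ≡.trans (≡.cong (λ c → + (ci ℕ.* t ℕ.+ a) ℤ.- + (c ℕ.* t ℕ.+ b)) (,-injectiveˡ e))
            (≡.trans (≡.cong₂ ℤ._-_ (ℤ.pos-+ (ci ℕ.* t) a) (ℤ.pos-+ (ci ℕ.* t) b)) (translate (+ (ci ℕ.* t)) (+ a) (+ b)))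

        parallel : ∀ {i j i′ j′ d d′ w w′} →
          + X i ℤ.- + X j ≡ d ℤ.* w → + Y i ℤ.- + Y j ≡ d ℤ.* w′ →
          + X i′ ℤ.- + X j′ ≡ d′ ℤ.* w → + Y i′ ℤ.- + Y j′ ≡ d′ ℤ.* w′ →
          SameSlope (grid (g j)) (grid (g i)) (grid (g j′)) (grid (g i′))
        parallel {i} {j} {i′} {j′} {d} {d′} {w} {w′} p q p′ q′ =
          trans (sym (ι-cross (+ X i) (+ X j) (+ Y i′) (+ Y j′))) (trans (reflexive (≡.cong ι equal)) (ι-cross (+ Y i) (+ Y j) (+ X i′) (+ X j′)))
          where
          equal : (+ X i ℤ.- + X j) ℤ.* (+ Y i′ ℤ.- + Y j′) ≡ (+ Y i ℤ.- + Y j) ℤ.* (+ X i′ ℤ.- + X j′)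
          equal = ≡.trans (≡.cong₂ ℤ._*_ p q′) (≡.trans (cross-multiply d d′ w w′) (≡.sym (≡.cong₂ ℤ._*_ q p′)))

        coincide : ∀ {i j d w w′} → i ≢ j → + X i ℤ.- + X j ≡ + scale d ℤ.* w → + Y i ℤ.- + Y j ≡ + scale d ℤ.* w′ → w ≡ + 0 → w′ ≢ + 0
        coincide {i} {j} {d} i≢j p q ≡.refl ≡.refl = i≢j (g-inj (Fin.toℕ-injective (xyℕ-injective (equal p) (equal q))))
          where
          equal : ∀ {a b} → + a ℤ.- + b ≡ + scale d ℤ.* + 0 → a ≡ b
          equal {a} {b} e = ℤ.+-injective (ℤ.i-j≡0⇒i≡j (+ a) (+ b) (≡.trans e (ℤ.*-zeroʳ (+ scale d))))

        -- Pairs with the same vector are parallel, hence equal up to order. In the same order, a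
        -- nonzero coordinate of the vector determines the scale; in opposite order, d w = - d′ w
        -- with positive d and d′ makes both coordinates 0, so that the two points would coincide.
        charge-injective : ∀ {x x′ y} → Charge x y → Charge x′ y → x ≡ x′
        charge-injective {d , i} {d′ , i′} {inj₁ (_ , _)} (≡.refl , ≡.refl , first) (≡.refl , e , first′) with ℕ.<-cmp (toℕ i) (toℕ i′)
        ... | tri< i<i′ _ _ = contradiction (≡.sym e) (first′ i i<i′)
        ... | tri≈ _ i≡i′ _ = ≡.cong (d ,_) (Fin.toℕ-injective i≡i′)
        ... | tri> _ _ i′<i = contradiction e (first i′ i′<i)
        charge-injective {d , i} {d′ , i′} {inj₂ (w , w′)} (j , j≢i , p , q) (j′ , j′≢i′ , p′ , q′)
          with (j Fin.≟ j′) ×-dec (i Fin.≟ i′) | (j Fin.≟ i′) ×-dec (i Fin.≟ j′)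
        ... | no ¬same | no ¬swap = contradiction (parallel {d = + scale d} {+ scale d′} p q p′ q′) (distinct j i j′ i′ j≢i j′≢i′
                                      λ { (inj₁ e) → ¬same e ; (inj₂ e) → ¬swap e })
        ... | yes (≡.refl , ≡.refl) | _ = ≡.cong (_, i) (Fin.toℕ-injective (same-scale (w ℤ.≟ + 0)))
          where
          same-scale : Dec (w ≡ + 0) → toℕ d ≡ toℕ d′
          same-scale (no w≢0)  = scale-injective (toℕ d) (toℕ d′) w (≡.trans (≡.sym p) p′) w≢0
          same-scale (yes w≡0) = scale-injective (toℕ d) (toℕ d′) w′ (≡.trans (≡.sym q) q′) (coincide {d = d} (j≢i ∘ ≡.sym) p q w≡0)
        ... | no _ | yes (≡.refl , ≡.refl) = contradiction
                (scale-opposite (toℕ d) (toℕ d′) w′ (opposite (+ Y i) (+ Y i′) q q′))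
                (coincide {d = d} (j≢i ∘ ≡.sym) p q (scale-opposite (toℕ d) (toℕ d′) w (opposite (+ X i) (+ X i′) p p′)))
          where
          opposite : ∀ a b {e f} → a ℤ.- b ≡ e → b ℤ.- a ≡ f → e ≡ ℤ.- f
          opposite a b e f = ≡.trans (≡.sym e) (≡.trans (swap-difference a b) (≡.cong ℤ.-_ f))

        length-targets : length targets ≡ v ℕ.* (z ℕ.* (2 ℕ.* v ℕ.* (2 ℕ.* v))) ℕ.+ 2 ℕ.* u ℕ.* (2 ℕ.* u)
        length-targets = ≡.trans (length-++ (map inj₁ (cartesianProduct (allFin v) classes))) (≡.cong₂ ℕ._+_
          (≡.trans (length-map inj₁ (cartesianProduct (allFin v) classes)) (≡.trans (length-× (allFin v) classes)
            (≡.cong₂ ℕ._*_ (length-allFin v) (≡.trans (length-× (upTo z) _) (≡.cong₂ ℕ._*_ (length-upTo z)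
              (≡.trans (length-× (upTo (2 ℕ.* v)) (upTo (2 ℕ.* v))) (≡.cong₂ ℕ._*_ (length-upTo (2 ℕ.* v)) (length-upTo (2 ℕ.* v)))))))))
          (≡.trans (length-map inj₂ vectors) (≡.trans (length-× (smallIntegers u) (smallIntegers u))
            (≡.cong₂ ℕ._*_ (length-smallIntegers u) (length-smallIntegers u)))))

      few-points : v ℕ.* K ℕ.≤ v ℕ.* (z ℕ.* (2 ℕ.* v ℕ.* (2 ℕ.* v))) ℕ.+ 2 ℕ.* u ℕ.* (2 ℕ.* u)
      few-points = begin
        v ℕ.* K                                           ≡⟨ ≡.cong₂ ℕ._*_ (length-allFin v) (length-allFin K) ⟨
        length (allFin v) ℕ.* length (allFin K)           ≡⟨ length-× (allFin v) (allFin K) ⟨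
        length (cartesianProduct (allFin v) (allFin K))   ≤⟨ length-≤-via {ys = targets} Charge
                                                               (Unique.cartesianProduct⁺ (Unique.allFin⁺ v) (Unique.allFin⁺ K))
                                                               (λ {x} _ → charge x) (λ {x} {x′} {y} _ _ → charge-injective {x} {x′} {y}) ⟩
        length targets                                    ≡⟨ length-targets ⟩
        v ℕ.* (z ℕ.* (2 ℕ.* v ℕ.* (2 ℕ.* v))) ℕ.+ 2 ℕ.* u ℕ.* (2 ℕ.* u) ∎
        where open ℕ.≤-Reasoning

  upper-bound-grid : ∀ (D : ℕ) → ∃ λ (C : ℕ) → ∃ λ (N : ℕ) →
    ∀ (n s : ℕ) → N ℕ.≤ n → 2 ℕ.≤ s → s ℕ.≤ n → n ℕ.^ 3 ℕ.≤ s ℕ.^ 8 → s ℕ.* s ℕ.≤ D ℕ.* D ℕ.* n →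
    ∃ λ (k : ℕ) → h≤ n s k × k ℕ.^ 5 ℕ.* s ℕ.^ 4 ℕ.≤ C ℕ.* n ℕ.^ 4
  upper-bound-grid D = 8 ℕ.^ 5 ℕ.* (128 ℕ.* 128) ℕ.* ((D ℕ.* D ℕ.+ 1) ℕ.^ 3 ℕ.* (D ℕ.* D)) , 0 , λ n s _ 2≤s _ n³≤s⁸ s²≤ →
      bound n s 2≤s {{ℕ.>-nonZero (ℕ.≤-trans (ℕ.s≤s ℕ.z≤n) 2≤s)}} (cube≤ n s (ℕ.≤-trans (ℕ.s≤s ℕ.z≤n) 2≤s) n³≤s⁸) s²≤ 8 128 ℕ.≤-refl ℕ.≤-refl
    where
    open ℕ.≤-Reasoning
    bound : ∀ n s → 2 ℕ.≤ s → .{{_ : ℕ.NonZero s}} → n ℕ.≤ s ℕ.* (s ℕ.* s) → s ℕ.* s ℕ.≤ D ℕ.* D ℕ.* n →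
      ∀ a b → 8 ℕ.≤ a → 128 ℕ.≤ b →
      ∃ λ k → h≤ n s k × k ℕ.^ 5 ℕ.* s ℕ.^ 4 ℕ.≤ a ℕ.^ 5 ℕ.* (b ℕ.* b) ℕ.* ((D ℕ.* D ℕ.+ 1) ℕ.^ 3 ℕ.* (D ℕ.* D)) ℕ.* n ℕ.^ 4
    bound n s 2≤s {{s≢0}} n≤s³ s²≤ a b 8≤a 128≤b =
      let v , u , v≥1 , u≥1 , s≤vu , u²≤ , zv⁵≤ = balance s z 2≤s (ℕ.s≤s ℕ.z≤n) (ℕ.s≤s z≤s)
      -- Here `a` stands for 8 and `b` for 128. The 8 is 4 + 4: there are (2 v)² pairs of codes per
      -- copy, and (2 u)² ≤ 4 z v³ vectors.
      in a ℕ.* (z ℕ.* (v ℕ.* v))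
       , ((grid , grid-distinct) , grid-at-most n≤s³ , λ (g , g-inj , distinct) →
            crowded v u v≥1 u²≤ (few-points {v = v} {{ℕ.>-nonZero u≥1}} copy<z s≤vu g g-inj distinct))
       , final-arithmetic a b D z v s n (ℕ.≤-trans zv⁵≤ (ℕ.*-monoˡ-≤ (s ℕ.* s) 128≤b)) zs²≤ s²≤
      where
      open Copies s
      open Points s n {{s≢0}}
      instance
        ss≢0 : ℕ.NonZero (s ℕ.* s)
        ss≢0 = ℕ.m*n≢0 s s
      z : ℕ
      -- The extra copy accommodates an incomplete last one; it costs s² ≤ D² n in z s².
      z = suc (n / (s ℕ.* s))
      z≤s : n / (s ℕ.* s) ℕ.≤ s
      z≤s = ℕ.*-cancelʳ-≤ (n / (s ℕ.* s)) s (s ℕ.* s) (ℕ.≤-trans (m/n*n≤m n (s ℕ.* s)) n≤s³)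
      zs²≤ : z ℕ.* (s ℕ.* s) ℕ.≤ (D ℕ.* D ℕ.+ 1) ℕ.* n
      zs²≤ = ℕ.≤-trans (ℕ.+-mono-≤ s²≤ (m/n*n≤m n (s ℕ.* s))) (ℕ.≤-reflexive (≡.trans
        (≡.cong (D ℕ.* D ℕ.* n ℕ.+_) (≡.sym (ℕ.*-identityˡ n))) (≡.sym (ℕ.*-distribʳ-+ n (D ℕ.* D) 1))))
      copy<z : ∀ (m : Fin n) → copy (toℕ m) ℕ.< z
      copy<z m = ℕ.s≤s (/-monoˡ-≤ (s ℕ.* s) (ℕ.<⇒≤ (Fin.toℕ<n m)))
      crowded : ∀ v u → 1 ℕ.≤ v → u ℕ.* u ℕ.≤ z ℕ.* (v ℕ.* (v ℕ.* v)) →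
                ¬ (v ℕ.* suc (a ℕ.* (z ℕ.* (v ℕ.* v))) ℕ.≤ v ℕ.* (z ℕ.* (2 ℕ.* v ℕ.* (2 ℕ.* v))) ℕ.+ 2 ℕ.* u ℕ.* (2 ℕ.* u))
      crowded v u v≥1 u²≤ h = ℕ.<⇒≱ (begin-strict
        v ℕ.* (z ℕ.* (2 ℕ.* v ℕ.* (2 ℕ.* v))) ℕ.+ 2 ℕ.* u ℕ.* (2 ℕ.* u)    ≡⟨ ≡.cong (v ℕ.* (z ℕ.* (2 ℕ.* v ℕ.* (2 ℕ.* v))) ℕ.+_) (four u) ⟩
        v ℕ.* (z ℕ.* (2 ℕ.* v ℕ.* (2 ℕ.* v))) ℕ.+ 4 ℕ.* (u ℕ.* u)          ≤⟨ ℕ.+-monoʳ-≤ (v ℕ.* (z ℕ.* (2 ℕ.* v ℕ.* (2 ℕ.* v)))) (ℕ.*-monoʳ-≤ 4 u²≤) ⟩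
        v ℕ.* (z ℕ.* (2 ℕ.* v ℕ.* (2 ℕ.* v))) ℕ.+ 4 ℕ.* (z ℕ.* (v ℕ.* (v ℕ.* v))) ≡⟨ eight v z ⟩
        8 ℕ.* (v ℕ.* (z ℕ.* (v ℕ.* v)))                                    ≤⟨ ℕ.*-monoˡ-≤ (v ℕ.* (z ℕ.* (v ℕ.* v))) 8≤a ⟩
        a ℕ.* (v ℕ.* (z ℕ.* (v ℕ.* v)))                                    <⟨ ℕ.+-monoˡ-≤ (a ℕ.* (v ℕ.* (z ℕ.* (v ℕ.* v)))) v≥1 ⟩
        v ℕ.+ a ℕ.* (v ℕ.* (z ℕ.* (v ℕ.* v)))                              ≡⟨ collect v a (z ℕ.* (v ℕ.* v)) ⟩
        v ℕ.* suc (a ℕ.* (z ℕ.* (v ℕ.* v)))                                ∎) h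
        where
        four : ∀ u → 2 ℕ.* u ℕ.* (2 ℕ.* u) ≡ 4 ℕ.* (u ℕ.* u)
        four = solve-∀
        eight : ∀ v z → v ℕ.* (z ℕ.* (2 ℕ.* v ℕ.* (2 ℕ.* v))) ℕ.+ 4 ℕ.* (z ℕ.* (v ℕ.* (v ℕ.* v))) ≡ 8 ℕ.* (v ℕ.* (z ℕ.* (v ℕ.* v)))
        eight = solve-∀
        collect : ∀ v a q → v ℕ.+ a ℕ.* (v ℕ.* q) ≡ v ℕ.* (1 ℕ.+ a ℕ.* q)
        collect = solve-∀

open import Data.Nat using (ℕ; _+_; _*_; _^_; _≤_)

theorem1p6 : (𝔽 : RealClosedField) → let open Plane 𝔽 in
    (∀ (C : ℕ) → ∃ λ (d : ℕ) → ∃ λ (N : ℕ) →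
    ∀ (n s : ℕ) → N ≤ n → 2 ≤ s → s ≤ n → s * s ≤ C * C * n →
    ∃ λ (k : ℕ) → h≥ n s k × n ≤ d * (k ^ 3 * ⌈log₂ s ⌉))
    ×
    (∃ λ (C : ℕ) → ∃ λ (N : ℕ) →
    ∀ (n s : ℕ) → N ≤ n → 2 ≤ s → s ≤ n → s ^ 8 ≤ n ^ 3 →
    ∃ λ (k : ℕ) → h≤ n s k × k * k ≤ C * C * n)
    ×
    (∀ (D : ℕ) → ∃ λ (C : ℕ) → ∃ λ (N : ℕ) →
    ∀ (n s : ℕ) → N ≤ n → 2 ≤ s → s ≤ n → n ^ 3 ≤ s ^ 8 → s * s ≤ D * D * n →
    ∃ λ (k : ℕ) → h≤ n s k × k ^ 5 * s ^ 4 ≤ C * n ^ 4)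
theorem1p6 𝔽 = LowerBound.lower-bound 𝔽 , Parabola.upper-bound-√n 𝔽 , GridBound.upper-bound-grid 𝔽
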